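{- Let $H$ be a graph with at least two vertices, and let $\tau(H)$ be the minimum size of a vertex cover of $H$. Let $H^{\tau(H)}$ be a $\tau(H)$-colorized graph of $H$ whose each colored subgraph is isomorphic to a star and such that the set of the centers of these stars is a minimum vertex cover of $H$. Then the multiset $M=\mathrm{DS}(H^{\tau(H)})$ of $\tau(H)$-colored degrees is an extended profile of $\mathcal{S}(H)$. Moreover, for a host graph $G$ with ordered edges $e_1,\dots,e_m$ and maximum frontier size $w=\max_{i\in[m]}|F_i|$, there is an algorithm to construct a $(\tau(H)+1)$-DD $\mathbf{Z}^{\tau(H)+1}(\mathcal{C}_M^*)$ over $E(G)$, i.e. one representing the family of all $\tau(H)$-colored subgraphs of $G$ satisfying $\mathcal{C}_M^*$, with width at most $$2^{O(\tau(H)\,w\log w)+|V(H)|}\,\bigl(2^{\tau(H)}\,\tau(H)\bigr)^{w}.$$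
   Context: All graphs are finite and simple; $[k]=\{1,\dots,k\}$; $\mathbb{N}$ is the set of non-negative integers; the number $c$ of colors is always a positive integer; $O(\cdot)$ is the usual big-O notation. A vertex cover of $H$ is a set $S\subseteq V(H)$ such that every edge of $H$ has at least one endpoint in $S$. A star is a graph isomorphic to $K_{1,a}$ for some positive integer $a$; its center is the vertex of the part of size one (for $K_{1,1}$, either endpoint may be designated as the center). Subdivisions. Subdividing an edge $\{u,v\}$ means removing it, adding a new vertex $x$ and the edges $\{u,x\},\{v,x\}$. A subdivision of $H$ is any graph obtained from $H$ by subdividing edges an arbitrary number (possibly zero) of times. $\mathcal{S}(H)$ is the family of subdivisions of $H$ (considered up to isomorphism). Colored graphs. A $c$-colored subset over a finite set $E$ is a $c$-tuple $(D_1,\dots,D_c)$ of pairwise disjoint subsets of $E$. A $c$-colored graph is a finite vertex set $U$ together with a $c$-colored subset $(D_1,\dots,D_c)$ over the set of unordered pairs of distinct elements of $U$; edges in $D_i$ have color $i$. Its underlying graph is obtained by forgetting colors; it is a $c$-colorized graph of $F$ if its underlying graph is isomorphic to $F$. A $c$-colored degree is a tuple in $\mathbb{N}^c$. The colored degree of a vertex $u$ is the $c$-tuple $(\delta_1,\dots,\delta_c)$ where $\delta_i$ is the number of color-$i$ edges incident to $u$. $\mathrm{DS}(F^c)$ is the multiset of colored degrees of all vertices of $F^c$. The color-$i$ subgraph of $F^c$ consists of the color-$i$ edges and their endpoints; these are the colored subgraphs of $F^c$. Extended profile. Let $\Delta^c$ be the set of the $c$ tuples in $\mathbb{N}^c$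 with one entry equal to $2$ and all other entries $0$. For a multiset $M$ of $c$-colored degrees, a $c$-colored graph $F^c$ satisfies $\mathcal{C}_M^*$ if and only if (a) $\mathrm{DS}(F^c)$ is obtained by adding to $M$ an arbitrary number (possibly zero) of elements of $\Delta^c$, repetitions allowed, and (b) for each $i\in[c]$ the color-$i$ subgraph of $F^c$ is connected. $M$ is an extended profile of $\mathcal{S}(H)$ if for every graph $F$: $F$ belongs to $\mathcal{S}(H)$ if and only if there exists a $c$-colorized graph $F^c$ of $F$ satisfying $\mathcal{C}_M^*$. Colored subgraphs of $G$. A $c$-colored subgraph of $G$ is identified with a $c$-colored subset $(D_1,\dots,D_c)$ over $E(G)$; it stands for the edge-induced $c$-colored graph whose vertices are the endpoints of edges in $D_1\cup\dots\cup D_c$. Frontier. The $i$-th frontier $F_i$ is the set of vertices of $G$ incident both to some edge in $\{e_1,\dots,e_{i-1}\}$ and to some edge in $\{e_i,\dots,e_m\}$. Decision diagrams. A $(c+1)$-DD over $E=\{e_1,\dots,e_m\}$ is a finite directed acyclic graph with a unique root node and two terminal nodes $\top,\bot$ (no outgoing arcs). Each non-terminal node $\alpha$ has a label $\ell(\alpha)\in[m]$ and exactly $c+1$ outgoing arcs, called its $0$-arc, $1$-arc, ..., $c$-arc; each arc from $\alpha$ points to a terminal node or to a non-terminal node with label $\ell(\alpha)+1$. A directed path from the root to $\top$ represents the $c$-colored subset $(B_1,\dots,B_c)$ with $B_j=\{e_{\ell(\beta)} : \text{the path uses the } j\text{ -arc of } \beta\}$. The DD represents the family of all $c$-colored subsets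 represented by its root-to-$\top$ paths. Its width is the maximum number of nodes with the same label. -}

module Defs where

open import Data.Empty using (⊥)
open import Data.Fin.Base using (Fin; zero; suc; toℕ)
import Data.Fin.Properties as Fin
open import Data.Fin.Subset using (Subset; _∈_; ∣_∣; ⁅_⁆; ⋃)
open import Data.Fin.Subset.Properties using (_∈?_)
open import Data.List.Base using (List; _++_; allFin; filter; length; lookup; map)
open import Data.List.Extrema.Nat using (max)
open import Data.List.Relation.Binary.Permutation.Propositional using (_↭_)
open import Data.List.Relation.Unary.All using (All)
open import Data.Nat.Base using (ℕ; zero; suc; _≤_; _<_)
import Data.Nat.Properties as ℕ
open import Data.Product.Base using (∃-syntax; _×_; _,_; proj₁; proj₂)
open import Data.Sum.Base using (_⊎_; inj₁; inj₂)
open import Data.Unit.Base using (⊤; tt)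
open import Data.Vec.Base as Vec using (Vec)
open import Function.Base using (_on_; _∘_)
open import Function.Bundles using (_↔_; _⇔_; Inverse)
open import Level using (0ℓ)
open import Relation.Binary.Construct.Closure.ReflexiveTransitive using (Star)
open import Relation.Binary.Core using (Rel)
open import Relation.Binary.Definitions using (Decidable; Symmetric; Irreflexive)
open import Relation.Binary.PropositionalEquality using (_≡_; _≢_; refl; sym; trans; cong; subst)
open import Relation.Nullary using (yes; no; ¬_; ¬?; _×-dec_; _⊎-dec_)

record Graph : Set₁ where
  field
    order    : ℕ
    _~_      : Rel (Fin order) 0ℓ
    _~?_     : Decidable _~_
    ~-sym    : Symmetric _~_
    ~-irrefl : Irreflexive _≡_ _~_

  Vertex : Set
  Vertex = Fin order

record _≅_ (G H : Graph) : Set where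
  private
    module G = Graph G
    module H = Graph H
  field
    bijection : G.Vertex ↔ H.Vertex

  to : G.Vertex → H.Vertex
  to = Inverse.to bijection

  field
    adjacency : ∀ u v → (u G.~ v) ⇔ (to u H.~ to v)

-- Vacuously true of the graph without vertices.
Connected : Graph → Set
Connected G = ∀ u v → Star _~_ u v
  where open Graph G

SamePair : ∀ {A : Set} → A × A → A × A → Set
SamePair (a , b) (u , v) = (a ≡ u × b ≡ v) ⊎ (a ≡ v × b ≡ u)

samePair? : ∀ {n} → Decidable (SamePair {Fin n})
samePair? (a , b) (u , v) =
  (a Fin.≟ u ×-dec b Fin.≟ v) ⊎-dec (a Fin.≟ v ×-dec b Fin.≟ u)

samePair-swap : ∀ {A : Set} {a b u v : A} → SamePair (a , b) (u , v) → SamePair (b , a) (u , v)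
samePair-swap (inj₁ (p , q)) = inj₂ (q , p)
samePair-swap (inj₂ (p , q)) = inj₁ (q , p)

samePair-sym : ∀ {A : Set} {p q : A × A} → SamePair p q → SamePair q p
samePair-sym (inj₁ (refl , refl)) = inj₁ (refl , refl)
samePair-sym (inj₂ (refl , refl)) = inj₂ (refl , refl)

samePair-trans : ∀ {A : Set} {p q r : A × A} → SamePair p q → SamePair q r → SamePair p r
samePair-trans (inj₁ (refl , refl)) s = s
samePair-trans (inj₂ (refl , refl)) s = samePair-swap s

module _ (G : Graph) where
  open Graph G

  -- The new vertex is zero; an old vertex w becomes suc w.
  SubdivideAdj : Vertex → Vertex → Rel (Fin (suc order)) 0ℓ
  SubdivideAdj u v zero    zero    = ⊥
  SubdivideAdj u v zero    (suc b) = b ≡ u ⊎ b ≡ v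
  SubdivideAdj u v (suc a) zero    = a ≡ u ⊎ a ≡ v
  SubdivideAdj u v (suc a) (suc b) = (a ~ b) × ¬ SamePair (a , b) (u , v)

  subdivide : (u v : Vertex) → u ~ v → Graph
  subdivide u v _ = record
    { order    = suc order
    ; _~_      = SubdivideAdj u v
    ; _~?_     = dec
    ; ~-sym    = λ {a} {b} → symm a b
    ; ~-irrefl = λ { {a} refl → irr a }
    }
    where
    dec : Decidable (SubdivideAdj u v)
    dec zero    zero    = no λ ()
    dec zero    (suc b) = b Fin.≟ u ⊎-dec b Fin.≟ v
    dec (suc a) zero    = a Fin.≟ u ⊎-dec a Fin.≟ v
    dec (suc a) (suc b) = (a ~? b) ×-dec ¬? (samePair? (a , b) (u , v))

    symm : ∀ a b → SubdivideAdj u v a b → SubdivideAdj u v b a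
    symm zero    (suc b) p       = p
    symm (suc a) zero    p       = p
    symm (suc a) (suc b) (p , q) = ~-sym p , q ∘ samePair-swap

    irr : ∀ a → ¬ SubdivideAdj u v a a
    irr zero    ()
    irr (suc a) (p , _) = ~-irrefl refl p

data Subdivided (H : Graph) : Graph → Set₁ where
  none : Subdivided H H
  step : ∀ {F} → Subdivided H F → ∀ u v (u~v : Graph._~_ F u v) →
         Subdivided H (subdivide F u v u~v)

𝒮 : Graph → Graph → Set₁
𝒮 H F = ∃[ F′ ] Subdivided H F′ × F ≅ F′

module _ (H : Graph) where
  open Graph H

  IsVertexCover : Subset order → Set
  IsVertexCover S = ∀ u v → u ~ v → u ∈ S ⊎ v ∈ S

  IsMinimumVertexCover : Subset order → Set
  IsMinimumVertexCover S = IsVertexCover S × (∀ S′ → IsVertexCover S′ → ∣ S ∣ ≤ ∣ S′ ∣)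

  -- The number τ(H), as a predicate on t.
  IsVertexCoverNumber : ℕ → Set
  IsVertexCoverNumber t = ∃[ S ] IsMinimumVertexCover S × ∣ S ∣ ≡ t

record ColoredGraph (c : ℕ) : Set₁ where
  field
    order    : ℕ
    D        : Fin c → Rel (Fin order) 0ℓ
    D?       : ∀ i → Decidable (D i)
    D-sym    : ∀ i → Symmetric (D i)
    D-irrefl : ∀ i → Irreflexive _≡_ (D i)
    disjoint : ∀ {i j u v} → D i u v → D j u v → i ≡ j

  Vertex : Set
  Vertex = Fin order

  degree : Vertex → Fin c → ℕ
  degree u i = length (filter (D? i u) (allFin order))

  coloredDegree : Vertex → Vec ℕ c
  coloredDegree u = Vec.tabulate (degree u)

  -- The multiset of colored degrees; multisets are lists up to _↭_.
  DS : List (Vec ℕ c)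
  DS = map coloredDegree (allFin order)

  underlying : Graph
  underlying = record
    { order    = order
    ; _~_      = λ u v → ∃[ i ] D i u v
    ; _~?_     = λ u v → Fin.any? λ i → D? i u v
    ; ~-sym    = λ (i , p) → i , D-sym i p
    ; ~-irrefl = λ eq (i , p) → D-irrefl i eq p
    }

  colorGraph : Fin c → Graph
  colorGraph i = record
    { order    = order
    ; _~_      = D i
    ; _~?_     = D? i
    ; ~-sym    = D-sym i
    ; ~-irrefl = D-irrefl i
    }

-- The vertices that are an endpoint of some edge, in increasing order.
-- Position k of this list becomes vertex k of the edge-induced graph.
endpoints : (G : Graph) → List (Graph.Vertex G)
endpoints G = filter (λ u → Fin.any? (λ v → u ~? v)) (allFin order)
  where open Graph G

edgeInduced : Graph → Graph
edgeInduced G = record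
  { order    = length (endpoints G)
  ; _~_      = _~_ on lookup (endpoints G)
  ; _~?_     = λ u v → lookup (endpoints G) u ~? lookup (endpoints G) v
  ; ~-sym    = ~-sym
  ; ~-irrefl = λ eq → ~-irrefl (cong (lookup (endpoints G)) eq)
  }
  where open Graph G

edgeInducedColored : ∀ {c} → ColoredGraph c → ColoredGraph c
edgeInducedColored F = record
  { order    = length vs
  ; D        = λ i → D i on lookup vs
  ; D?       = λ i u v → D? i (lookup vs u) (lookup vs v)
  ; D-sym    = λ i → D-sym i
  ; D-irrefl = λ i eq → D-irrefl i (cong (lookup vs) eq)
  ; disjoint = disjoint
  }
  where
  open ColoredGraph F
  vs = endpoints underlying

colorSubgraph : ∀ {c} → ColoredGraph c → Fin c → Graph
colorSubgraph F i = edgeInduced (ColoredGraph.colorGraph F i)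

StarAdj : ∀ {a} → Rel (Fin (suc a)) 0ℓ
StarAdj zero    zero    = ⊥
StarAdj zero    (suc _) = ⊤
StarAdj (suc _) zero    = ⊤
StarAdj (suc _) (suc _) = ⊥

K₁ : ℕ → Graph
K₁ a = record
  { order    = suc a
  ; _~_      = StarAdj
  ; _~?_     = dec
  ; ~-sym    = λ {u} {v} → symm u v
  ; ~-irrefl = λ { {u} refl → irr u }
  }
  where
  dec : Decidable (StarAdj {a})
  dec zero    zero    = no λ ()
  dec zero    (suc _) = yes tt
  dec (suc _) zero    = yes tt
  dec (suc _) (suc _) = no λ ()

  symm : ∀ u v → StarAdj {a} u v → StarAdj v u
  symm zero    (suc _) p = p
  symm (suc _) zero    p = p

  irr : ∀ u → ¬ StarAdj {a} u u
  irr zero    ()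
  irr (suc _) ()

-- The isomorphism designates the center, which matters only for K₁,₁.
record IsStar (G : Graph) : Set where
  field
    leaves   : ℕ
    leaves≥1 : 1 ≤ leaves
    iso      : K₁ leaves ≅ G

  center : Graph.Vertex G
  center = _≅_.to iso zero

-- F is a colorized graph of H whose colored subgraphs are stars and whose
-- star centers form a minimum vertex cover of H.
record IsStarColorization {c : ℕ} (H : Graph) (F : ColoredGraph c) : Set where
  open ColoredGraph F using (underlying; colorGraph)
  field
    colorizes : underlying ≅ H
    star      : ∀ i → IsStar (colorSubgraph F i)

  center : Fin c → Graph.Vertex H
  center i = _≅_.to colorizes (lookup (endpoints (colorGraph i)) (IsStar.center (star i)))

  centers : Subset (Graph.order H)
  centers = ⋃ (map (λ i → ⁅ center i ⁆) (allFin c))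

  field
    centers-minimum : IsMinimumVertexCover H centers

module _ {c : ℕ} where

  InΔ : Vec ℕ c → Set
  InΔ δ = ∃[ i ] Vec.lookup δ i ≡ 2 × (∀ j → j ≢ i → Vec.lookup δ j ≡ 0)

  SatisfiesC* : List (Vec ℕ c) → ColoredGraph c → Set
  SatisfiesC* M F =
    (∃[ L ] All InΔ L × ColoredGraph.DS F ↭ M ++ L) ×
    (∀ i → Connected (colorSubgraph F i))

  IsExtendedProfile : List (Vec ℕ c) → (Graph → Set₁) → Set₁
  IsExtendedProfile M 𝓕 =
    ∀ F → 𝓕 F ⇔ (∃[ Fᶜ ] ColoredGraph.underlying Fᶜ ≅ F × SatisfiesC* M Fᶜ)

record EdgeOrdering (G : Graph) : Set where
  open Graph G
  field
    size      : ℕ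
    ends      : Fin size → Vertex × Vertex
    sound     : ∀ e → proj₁ (ends e) ~ proj₂ (ends e)
    complete  : ∀ {u v} → u ~ v → ∃[ e ] SamePair (ends e) (u , v)
    injective : ∀ {e f} → SamePair (ends e) (ends f) → e ≡ f

  Incident : Vertex → Fin size → Set
  Incident v e = v ≡ proj₁ (ends e) ⊎ v ≡ proj₂ (ends e)

  incident? : Decidable Incident
  incident? v e = v Fin.≟ proj₁ (ends e) ⊎-dec v Fin.≟ proj₂ (ends e)

  InFrontier : Fin size → Vertex → Set
  InFrontier i v =
    (∃[ e ] toℕ e < toℕ i × Incident v e) × (∃[ e ] toℕ i ≤ toℕ e × Incident v e)

  inFrontier? : Decidable InFrontier
  inFrontier? i v =
    Fin.any? (λ e → toℕ e ℕ.<? toℕ i ×-dec incident? v e) ×-dec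
    Fin.any? (λ e → toℕ i ℕ.≤? toℕ e ×-dec incident? v e)

  frontier : Fin size → List Vertex
  frontier i = filter (inFrontier? i) (allFin order)

  -- Zero when there are no edges.
  maxFrontierSize : ℕ
  maxFrontierSize = max 0 (map (length ∘ frontier) (allFin size))

record ColoredSubset (c m : ℕ) : Set where
  field
    D        : Fin c → Subset m
    disjoint : ∀ {i j e} → e ∈ D i → e ∈ D j → i ≡ j

coloredSubgraph : ∀ {c G} (E : EdgeOrdering G) → ColoredSubset c (EdgeOrdering.size E) →
                  ColoredGraph c
coloredSubgraph {c} {G} E B = edgeInducedColored spanning
  where
  open Graph G
  open EdgeOrdering E
  open ColoredSubset B

  spanning : ColoredGraph c
  spanning = record
    { order    = order
    ; D        = λ i u v → ∃[ e ] e ∈ D i × SamePair (u , v) (ends e)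
    ; D?       = λ i u v → Fin.any? λ e → (e ∈? D i) ×-dec samePair? (u , v) (ends e)
    ; D-sym    = λ _ (e , e∈ , p) → e , e∈ , samePair-swap p
    ; D-irrefl = λ { _ refl (e , _ , inj₁ (p , q)) → ~-irrefl (trans (sym p) q) (sound e)
                   ; _ refl (e , _ , inj₂ (p , q)) → ~-irrefl (trans (sym q) p) (sound e) }
    ; disjoint = λ { {i} (e , e∈ , p) (f , f∈ , q) →
        disjoint e∈ (subst (_∈ D _) (sym (injective (samePair-trans (samePair-sym p) q))) f∈) }
    }

data Terminal : Set where
  ⊤ᵗ ⊥ᵗ : Terminal

-- Acyclicity follows from arc-label.  The root may be a terminal, which is
-- unavoidable when m = 0.
record DD (c m : ℕ) : Set where
  field
    size  : ℕ
    label : Fin size → Fin m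

  Node : Set
  Node = Terminal ⊎ Fin size

  field
    arc         : Fin size → Fin (suc c) → Node
    arc-label   : ∀ α j {β} → arc α j ≡ inj₂ β → toℕ (label β) ≡ suc (toℕ (label α))
    root        : Node
    -- Every non-terminal other than the root has an incoming arc.
    root-unique : ∀ β → inj₂ β ≡ root ⊎ (∃[ α ] ∃[ j ] arc α j ≡ inj₂ β)

  data PathTo⊤ : Node → Set where
    done : PathTo⊤ (inj₁ ⊤ᵗ)
    step : ∀ α j → PathTo⊤ (arc α j) → PathTo⊤ (inj₂ α)

  Uses : ∀ {ν} → PathTo⊤ ν → Fin size → Fin (suc c) → Set
  Uses done         β k = ⊥
  Uses (step α j p) β k = (α ≡ β × j ≡ k) ⊎ Uses p β k

  -- Color j of Fin c corresponds to the arc suc j; the arc zero is the 0-arc.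
  RepresentedBy : ColoredSubset c m → PathTo⊤ root → Set
  RepresentedBy B p =
    ∀ j e → e ∈ ColoredSubset.D B j ⇔ (∃[ β ] label β ≡ e × Uses p β (suc j))

  Represents : (ColoredSubset c m → Set) → Set
  Represents 𝓕 = ∀ B → (∃[ p ] RepresentedBy B p) ⇔ 𝓕 B

  width : ℕ
  width = max 0 (map (λ l → length (filter (λ α → label α Fin.≟ l) (allFin size))) (allFin m))

{-# OPTIONS --safe #-}
-- Each color class of a graph satisfying C*_M is a subdivided star.  A connected
-- graph has at least T - 1 edges, and the degrees in M leave room for exactly
-- that many, so the classes are trees in which everything but the vertices of H
-- has degree 2.  Adjacency in a star is determined by its degrees, so M
-- determines H; a vertex added by Δ can be smoothed because its two neighbors
-- are nonadjacent: within one color because of the tree, between two colors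
-- because H is simple.
--
-- A node of the diagram is a class of accepted words whose prefixes have the
-- same completions.  The class is determined by the part of M already used
-- (at most 2^|M| possibilities) and, for each frontier vertex and color, its
-- degree and its component.  One frontier degree per color may be forgotten:
-- exchanging prefixes keeps every color connected, and the edge bound applied
-- to both exchanges recovers it.  Hence degrees are needed only up to 3, the
-- center alone exceeding 2, and for frontiers of size at most 1 a single bit per
-- color suffices.
module Submission where

open import Defs
open import Data.Bool.Base using (if_then_else_)
open import Data.Empty using (⊥)
open import Data.Fin.Base using (Fin; zero; suc; toℕ; fromℕ<; punchIn; punchOut; inject≤; inject₁; combine; remQuot; funToFin; finToFun)
import Data.Fin.Properties as Fin
import Data.Fin.Subset as Subset
import Data.Fin.Subset.Properties as Subset
open import Data.List.Base using (List; []; _∷_; _++_; allFin; filter; length; lookup; map; cartesianProduct; cartesianProductWith; tabulate)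
open import Data.List.Extrema.Nat using (max<v⁺; xs≤max)
import Data.List.Membership.DecPropositional as DecMembership
open import Data.List.Membership.Propositional using (_∈_; _∉_; lose)
open import Data.List.Membership.Propositional.Properties using (∈-filter⁺; ∈-filter⁻; ∈-map⁺; ∈-map⁻; ∈-allFin; ∈-lookup; ∈-∃++; ∈-++⁺ˡ; ∈-++⁺ʳ; ∈-++⁻; ∈-length; ∈-tabulate⁻; ∈-cartesianProduct⁺; ∈-cartesianProductWith⁺)
import Data.List.Properties as List
open import Data.List.Relation.Binary.Permutation.Propositional using (_↭_; ↭-refl; ↭-sym; ↭-trans; prep; ↭⇒↭ₛ)
import Data.List.Relation.Binary.Permutation.Propositional.Properties as ↭
import Data.List.Relation.Binary.Permutation.Setoid.Properties as Setoid↭ₚ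
open import Data.List.Relation.Unary.All as All using (All; []; _∷_)
import Data.List.Relation.Unary.All.Properties as All
open import Data.List.Relation.Unary.AllPairs using ([]; _∷_)
open import Data.List.Relation.Unary.Any as Any using (Any; here; there)
import Data.List.Relation.Unary.Any.Properties as Any
open import Data.List.Relation.Unary.Unique.Propositional using (Unique)
import Data.List.Relation.Unary.Unique.Propositional.Properties as Unique
open import Data.Nat.Base using (ℕ; zero; suc; _≤_; _<_; z≤n; s≤s; _+_; _*_; _^_; _∸_; _⊓_; >-nonZero)
open import Data.Nat.ListAction using (sum)
open import Data.Nat.ListAction.Properties using (sum-++; sum-↭)
open import Data.Nat.Logarithm using (⌊log₂_⌋; ⌊log₂⌋-mono-≤; ⌊log₂[2^n]⌋≡n)
import Data.Nat.Properties as ℕ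
open import Data.Nat.Tactic.RingSolver using (solve-∀)
open import Data.Product.Base using (Σ-syntax; ∃-syntax; _×_; _,_; proj₁; proj₂)
open import Data.Sum.Base using (_⊎_; inj₁; inj₂; [_,_]′)
open import Data.Unit.Base using (⊤; tt)
open import Data.Vec.Base as Vec using (Vec)
import Data.Vec.Properties as Vec
open import Function.Base using (_∘_; id)
open import Function.Bundles using (_⇔_; mk⇔; Equivalence; Inverse; mk↔ₛ′)
open import Level using (0ℓ)
open import Relation.Binary.Construct.Closure.ReflexiveTransitive as Star using (Star; ε; _◅_; _◅◅_)
open import Relation.Binary.Core using (Rel)
open import Relation.Binary.Definitions using (Decidable; DecidableEquality; Symmetric; Irreflexive)
open import Relation.Binary.PropositionalEquality using (_≡_; _≢_; refl; sym; trans; cong; cong₂; subst; subst₂; setoid; module ≡-Reasoning)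
open import Relation.Nullary using (Dec; yes; no; does; ¬_; ¬?; _×-dec_; _⊎-dec_; _→-dec_; contradiction)
import Relation.Nullary.Decidable as Dec

-- The degree of a star center grows with `H`, while the bound grants `H` only the factor
-- `2 ^ |V(H)|`, which is spent on the used part of `M`; a state therefore cannot store exact
-- frontier degrees. What rescues the count is that states are taken only from prefixes of accepted
-- words. Such a prefix comes with a completion of its own, in which every color satisfies (number
-- of leaves) = (sum of the excesses over 2) + 2 exactly, whereas a connected color class of any
-- other splice satisfies the same relation with ≤. Vertices of degree 0 and 2 are invisible to it,
-- hence so is everything contributed by Δ, and one unknown degree per color can be solved for.
--
-- The separate treatment of frontiers of size at most 1 is forced by the rounded logarithm:
-- `⌊log₂ w⌋` is then 0, so no constant in the exponent helps, and all that is stored at the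
-- frontier has to be paid by the factor `(2 ^ c) ^ w`.

𝟙 : {P : Set} → Dec P → ℕ
𝟙 p? = if does p? then 1 else 0

𝟙-yes : {P : Set} (p? : Dec P) → P → 𝟙 p? ≡ 1
𝟙-yes (yes _) _ = refl
𝟙-yes (no ¬p) p = contradiction p ¬p

𝟙-no : {P : Set} (p? : Dec P) → ¬ P → 𝟙 p? ≡ 0
𝟙-no (yes p) ¬p = contradiction p ¬p
𝟙-no (no _)  _  = refl

𝟙-⇔ : {P Q : Set} (p? : Dec P) (q? : Dec Q) → (P → Q) → (Q → P) → 𝟙 p? ≡ 𝟙 q?
𝟙-⇔ (yes p) q? f g = sym (𝟙-yes q? (f p))
𝟙-⇔ (no ¬p) q? f g = sym (𝟙-no q? (¬p ∘ g))

𝟙-split : {P Q : Set} (p? : Dec P) (q? : Dec Q) → 𝟙 (p? ×-dec q?) + 𝟙 (p? ×-dec ¬? q?) ≡ 𝟙 p?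
𝟙-split (yes _) (yes _) = refl
𝟙-split (yes _) (no _)  = refl
𝟙-split (no _)  (yes _) = refl
𝟙-split (no _)  (no _)  = refl

𝟙-⊎ : {P Q : Set} (p? : Dec P) (q? : Dec Q) → (P → ¬ Q) → 𝟙 (p? ⊎-dec q?) ≡ 𝟙 p? + 𝟙 q?
𝟙-⊎ (yes p) (yes q) excl = contradiction q (excl p)
𝟙-⊎ (yes _) (no _)  excl = refl
𝟙-⊎ (no _)  (yes _) excl = refl
𝟙-⊎ (no _)  (no _)  excl = refl

-- Finite sums over lists

module _ {A : Set} where

  ∑ : List A → (A → ℕ) → ℕ
  ∑ xs f = sum (map f xs)

  ∑-cong : ∀ xs {f g : A → ℕ} → (∀ x → f x ≡ g x) → ∑ xs f ≡ ∑ xs g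
  ∑-cong xs eq = cong sum (List.map-cong eq xs)

  ∑-zero : ∀ xs {f : A → ℕ} → (∀ {x} → x ∈ xs → f x ≡ 0) → ∑ xs f ≡ 0
  ∑-zero []       eq = refl
  ∑-zero (x ∷ xs) eq = cong₂ _+_ (eq (here refl)) (∑-zero xs (eq ∘ there))

  ∑-mono : ∀ xs {f g : A → ℕ} → (∀ x → f x ≤ g x) → ∑ xs f ≤ ∑ xs g
  ∑-mono []       le = z≤n
  ∑-mono (x ∷ xs) le = ℕ.+-mono-≤ (le x) (∑-mono xs le)

  ∑-+ : ∀ xs (f g : A → ℕ) → ∑ xs (λ x → f x + g x) ≡ ∑ xs f + ∑ xs g
  ∑-+ []       f g = refl
  ∑-+ (x ∷ xs) f g = trans (cong (f x + g x +_) (∑-+ xs f g)) (shuffle (f x) (g x) _ _)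
    where
    shuffle : ∀ a b c d → a + b + (c + d) ≡ a + c + (b + d)
    shuffle = solve-∀

  ∑-++ : ∀ xs ys (f : A → ℕ) → ∑ (xs ++ ys) f ≡ ∑ xs f + ∑ ys f
  ∑-++ xs ys f = trans (cong sum (List.map-++ f xs ys)) (sum-++ (map f xs) (map f ys))

  ∑-↭ : ∀ {xs ys} (f : A → ℕ) → xs ↭ ys → ∑ xs f ≡ ∑ ys f
  ∑-↭ f p = sum-↭ (↭.map⁺ f p)

  length-filter-∑ : ∀ {P : A → Set} (P? : ∀ x → Dec (P x)) xs →
                    length (filter P? xs) ≡ ∑ xs (𝟙 ∘ P?)
  length-filter-∑ P? []       = refl
  length-filter-∑ P? (x ∷ xs) with P? x
  ... | yes _ = cong suc (length-filter-∑ P? xs)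
  ... | no _  = length-filter-∑ P? xs

  ∑-filter : ∀ {P : A → Set} (P? : ∀ x → Dec (P x)) (f : A → ℕ) xs →
             (∀ x → ¬ P x → f x ≡ 0) → ∑ (filter P? xs) f ≡ ∑ xs f
  ∑-filter P? f []       z = refl
  ∑-filter P? f (x ∷ xs) z with P? x
  ... | yes _ = cong (f x +_) (∑-filter P? f xs z)
  ... | no ¬p = trans (∑-filter P? f xs z) (cong (_+ ∑ xs f) (sym (z x ¬p)))

  ∑-partition : ∀ {P : A → Set} (P? : ∀ x → Dec (P x)) (f : A → ℕ) xs →
                ∑ xs f ≡ ∑ (filter (¬? ∘ P?) xs) f + ∑ (filter P? xs) f
  ∑-partition P? f []       = refl
  ∑-partition P? f (x ∷ xs) with P? x
  ... | no _  = trans (cong (f x +_) (∑-partition P? f xs)) (sym (ℕ.+-assoc (f x) _ _))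
  ... | yes _ = trans (cong (f x +_) (∑-partition P? f xs)) (shuffle (f x) (∑ (filter (¬? ∘ P?) xs) f) _)
    where
    shuffle : ∀ a b c → a + (b + c) ≡ b + (a + c)
    shuffle = solve-∀

  ∑-cong-∈ : ∀ xs {f g : A → ℕ} → (∀ {x} → x ∈ xs → f x ≡ g x) → ∑ xs f ≡ ∑ xs g
  ∑-cong-∈ []       eq = refl
  ∑-cong-∈ (x ∷ xs) eq = cong₂ _+_ (eq (here refl)) (∑-cong-∈ xs (eq ∘ there))

  ∑-member-≤ : ∀ {x xs} (f : A → ℕ) → x ∈ xs → f x ≤ ∑ xs f
  ∑-member-≤ f (here refl) = ℕ.m≤m+n _ _
  ∑-member-≤ f (there {y} x∈) = ℕ.≤-trans (∑-member-≤ f x∈) (ℕ.m≤n+m _ (f y))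

  length-as-∑ : ∀ xs → length {A = A} xs ≡ ∑ xs (λ _ → 1)
  length-as-∑ []       = refl
  length-as-∑ (x ∷ xs) = cong suc (length-as-∑ xs)

  ∈⇒↭ : ∀ {x : A} {xs} → x ∈ xs → ∃[ zs ] xs ↭ x ∷ zs
  ∈⇒↭ {x} x∈ with ys , zs , refl ← ∈-∃++ x∈ = ys ++ zs , ↭.shift x ys zs

  -- Each entry of `xs` is taken out of `ys` once, and uniqueness keeps later entries from needing
  -- the position just removed. The comparisons of sums and cardinalities along inclusions rest on
  -- this.
  unique-⊆⇒↭ : ∀ {xs ys : List A} → Unique xs → (∀ {x} → x ∈ xs → x ∈ ys) →
               ∃[ zs ] ys ↭ xs ++ zs
  unique-⊆⇒↭ {[]}     {ys} _        _ = ys , ↭-refl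
  unique-⊆⇒↭ {x ∷ xs} (x∉ ∷ uniq) sub
    with zs , ys↭ ← ∈⇒↭ (sub (here refl))
    with ws , zs↭ ← unique-⊆⇒↭ uniq (λ y∈ → Any.tail (λ { refl → All.lookup x∉ y∈ refl }) (↭.∈-resp-↭ ys↭ (sub (there y∈))))
    = ws , ↭-trans ys↭ (prep x zs↭)

  ∑-⊆ : ∀ {xs ys : List A} (f : A → ℕ) → Unique xs → (∀ {x} → x ∈ xs → x ∈ ys) →
        ∑ xs f ≤ ∑ ys f
  ∑-⊆ {xs} f uniq sub with zs , ys↭ ← unique-⊆⇒↭ uniq sub =
    ℕ.≤-trans (ℕ.m≤m+n _ (∑ zs f)) (ℕ.≤-reflexive (sym (trans (∑-↭ f ys↭) (∑-++ xs zs f))))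

  length-⊆ : ∀ {xs ys : List A} → Unique xs → (∀ {x} → x ∈ xs → x ∈ ys) →
             length xs ≤ length ys
  length-⊆ {xs} {ys} uniq sub =
    subst₂ _≤_ (sym (length-as-∑ xs)) (sym (length-as-∑ ys)) (∑-⊆ (λ _ → 1) uniq sub)

  module _ {B : Set} (f : A → B) where

    unique-map-on : ∀ {xs} → (∀ {x y} → x ∈ xs → y ∈ xs → f x ≡ f y → x ≡ y) →
                    Unique xs → Unique (map f xs)
    unique-map-on inj []          = []
    unique-map-on inj (x∉ ∷ uniq) =
      All.map⁺ (All.tabulate λ y∈ eq → All.lookup x∉ y∈ (inj (here refl) (there y∈) eq)) ∷
      unique-map-on (λ x∈ y∈ → inj (there x∈) (there y∈)) uniq

∑-map : ∀ {A B : Set} (g : B → A) (f : A → ℕ) xs → ∑ (map g xs) f ≡ ∑ xs (f ∘ g)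
∑-map g f xs = cong sum (sym (List.map-∘ xs))

module _ {A : Set} where

  first : A → List A → A
  first d []      = d
  first d (x ∷ _) = x

  first-∈ : ∀ {d z : A} {xs} → z ∈ xs → first d xs ∈ xs
  first-∈ {xs = x ∷ xs} _ = here refl

  -- Lets every member of a class supply itself as the default and still arrive at the same
  -- representative.
  first-default : ∀ {d d′ z : A} {xs} → z ∈ xs → first d xs ≡ first d′ xs
  first-default {xs = x ∷ xs} _ = refl

-- Multiplicities in lists

module _ {A : Set} (_≟_ : DecidableEquality A) where

  count : A → List A → ℕ
  count x xs = ∑ xs (λ y → 𝟙 (x ≟ y))

  ∈⇒count≥1 : ∀ {x xs} → x ∈ xs → 1 ≤ count x xs
  ∈⇒count≥1 {x} x∈ = ℕ.≤-trans (ℕ.≤-reflexive (sym (𝟙-yes (x ≟ x) refl))) (∑-member-≤ _ x∈)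

  count≥1⇒∈ : ∀ {x} xs → 1 ≤ count x xs → x ∈ xs
  count≥1⇒∈ {x} (y ∷ xs) c with x ≟ y
  ... | yes refl = here refl
  ... | no _     = there (count≥1⇒∈ xs c)

  counts-≤⇒↭ : ∀ ys {xs} → (∀ x → count x ys ≤ count x xs) → ∃[ zs ] xs ↭ ys ++ zs
  counts-≤⇒↭ []       {xs} le = xs , ↭-refl
  counts-≤⇒↭ (y ∷ ys) {xs} le
    with zs , xs↭ ← ∈⇒↭ (count≥1⇒∈ xs (ℕ.≤-trans (∈⇒count≥1 {xs = y ∷ ys} (here refl)) (le y)))
    with ws , zs↭ ← counts-≤⇒↭ ys {zs} (λ x → ℕ.+-cancelˡ-≤ (𝟙 (x ≟ y)) _ _
           (ℕ.≤-trans (le x) (ℕ.≤-reflexive (∑-↭ _ xs↭))))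
    = ws , ↭-trans xs↭ (prep y zs↭)

  counts-≡⇒↭ : ∀ {xs ys} → (∀ x → count x xs ≡ count x ys) → xs ↭ ys
  counts-≡⇒↭ {xs} {ys} eq with counts-≤⇒↭ ys {xs} (λ x → ℕ.≤-reflexive (sym (eq x)))
  ... | []     , xs↭ = ↭-trans xs↭ (↭.++-identityʳ ys)
  ... | z ∷ zs , xs↭ = contradiction (trans (sym (trans (∑-↭ _ xs↭) (∑-++ ys (z ∷ zs) _))) (eq z))
                         (ℕ.m+1+n≢m _ ∘ trans (cong (count z ys +_) (cong (_+ count z zs) (sym (𝟙-yes (z ≟ z) refl)))))

-- Sums over Fin n

∑ᶠ : ∀ {n} → (Fin n → ℕ) → ℕ
∑ᶠ {n} = ∑ (allFin n)

# : ∀ {n} {P : Fin n → Set} → (∀ i → Dec (P i)) → ℕ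
# {n} P? = length (filter P? (allFin n))

#-∑ : ∀ {n} {P : Fin n → Set} (P? : ∀ i → Dec (P i)) → # P? ≡ ∑ᶠ (𝟙 ∘ P?)
#-∑ P? = length-filter-∑ P? (allFin _)

#-cong : ∀ {n} {P Q : Fin n → Set} (P? : ∀ i → Dec (P i)) (Q? : ∀ i → Dec (Q i)) →
         (∀ i → P i → Q i) → (∀ i → Q i → P i) → # P? ≡ # Q?
#-cong P? Q? f g = cong length (List.filter-≐ P? Q? ((λ {i} → f i) , (λ {i} → g i)) (allFin _))

#-embed : ∀ {n m} {P : Fin n → Set} {Q : Fin m → Set} (P? : ∀ i → Dec (P i)) (Q? : ∀ i → Dec (Q i))
          (e : Fin n → Fin m) → (∀ {i j} → e i ≡ e j → i ≡ j) →
          (∀ i → P i → Q (e i)) → (∀ j → Q j → ∃[ i ] e i ≡ j × P i) → # P? ≡ # Q?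
#-embed {n} {m} P? Q? e inj to from = trans (sym (List.length-map e (filter P? (allFin n))))
  (ℕ.≤-antisym
    (length-⊆ (Unique.map⁺ inj (Unique.filter⁺ P? (Unique.allFin⁺ n))) forth)
    (length-⊆ (Unique.filter⁺ Q? (Unique.allFin⁺ m)) back))
  where
  forth : ∀ {j} → j ∈ map e (filter P? (allFin _)) → j ∈ filter Q? (allFin _)
  forth j∈ with i , i∈ , refl ← ∈-map⁻ e j∈ =
    ∈-filter⁺ Q? (∈-allFin _) (to i (proj₂ (∈-filter⁻ P? {xs = allFin _} i∈)))

  back : ∀ {j} → j ∈ filter Q? (allFin _) → j ∈ map e (filter P? (allFin _))
  back j∈ with i , refl , p ← from _ (proj₂ (∈-filter⁻ Q? {xs = allFin _} j∈)) =
    ∈-map⁺ e (∈-filter⁺ P? (∈-allFin _) p)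

#≤ : ∀ {n N} {P : Fin n → Set} (P? : ∀ i → Dec (P i)) (f : Fin n → Fin N) →
     (∀ {i j} → P i → P j → f i ≡ f j → i ≡ j) → # P? ≤ N
#≤ {n} {N} P? f inj = subst₂ _≤_ (List.length-map f (filter P? (allFin n))) (List.length-tabulate {n = N} id)
  (length-⊆ (unique-map-on f
     (λ i∈ j∈ → inj (proj₂ (∈-filter⁻ P? {xs = allFin _} i∈)) (proj₂ (∈-filter⁻ P? {xs = allFin _} j∈)))
     (Unique.filter⁺ P? (Unique.allFin⁺ _)))
     (λ _ → ∈-allFin _))

#≥1 : ∀ {n} {P : Fin n → Set} (P? : ∀ i → Dec (P i)) {i} → P i → 1 ≤ # P?
#≥1 P? p = ∈-length (∈-filter⁺ P? (∈-allFin _) p)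

#≥1⁻ : ∀ {n} {P : Fin n → Set} (P? : ∀ i → Dec (P i)) → 1 ≤ # P? → ∃[ i ] P i
#≥1⁻ P? le with filter P? (allFin _) in eq
#≥1⁻ P? ()  | []
#≥1⁻ P? _   | i ∷ _ = i , proj₂ (∈-filter⁻ P? {xs = allFin _} (subst (i ∈_) (sym eq) (here refl)))

#≡0 : ∀ {n} {P : Fin n → Set} (P? : ∀ i → Dec (P i)) → (∀ i → ¬ P i) → # P? ≡ 0
#≡0 P? never = trans (#-∑ P?) (∑-zero (allFin _) λ {i} _ → 𝟙-no (P? i) (never i))

#≤1 : ∀ {n} {P : Fin n → Set} (P? : ∀ i → Dec (P i)) →
      # P? ≤ 1 → ∀ {i j} → P i → P j → i ≡ j
#≤1 P? le {i} {j} p q with i Fin.≟ j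
... | yes i≡j = i≡j
... | no  i≢j = contradiction (ℕ.≤-trans (length-⊆ ((i≢j ∷ []) ∷ [] ∷ [])
      λ { (here refl) → ∈-filter⁺ P? (∈-allFin _) p
        ; (there (here refl)) → ∈-filter⁺ P? (∈-allFin _) q }) le) λ { (s≤s ()) }

#-⊆ : ∀ {n} {P Q : Fin n → Set} (P? : ∀ i → Dec (P i)) (Q? : ∀ i → Dec (Q i)) →
      (∀ i → P i → Q i) → # P? ≤ # Q?
#-⊆ P? Q? sub = length-⊆ (Unique.filter⁺ P? (Unique.allFin⁺ _)) λ {i} i∈ →
  ∈-filter⁺ Q? (∈-allFin i) (sub i (proj₂ (∈-filter⁻ P? {xs = allFin _} i∈)))

#-unique : ∀ {n} {P : Fin n → Set} (P? : ∀ i → Dec (P i)) {i} →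
           P i → (∀ j → P j → j ≡ i) → # P? ≡ 1
#-unique P? p only = ℕ.≤-antisym
  (length-⊆ (Unique.filter⁺ P? (Unique.allFin⁺ _)) λ {j} j∈ →
    here {xs = []} (only j (proj₂ (∈-filter⁻ P? {xs = allFin _} j∈))))
  (#≥1 P? p)

∑ᶠ-only : ∀ {n} (f : Fin n → ℕ) z → (∀ v → v ≢ z → f v ≡ 0) → ∑ᶠ f ≡ f z
∑ᶠ-only {n} f z off with zs , all↭ ← ∈⇒↭ (∈-allFin z) = begin
  ∑ᶠ f             ≡⟨ ∑-↭ f all↭ ⟩
  f z + ∑ zs f     ≡⟨ cong (f z +_) (∑-zero zs λ {x} x∈ → off x (λ { refl → z∉ x∈ })) ⟩
  f z + 0          ≡⟨ ℕ.+-identityʳ _ ⟩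
  f z              ∎
  where
  open ≡-Reasoning
  z∉ : z ∉ zs
  z∉ = Unique.Unique[x∷xs]⇒x∉xs
         (Setoid↭ₚ.Unique-resp-↭ (setoid (Fin n)) (↭⇒↭ₛ all↭) (Unique.allFin⁺ n))

-- Reachability and the edge bound for connected graphs

-- Adding the edge (a , b) to a list of edges creates exactly the walks that
-- use it once.
listStar? : ∀ {n} (es : List (Fin n × Fin n)) → Decidable (Star (λ u v → (u , v) ∈ es))
listStar? [] u v = Dec.map′ (λ { refl → ε }) (λ { ε → refl ; (() ◅ _) }) (u Fin.≟ v)
listStar? {n} ((a , b) ∷ es) u v =
  Dec.map′ forth back (listStar? es u v ⊎-dec (listStar? es u a ×-dec listStar? es b v))
  where
  Walk Walk′ : Rel (Fin n) 0ℓ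
  Walk  = Star (λ u v → (u , v) ∈ es)
  Walk′ = Star (λ u v → (u , v) ∈ (a , b) ∷ es)

  forth : ∀ {u v} → Walk u v ⊎ (Walk u a × Walk b v) → Walk′ u v
  forth (inj₁ p)       = Star.map there p
  forth (inj₂ (p , q)) = Star.map there p ◅◅ here refl ◅ Star.map there q

  back : ∀ {u v} → Walk′ u v → Walk u v ⊎ (Walk u a × Walk b v)
  back ε = inj₁ ε
  back (here refl ◅ p) with back p
  ... | inj₁ q       = inj₂ (ε , q)
  ... | inj₂ (_ , q) = inj₂ (ε , q)
  back (there e ◅ p) with back p
  ... | inj₁ q       = inj₁ (e ◅ q)
  ... | inj₂ (q , r) = inj₂ (e ◅ q , r)

star? : ∀ {n} {R : Rel (Fin n) 0ℓ} → Decidable R → Decidable (Star R)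
star? {n} R? u v = Dec.map′
  (Star.map λ {u} {v} e → proj₂ (∈-filter⁻ P? {v = u , v} {xs = pairs} e))
  (Star.map λ {u} {v} r → ∈-filter⁺ P? (∈-cartesianProduct⁺ (∈-allFin u) (∈-allFin v)) r)
  (listStar? (filter P? pairs) u v)
  where
  pairs = cartesianProduct (allFin n) (allFin n)
  P?    = λ ((u , v) : Fin n × Fin n) → R? u v

module Degrees {n} {R : Rel (Fin n) 0ℓ} (R? : Decidable R) where

  deg : Fin n → ℕ
  deg u = # (R? u)

  Touched : Fin n → Set
  Touched u = ∃[ v ] R u v

  touched? : ∀ u → Dec (Touched u)
  touched? u = Fin.any? (R? u)

  -- Connectivity of the edge-induced subgraph, expressed on the full vertex set: isolated vertices
  -- are exempt, and no vertex is renumbered.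
  AllLinked : Set
  AllLinked = ∀ {u v} → Touched u → Touched v → Star R u v

  touched⇒deg≥1 : ∀ {u} → Touched u → 1 ≤ deg u
  touched⇒deg≥1 {u} (_ , r) = #≥1 (R? u) r

  deg≥1⇒touched : ∀ {u} → 1 ≤ deg u → Touched u
  deg≥1⇒touched {u} = #≥1⁻ (R? u)

  untouched⇒deg≡0 : ∀ {u} → ¬ Touched u → deg u ≡ 0
  untouched⇒deg≡0 {u} ¬t = #≡0 (R? u) (λ v r → ¬t (v , r))

  closed-star : ∀ {P : Fin n → Set} → (∀ {u v} → P u → R u v → P v) →
                ∀ {u v} → P u → Star R u v → P v
  closed-star keep p ε       = p
  closed-star keep p (r ◅ s) = closed-star keep (keep p r) s

  -- A touched vertex of degree `d` contributes 2 plus its excess; the truncation at `d = 1` is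
  -- repaired by the indicator on the right. Summed up, this trades the number of touched vertices
  -- for leaves and excesses.
  deg-split : ∀ u → 2 * 𝟙 (touched? u) + (deg u ∸ 2) ≡ deg u + 𝟙 (deg u ℕ.≟ 1)
  deg-split u with touched? u
  ... | no ¬t  rewrite untouched⇒deg≡0 ¬t = refl
  ... | yes t with deg u | touched⇒deg≥1 t
  ...   | suc zero    | _ = refl
  ...   | suc (suc d) | _ = sym (ℕ.+-identityʳ _)

  ∑-deg-split : 2 * # touched? + ∑ᶠ (λ u → deg u ∸ 2) ≡ ∑ᶠ deg + ∑ᶠ (λ u → 𝟙 (deg u ℕ.≟ 1))
  ∑-deg-split = begin
    2 * # touched? + ∑ᶠ o                        ≡⟨ cong (λ k → 2 * k + ∑ᶠ o) (#-∑ touched?) ⟩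
    (∑ᶠ t + (∑ᶠ t + 0)) + ∑ᶠ o                   ≡⟨ cong (λ k → ∑ᶠ t + k + ∑ᶠ o) (ℕ.+-identityʳ _) ⟩
    (∑ᶠ t + ∑ᶠ t) + ∑ᶠ o                         ≡⟨ cong (_+ ∑ᶠ o) (sym (∑-+ (allFin n) t t)) ⟩
    ∑ᶠ (λ u → t u + t u) + ∑ᶠ o                  ≡⟨ sym (∑-+ (allFin n) _ o) ⟩
    ∑ᶠ (λ u → t u + t u + o u)                   ≡⟨ ∑-cong (allFin n) (λ u →
                                                      trans (cong (λ k → t u + k + o u) (sym (ℕ.+-identityʳ _))) (deg-split u)) ⟩
    ∑ᶠ (λ u → deg u + 𝟙 (deg u ℕ.≟ 1))           ≡⟨ ∑-+ (allFin n) deg _ ⟩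
    ∑ᶠ deg + ∑ᶠ (λ u → 𝟙 (deg u ℕ.≟ 1))          ∎
    where
    open ≡-Reasoning
    t o : Fin n → ℕ
    t u = 𝟙 (touched? u)
    o u = deg u ∸ 2

  private
    open DecMembership (Fin._≟_ {n}) using (_∈?_)

    -- Ordered pairs are counted, so an edge inside `U` contributes 2; this is the source of the
    -- factor 2 in the bounds below.
    internal : List (Fin n) → ℕ
    internal U = ∑ U (λ u → ∑ U (λ v → 𝟙 (R? u v)))

    internal-≤ : ∀ {U} → Unique U → internal U ≤ ∑ᶠ deg
    internal-≤ {U} uniq = ℕ.≤-trans
      (∑-mono U λ u → ℕ.≤-trans (∑-⊆ _ uniq (λ _ → ∈-allFin _)) (ℕ.≤-reflexive (sym (#-∑ (R? u)))))
      (∑-⊆ deg uniq (λ _ → ∈-allFin _))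

    internal-∷ : Symmetric R → ∀ {U a b} → a ∈ U → R a b → 2 + internal U ≤ internal (b ∷ U)
    internal-∷ symm {U} {a} {b} a∈ r = begin
      2 + internal U
        ≤⟨ ℕ.+-monoˡ-≤ (internal U) (ℕ.+-mono-≤ (edge (R? b) (symm r)) (edge (λ u → R? u b) r)) ⟩
      ∑ U (λ v → 𝟙 (R? b v)) + ∑ U (λ u → 𝟙 (R? u b)) + internal U
        ≡⟨ ℕ.+-assoc (∑ U (λ v → 𝟙 (R? b v))) _ _ ⟩
      ∑ U (λ v → 𝟙 (R? b v)) + (∑ U (λ u → 𝟙 (R? u b)) + internal U)
        ≡⟨ cong (∑ U (λ v → 𝟙 (R? b v)) +_) (sym (∑-+ U _ _)) ⟩
      ∑ U (λ v → 𝟙 (R? b v)) + ∑ U (λ u → ∑ (b ∷ U) (λ v → 𝟙 (R? u v)))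
        ≤⟨ ℕ.+-monoˡ-≤ _ (ℕ.m≤n+m _ (𝟙 (R? b b))) ⟩
      internal (b ∷ U) ∎
      where
      open ℕ.≤-Reasoning
      edge : ∀ {P : Fin n → Set} (P? : ∀ v → Dec (P v)) → P a → 1 ≤ ∑ U (𝟙 ∘ P?)
      edge P? p = ℕ.≤-trans (ℕ.≤-reflexive (sym (𝟙-yes (P? a) p))) (∑-member-≤ (𝟙 ∘ P?) a∈)

    crossing : ∀ {U u v} → u ∈ U → v ∉ U → Star R u v →
               ∃[ a ] ∃[ b ] a ∈ U × b ∉ U × R a b
    crossing u∈ v∉ ε = contradiction u∈ v∉
    crossing {U} {u} u∈ v∉ (_◅_ {j = w} r s) with w ∈? U
    ... | yes w∈ = crossing w∈ v∉ s
    ... | no  w∉ = u , w , u∈ , w∉ , r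

    -- A spanning tree grown vertex by vertex. The invariant says that `U` spans at least `|U| - 1`
    -- edges; a walk to an uncovered touched vertex has to leave `U`, and the crossing edge comes
    -- with one new vertex. `k` is fuel, since a duplicate-free `U` cannot outgrow `n`.
    grow : Symmetric R → AllLinked → ∀ k {U r} → Unique U → r ∈ U → Touched r →
           2 * length U ≤ internal U + 2 → n < length U + k → 2 * # touched? ≤ ∑ᶠ deg + 2
    grow symm linked k {U} uniq r∈ tr inv big
      with Fin.any? (λ v → touched? v ×-dec ¬? (v ∈? U))
    ... | no all∈ = begin
      2 * # touched?   ≤⟨ ℕ.*-monoʳ-≤ 2 (length-⊆ (Unique.filter⁺ touched? (Unique.allFin⁺ n)) covered) ⟩
      2 * length U     ≤⟨ inv ⟩
      internal U + 2   ≤⟨ ℕ.+-monoˡ-≤ 2 (internal-≤ uniq) ⟩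
      ∑ᶠ deg + 2       ∎
      where
      open ℕ.≤-Reasoning
      covered : ∀ {v} → v ∈ filter touched? (allFin n) → v ∈ U
      covered {v} v∈ with v ∈? U
      ... | yes v∈U = v∈U
      ... | no  v∉U = contradiction (v , proj₂ (∈-filter⁻ touched? {xs = allFin n} v∈) , v∉U) all∈
    grow symm linked zero {U} uniq r∈ tr inv big | yes _ =
      contradiction (ℕ.≤-trans (subst (n <_) (ℕ.+-identityʳ _) big)
        (subst (length U ≤_) (List.length-tabulate {n = n} id) (length-⊆ uniq (λ _ → ∈-allFin _))))
        (ℕ.<-irrefl refl)
    grow symm linked (suc k) {U} uniq r∈ tr inv big | yes (v , tv , v∉)
      with a , b , a∈ , b∉ , r ← crossing r∈ v∉ (linked tr tv) =
      grow symm linked k (All.tabulate (λ {x} x∈ b≡x → b∉ (subst (_∈ U) (sym b≡x) x∈)) ∷ uniq)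
        (there r∈) tr
        (begin
          2 * (1 + length U)       ≡⟨ ℕ.*-distribˡ-+ 2 1 (length U) ⟩
          2 + 2 * length U         ≤⟨ ℕ.+-monoʳ-≤ 2 inv ⟩
          2 + (internal U + 2)     ≤⟨ ℕ.+-monoˡ-≤ 2 (internal-∷ symm a∈ r) ⟩
          internal (b ∷ U) + 2     ∎)
        (subst (n <_) (ℕ.+-suc (length U) k) big)
      where open ℕ.≤-Reasoning

  connected-bound : Symmetric R → AllLinked → 2 * # touched? ≤ ∑ᶠ deg + 2
  connected-bound symm linked with Fin.any? touched?
  ... | no  never    rewrite #≡0 touched? (λ v t → never (v , t)) = z≤n
  ... | yes (r , tr) = grow symm linked n ([] ∷ []) (here refl) tr (ℕ.m≤n+m 2 _) ℕ.≤-refl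

  -- The edge bound after the vertices of degree 2 have cancelled. In this form it is unaffected by
  -- subdivision vertices and by isolated ones.
  ends-bound : Symmetric R → AllLinked →
               ∑ᶠ (λ u → 𝟙 (deg u ℕ.≟ 1)) ≤ ∑ᶠ (λ u → deg u ∸ 2) + 2
  ends-bound symm linked = ℕ.+-cancelˡ-≤ (∑ᶠ deg) _ _ (begin
    ∑ᶠ deg + ∑ᶠ (λ u → 𝟙 (deg u ℕ.≟ 1))       ≡⟨ sym ∑-deg-split ⟩
    2 * # touched? + over                     ≤⟨ ℕ.+-monoˡ-≤ over (connected-bound symm linked) ⟩
    ∑ᶠ deg + 2 + over                         ≡⟨ ℕ.+-assoc (∑ᶠ deg) 2 over ⟩
    ∑ᶠ deg + (2 + over)                       ≡⟨ cong (∑ᶠ deg +_) (ℕ.+-comm 2 over) ⟩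
    ∑ᶠ deg + (over + 2)                       ∎)
    where
    open ℕ.≤-Reasoning
    over = ∑ᶠ (λ u → deg u ∸ 2)

-- By `back`, no edge leaves the image, so degrees of image vertices and walks starting there are
-- the same on both sides.
module Embedding {n m} {R : Rel (Fin n) 0ℓ} {R′ : Rel (Fin m) 0ℓ} (R? : Decidable R) (R′? : Decidable R′)
  (e : Fin n → Fin m) (injective : ∀ {u v} → e u ≡ e v → u ≡ v)
  (forth : ∀ {u v} → R u v → R′ (e u) (e v))
  (back : ∀ {u w} → R′ (e u) w → ∃[ v ] e v ≡ w × R u v)
  where

  open Degrees

  deg-embed : ∀ u → deg R? u ≡ deg R′? (e u)
  deg-embed u = #-embed (R? u) (R′? (e u)) e injective (λ _ → forth) (λ _ → back)

  star-embed : ∀ {u w} → Star R′ (e u) w → ∃[ v ] e v ≡ w × Star R u v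
  star-embed ε       = _ , refl , ε
  star-embed (r ◅ s) with _ , refl , r′ ← back r with v , eq , s′ ← star-embed s = v , eq , r′ ◅ s′

  linked-down : AllLinked R′? → AllLinked R?
  linked-down linked {u} (_ , r) (_ , r′)
    with v , eq , s ← star-embed (linked (_ , forth r) (_ , forth r′)) =
    subst (Star R u) (injective eq) s

  linked-up : (∀ {w} → Touched R′? w → ∃[ u ] e u ≡ w) → AllLinked R? → AllLinked R′?
  linked-up covered linked tv tw
    with _ , refl ← covered tv | _ , refl ← covered tw
    with _ , _ , r ← back (proj₂ tv) | _ , _ , r′ ← back (proj₂ tw) =
    Star.gmap e forth (linked (_ , r) (_ , r′))

unique-lookup-injective : ∀ {A : Set} {xs : List A} → Unique xs →
                          ∀ {i j} → lookup xs i ≡ lookup xs j → i ≡ j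
unique-lookup-injective (_ ∷ _)  {zero}  {zero}  eq = refl
unique-lookup-injective (x∉ ∷ _) {zero}  {suc j} eq = contradiction eq (All.lookup x∉ (∈-lookup j))
unique-lookup-injective (x∉ ∷ _) {suc i} {zero}  eq = contradiction (sym eq) (All.lookup x∉ (∈-lookup i))
unique-lookup-injective (_ ∷ u)  {suc i} {suc j} eq = cong suc (unique-lookup-injective u eq)

module _ (G : Graph) where
  open Graph G
  open Degrees _~?_

  private
    vs = endpoints G

  endpoints-unique : Unique vs
  endpoints-unique = Unique.filter⁺ touched? (Unique.allFin⁺ order)

  endpoints-touched : ∀ p → Touched (lookup vs p)
  endpoints-touched p = proj₂ (∈-filter⁻ touched? {xs = allFin order} (∈-lookup p))

  position : ∀ {u} → Touched u → ∃[ p ] lookup vs p ≡ u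
  position t = Any.index u∈ , sym (Any.lookup-index u∈)
    where u∈ = ∈-filter⁺ touched? (∈-allFin _) t

  private
    neighbor-position : ∀ {p w} → lookup vs p ~ w → ∃[ q ] lookup vs q ≡ w × lookup vs p ~ lookup vs q
    neighbor-position r with q , eq ← position (_ , ~-sym r) = q , eq , subst (_ ~_) (sym eq) r

    module Emb = Embedding (Graph._~?_ (edgeInduced G)) _~?_ (lookup vs)
      (unique-lookup-injective endpoints-unique) id neighbor-position

  connected⇒linked : Connected (edgeInduced G) → AllLinked
  connected⇒linked conn = Emb.linked-up position (λ _ _ → conn _ _)

  linked⇒connected : AllLinked → Connected (edgeInduced G)
  linked⇒connected linked p q = Emb.linked-down linked (touched p) (touched q)
    where
    touched : ∀ p → ∃[ q ] lookup vs p ~ lookup vs q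
    touched p with _ , r ← endpoints-touched p with q , _ , r′ ← neighbor-position {p} r = q , r′

-- Multisets of colored degrees up to Δ

module _ {c : ℕ} where

  infix 4 _≟δ_
  _≟δ_ : DecidableEquality (Vec ℕ c)
  _≟δ_ = Vec.≡-dec ℕ._≟_

  inΔ? : (δ : Vec ℕ c) → Dec (InΔ δ)
  inΔ? δ = Fin.any? λ i → (Vec.lookup δ i ℕ.≟ 2) ×-dec
    Fin.all? λ j → ¬? (j Fin.≟ i) →-dec (Vec.lookup δ j ℕ.≟ 0)

  ExtendsByΔ : List (Vec ℕ c) → List (Vec ℕ c) → Set
  ExtendsByΔ M xs = ∃[ L ] All InΔ L × xs ↭ M ++ L

  #δ : Vec ℕ c → List (Vec ℕ c) → ℕ
  #δ = count _≟δ_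

  -- Replaces the existential list `L` by conditions on multiplicities, so that condition (a) can be
  -- decided and transferred one degree at a time.
  CountsMatch : List (Vec ℕ c) → List (Vec ℕ c) → Vec ℕ c → Set
  CountsMatch M xs δ = #δ δ M ≤ #δ δ xs × (InΔ δ ⊎ #δ δ xs ≡ #δ δ M)

  private
    count-outside : ∀ {δ} M L → All InΔ L → ¬ InΔ δ → #δ δ (M ++ L) ≡ #δ δ M
    count-outside {δ} M L all ¬Δ = trans (∑-++ M L _) (trans
      (cong (#δ δ M +_) (∑-zero L λ {x} x∈ → 𝟙-no (δ ≟δ x) λ { refl → ¬Δ (All.lookup all x∈) }))
      (ℕ.+-identityʳ _))

  extends⇒counts : ∀ {M xs} → ExtendsByΔ M xs → ∀ δ → CountsMatch M xs δ
  extends⇒counts {M} {xs} (L , all , xs↭) δ = le , dec (inΔ? δ)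
    where
    eq : #δ δ xs ≡ #δ δ (M ++ L)
    eq = ∑-↭ _ xs↭

    le : #δ δ M ≤ #δ δ xs
    le = ℕ.≤-trans (ℕ.m≤m+n _ _) (ℕ.≤-reflexive (sym (trans eq (∑-++ M L _))))

    dec : Dec (InΔ δ) → InΔ δ ⊎ #δ δ xs ≡ #δ δ M
    dec (yes d) = inj₁ d
    dec (no ¬d) = inj₂ (trans eq (count-outside {δ} M L all ¬d))

  counts⇒extends : ∀ {M xs} → (∀ δ → CountsMatch M xs δ) → ExtendsByΔ M xs
  counts⇒extends {M} {xs} match with L , xs↭ ← counts-≤⇒↭ _≟δ_ M {xs} (proj₁ ∘ match) =
    L , All.tabulate inΔ , xs↭
    where
    inΔ : ∀ {δ} → δ ∈ L → InΔ δ
    inΔ {δ} δ∈ with proj₂ (match δ)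
    ... | inj₁ d  = d
    ... | inj₂ eq = contradiction
      (trans (sym (∑-++ M L _)) (trans (sym (∑-↭ _ xs↭)) eq))
      (λ eq′ → ℕ.m+1+n≢m (#δ δ M) (trans (cong (#δ δ M +_) (ℕ.suc-pred _ {{>-nonZero (∈⇒count≥1 _≟δ_ δ∈)}})) eq′))

  -- A degree outside `M ++ xs` has multiplicity 0 on both sides, so finitely many checks suffice.
  extends? : ∀ M xs → Dec (ExtendsByΔ M xs)
  extends? M xs = Dec.map′ (λ all → counts⇒extends (everywhere all))
    (λ ext → All.tabulate λ {δ} _ → extends⇒counts ext δ)
    (All.all? (λ δ → (#δ δ M ℕ.≤? #δ δ xs) ×-dec (inΔ? δ ⊎-dec (#δ δ xs ℕ.≟ #δ δ M))) (M ++ xs))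
    where
    open DecMembership _≟δ_ using (_∈?_)

    absent : ∀ {δ} ys → δ ∉ ys → #δ δ ys ≡ 0
    absent {δ} ys δ∉ = ∑-zero ys λ {y} y∈ → 𝟙-no (δ ≟δ y) λ { refl → δ∉ y∈ }

    everywhere : All (CountsMatch M xs) (M ++ xs) → ∀ δ → CountsMatch M xs δ
    everywhere all δ with δ ∈? (M ++ xs)
    ... | yes δ∈ = All.lookup all δ∈
    ... | no  δ∉ = subst (_≤ #δ δ xs) (sym M≡0) z≤n , inj₂ (trans (absent xs (δ∉ ∘ ∈-++⁺ʳ M)) (sym M≡0))
      where
      M≡0 : #δ δ M ≡ 0
      M≡0 = absent M (δ∉ ∘ ∈-++⁺ˡ)

  -- Weights that vanish on Δ yield invariants: their sums depend on `M` alone, however many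
  -- elements of Δ were added.
  extends-∑ : ∀ {M xs} (h : Vec ℕ c → ℕ) → (∀ {δ} → InΔ δ → h δ ≡ 0) →
              ExtendsByΔ M xs → ∑ xs h ≡ ∑ M h
  extends-∑ {M} h vanish (L , all , xs↭) = trans (∑-↭ h xs↭) (trans (∑-++ M L h)
    (trans (cong (∑ M h +_) (∑-zero L (vanish ∘ All.lookup all))) (ℕ.+-identityʳ _)))

-- A color-preserving embedding whose image is a union of components.
module ColoredEmbedding {c} (F F′ : ColoredGraph c)
  (e : ColoredGraph.Vertex F → ColoredGraph.Vertex F′) (injective : ∀ {u v} → e u ≡ e v → u ≡ v)
  (forth : ∀ i {u v} → ColoredGraph.D F i u v → ColoredGraph.D F′ i (e u) (e v))
  (back : ∀ i {u w} → ColoredGraph.D F′ i (e u) w → ∃[ v ] e v ≡ w × ColoredGraph.D F i u v)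
  where

  private
    module F  = ColoredGraph F
    module F′ = ColoredGraph F′

  module _ (i : Fin c) where
    open Embedding (F.D? i) (F′.D? i) e injective (forth i) (back i) public

  coloredDegree-embed : ∀ u → F.coloredDegree u ≡ F′.coloredDegree (e u)
  coloredDegree-embed u = Vec.tabulate-cong (λ i → deg-embed i u)

module _ {c : ℕ} (F : ColoredGraph c) where
  open ColoredGraph F

  Linked : Set
  Linked = ∀ i → Degrees.AllLinked (D? i)

  linked? : Dec Linked
  linked? = Fin.all? λ i →
    let open Degrees (D? i) in
    Dec.map′ (λ s {u} {v} tu tv → s u v tu tv) (λ s u v tu tv → s tu tv)
    (Fin.all? λ u → Fin.all? λ v → touched? u →-dec (touched? v →-dec star? (D? i) u v))

  Used : Vertex → Set
  Used u = ∃[ v ] ∃[ i ] D i u v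

  used? : ∀ u → Dec (Used u)
  used? u = Fin.any? λ v → Fin.any? λ i → D? i u v

  usedDegrees : List (Vec ℕ c)
  usedDegrees = map coloredDegree (endpoints underlying)

  -- Condition C*_M for the edge-induced graph without its renumbering of vertices. Different
  -- subgraphs of one host graph can thus be compared vertex by vertex.
  Satisfies : List (Vec ℕ c) → Set
  Satisfies M = ExtendsByΔ M usedDegrees × Linked

  satisfies? : ∀ M → Dec (Satisfies M)
  satisfies? M = extends? M usedDegrees ×-dec linked?

  lookup-degree : ∀ u i → Vec.lookup (coloredDegree u) i ≡ degree u i
  lookup-degree u i = Vec.lookup∘tabulate (degree u) i

  private
    I = edgeInducedColored F
    vs = endpoints underlying

    neighbor-position : ∀ i {p w} → D i (lookup vs p) w → ∃[ q ] lookup vs q ≡ w × D i (lookup vs p) (lookup vs q)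
    neighbor-position i r with q , eq ← position underlying (_ , i , D-sym i r) =
      q , eq , subst (D i _) (sym eq) r

    module Emb = ColoredEmbedding I F (lookup vs)
      (unique-lookup-injective (endpoints-unique underlying)) (λ _ → id) neighbor-position

    covered : ∀ i {w} → Degrees.Touched (D? i) w → ∃[ p ] lookup vs p ≡ w
    covered i (v , r) = position underlying (v , i , r)

    DS-induced : ColoredGraph.DS I ≡ usedDegrees
    DS-induced = begin
      map (ColoredGraph.coloredDegree I) (allFin (length vs))
        ≡⟨ List.map-cong Emb.coloredDegree-embed (allFin (length vs)) ⟩
      map (coloredDegree ∘ lookup vs) (allFin (length vs))
        ≡⟨ List.map-∘ (allFin (length vs)) ⟩
      map coloredDegree (map (lookup vs) (allFin (length vs)))
        ≡⟨ cong (map coloredDegree) (trans (List.map-tabulate id (lookup vs)) (List.tabulate-lookup vs)) ⟩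
      map coloredDegree vs ∎
      where open ≡-Reasoning

  induced⇒satisfies : ∀ {M} → SatisfiesC* M I → Satisfies M
  induced⇒satisfies {M} ((L , all , ds) , conn) = (L , all , subst (_↭ M ++ L) DS-induced ds) ,
    λ i → Emb.linked-up i (covered i) (connected⇒linked (ColoredGraph.colorGraph I i) (conn i))

  satisfies⇒induced : ∀ {M} → Satisfies M → SatisfiesC* M I
  satisfies⇒induced {M} ((L , all , ds) , linked) = (L , all , subst (_↭ M ++ L) (sym DS-induced) ds) ,
    λ i → linked⇒connected (ColoredGraph.colorGraph I i) (Emb.linked-down i (linked i))

-- Stars

module StarShaped {n} {R : Rel (Fin n) 0ℓ} (R? : Decidable R) (R-sym : Symmetric R) (R-irrefl : Irreflexive _≡_ R)
  (z : Fin n) (through : ∀ {u v} → R u v → u ≡ z ⊎ v ≡ z) (z-touched : ∃[ v ] R z v)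
  where

  open Degrees R?

  neighbor-is-center : ∀ {u v} → u ≢ z → R u v → v ≡ z
  neighbor-is-center u≢z r with through r
  ... | inj₁ u≡z = contradiction u≡z u≢z
  ... | inj₂ v≡z = v≡z

  deg≤1 : ∀ {u} → u ≢ z → deg u ≤ 1
  deg≤1 {u} u≢z = length-⊆ (Unique.filter⁺ (R? u) (Unique.allFin⁺ n)) λ {v} v∈ →
    here {xs = []} (neighbor-is-center u≢z (proj₂ (∈-filter⁻ (R? u) {xs = allFin n} v∈)))

  deg≥2⇒center : ∀ {u} → 2 ≤ deg u → u ≡ z
  deg≥2⇒center {u} le with u Fin.≟ z
  ... | yes u≡z = u≡z
  ... | no  u≢z = contradiction (ℕ.≤-trans le (deg≤1 u≢z)) λ { (s≤s ()) }

  private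
    to-center : ∀ {u} → Touched u → Star R u z
    to-center {u} (v , r) with through r
    ... | inj₁ refl = ε
    ... | inj₂ refl = r ◅ ε

  linked : AllLinked
  linked tu tv = to-center tu ◅◅ Star.reverse R-sym (to-center tv)

  over≡ : ∑ᶠ (λ u → deg u ∸ 2) ≡ deg z ∸ 2
  over≡ = ∑ᶠ-only _ z (λ v v≢z → ℕ.m≤n⇒m∸n≡0 (ℕ.≤-trans (deg≤1 v≢z) (s≤s z≤n)))

  -- The ends are the leaves and, in the case of a single edge, also the designated center, which
  -- the last indicator adds.
  ends≡ : ∑ᶠ (λ u → 𝟙 (deg u ℕ.≟ 1)) ≡ deg z + 𝟙 (deg z ℕ.≟ 1)
  ends≡ = begin
    ∑ᶠ (λ u → 𝟙 (deg u ℕ.≟ 1))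
      ≡⟨ ∑-cong (allFin n) pointwise ⟩
    ∑ᶠ (λ u → 𝟙 (R? z u) + at-center u)
      ≡⟨ ∑-+ (allFin n) _ at-center ⟩
    ∑ᶠ (λ u → 𝟙 (R? z u)) + ∑ᶠ at-center
      ≡⟨ cong₂ _+_ (sym (#-∑ (R? z))) (∑ᶠ-only at-center z (λ v v≢z → 𝟙-no (center? v) (v≢z ∘ proj₁))) ⟩
    deg z + at-center z
      ≡⟨ cong (deg z +_) (𝟙-⇔ (center? z) (deg z ℕ.≟ 1) proj₂ (refl ,_)) ⟩
    deg z + 𝟙 (deg z ℕ.≟ 1) ∎
    where
    open ≡-Reasoning
    center? : ∀ u → Dec (u ≡ z × deg z ≡ 1)
    center? u = (u Fin.≟ z) ×-dec (deg z ℕ.≟ 1)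

    at-center : Fin n → ℕ
    at-center u = 𝟙 (center? u)

    pointwise : ∀ u → 𝟙 (deg u ℕ.≟ 1) ≡ 𝟙 (R? z u) + at-center u
    pointwise u with u Fin.≟ z
    ... | yes refl rewrite 𝟙-no (R? z z) (R-irrefl refl) = 𝟙-⇔ (deg z ℕ.≟ 1) (yes (refl {x = z}) ×-dec (deg z ℕ.≟ 1)) (refl ,_) proj₂
    ... | no u≢z = trans (𝟙-⇔ (deg u ℕ.≟ 1) (R? z u)
      (λ eq → let v , r = deg≥1⇒touched (ℕ.≤-reflexive (sym eq)) in
              subst (λ v → R v u) (neighbor-is-center u≢z r) (R-sym r))
      (λ r → ℕ.≤-antisym (deg≤1 u≢z) (touched⇒deg≥1 (z , R-sym r)))) (sym (ℕ.+-identityʳ _))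

  ends≡over+2 : ∑ᶠ (λ u → 𝟙 (deg u ℕ.≟ 1)) ≡ ∑ᶠ (λ u → deg u ∸ 2) + 2
  ends≡over+2 = trans ends≡ (trans (arith (deg z) (touched⇒deg≥1 z-touched)) (cong (_+ 2) (sym over≡)))
    where
    arith : ∀ d → 1 ≤ d → d + 𝟙 (d ℕ.≟ 1) ≡ d ∸ 2 + 2
    arith (suc zero)    _ = refl
    arith (suc (suc d)) _ = trans (ℕ.+-identityʳ _) (ℕ.+-comm 2 d)

  big≤1 : ∑ᶠ (λ u → 𝟙 (3 ℕ.≤? deg u)) ≤ 1
  big≤1 = ℕ.≤-trans (ℕ.≤-reflexive (∑ᶠ-only _ z (λ v v≢z → 𝟙-no (3 ℕ.≤? deg v)
      (λ le → v≢z (deg≥2⇒center (ℕ.≤-trans (ℕ.n≤1+n 2) le))))))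
    (𝟙≤1 (3 ℕ.≤? deg z))
    where
    𝟙≤1 : {P : Set} (p? : Dec P) → 𝟙 p? ≤ 1
    𝟙≤1 (yes _) = ℕ.≤-refl
    𝟙≤1 (no _)  = z≤n

record StarCenter {c} (F : ColoredGraph c) (i : Fin c) : Set where
  open ColoredGraph F
  field
    z         : Vertex
    through   : ∀ {u v} → D i u v → u ≡ z ⊎ v ≡ z
    z-touched : ∃[ v ] D i z v

  open StarShaped (D? i) (D-sym i) (D-irrefl i) z through z-touched public

isStar⇒center : ∀ {c} (F : ColoredGraph c) i → IsStar (colorSubgraph F i) → StarCenter F i
isStar⇒center F i star = record
  { z         = at zero
  ; through   = through
  ; z-touched = touched leaves≥1
  }
  where
  open ColoredGraph F
  open IsStar star
  open _≅_ iso
  open Inverse bijection using (from; strictlyInverseˡ)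

  at : Fin (suc leaves) → Vertex
  at p = lookup (endpoints (colorGraph i)) (to p)

  preimage : ∀ {u} → (∃[ v ] D i u v) → ∃[ p ] at p ≡ u
  preimage t with q , eq ← position (colorGraph i) t =
    from q , trans (cong (lookup (endpoints (colorGraph i))) (strictlyInverseˡ q)) eq

  through : ∀ {u v} → D i u v → u ≡ at zero ⊎ v ≡ at zero
  through r with preimage (_ , r) | preimage (_ , D-sym i r)
  ... | p , refl | q , refl with p | q | Equivalence.from (adjacency p q) r
  ...   | zero  | _    | _ = inj₁ refl
  ...   | suc _ | zero | _ = inj₂ refl

  touched : 1 ≤ leaves → ∃[ v ] D i (at zero) v
  touched (s≤s _) = at (suc zero) , Equivalence.to (adjacency zero (suc zero)) tt

-- Vertices of degree 2 contribute nothing to ends-over: it is the tree identity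
-- ∑ (2 - deg) = 2 for the star of color i, in a form stable under subdivision.
record StarDegrees {c} (M : List (Vec ℕ c)) : Set where
  field
    ends-over : ∀ i → ∑ M (λ δ → 𝟙 (Vec.lookup δ i ℕ.≟ 1)) ≡ ∑ M (λ δ → Vec.lookup δ i ∸ 2) + 2
    big       : ∀ i → ∑ M (λ δ → 𝟙 (3 ℕ.≤? Vec.lookup δ i)) ≤ 1

DS-∑ : ∀ {c} (F : ColoredGraph c) i (h : ℕ → ℕ) →
       ∑ (ColoredGraph.DS F) (λ δ → h (Vec.lookup δ i)) ≡ ∑ᶠ (λ u → h (ColoredGraph.degree F u i))
DS-∑ F i h = trans (∑-map coloredDegree _ (allFin order))
  (∑-cong (allFin order) λ u → cong h (lookup-degree F u i))
  where open ColoredGraph F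

starDegrees : ∀ {c} (F : ColoredGraph c) → (∀ i → StarCenter F i) → StarDegrees (ColoredGraph.DS F)
starDegrees F center = record
  { ends-over = λ i → trans (DS-∑ F i (λ d → 𝟙 (d ℕ.≟ 1)))
      (trans (StarCenter.ends≡over+2 (center i)) (cong (_+ 2) (sym (DS-∑ F i (_∸ 2)))))
  ; big       = λ i → subst (_≤ 1) (sym (DS-∑ F i (λ d → 𝟙 (3 ℕ.≤? d)))) (StarCenter.big≤1 (center i))
  }

-- Subdivisions

#-suc : ∀ {n} {P : Fin (suc n) → Set} (P? : ∀ i → Dec (P i)) → # P? ≡ 𝟙 (P? zero) + # (P? ∘ suc)
#-suc {n} P? = begin
  # P?                                             ≡⟨ #-∑ P? ⟩
  𝟙 (P? zero) + ∑ (tabulate suc) (𝟙 ∘ P?)           ≡⟨ cong (λ xs → 𝟙 (P? zero) + ∑ xs (𝟙 ∘ P?)) (List.map-tabulate id suc) ⟨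
  𝟙 (P? zero) + ∑ (map suc (allFin n)) (𝟙 ∘ P?)     ≡⟨ cong (𝟙 (P? zero) +_) (∑-map suc (𝟙 ∘ P?) (allFin n)) ⟩
  𝟙 (P? zero) + ∑ᶠ (𝟙 ∘ P? ∘ suc)                   ≡⟨ cong (𝟙 (P? zero) +_) (#-∑ (P? ∘ suc)) ⟨
  𝟙 (P? zero) + # (P? ∘ suc)                       ∎
  where open ≡-Reasoning

≅-sym : ∀ {G H} → G ≅ H → H ≅ G
≅-sym {G} {H} φ = record
  { bijection = mk↔ₛ′ from to strictlyInverseʳ strictlyInverseˡ
  ; adjacency = λ u v → mk⇔
      (λ r → Equivalence.from (adjacency _ _)
        (subst₂ (Graph._~_ H) (sym (strictlyInverseˡ u)) (sym (strictlyInverseˡ v)) r))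
      (λ r → subst₂ (Graph._~_ H) (strictlyInverseˡ u) (strictlyInverseˡ v)
        (Equivalence.to (adjacency _ _) r))
  }
  where
  open _≅_ φ using (bijection; adjacency)
  open Inverse bijection

≅-trans : ∀ {G H K} → G ≅ H → H ≅ K → G ≅ K
≅-trans φ ψ = record
  { bijection = mk↔ₛ′ (Ψ.to ∘ Φ.to) (Φ.from ∘ Ψ.from)
      (λ w → trans (cong Ψ.to (Φ.strictlyInverseˡ (Ψ.from w))) (Ψ.strictlyInverseˡ w))
      (λ u → trans (cong Φ.from (Ψ.strictlyInverseʳ (Φ.to u))) (Φ.strictlyInverseʳ u))
  ; adjacency = λ u v → mk⇔
      (Equivalence.to (_≅_.adjacency ψ _ _) ∘ Equivalence.to (_≅_.adjacency φ u v))
      (Equivalence.from (_≅_.adjacency φ u v) ∘ Equivalence.from (_≅_.adjacency ψ _ _))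
  }
  where
  module Φ = Inverse (_≅_.bijection φ)
  module Ψ = Inverse (_≅_.bijection ψ)

bijective⇒≅ : ∀ {G H} (f : Graph.Vertex G → Graph.Vertex H) → (∀ {u v} → f u ≡ f v → u ≡ v) →
              (∀ w → ∃[ u ] f u ≡ w) → (∀ u v → Graph._~_ G u v ⇔ Graph._~_ H (f u) (f v)) → G ≅ H
bijective⇒≅ f inj surj adj = record
  { bijection = mk↔ₛ′ f (proj₁ ∘ surj) (proj₂ ∘ surj) (λ u → inj (proj₂ (surj (f u))))
  ; adjacency = adj
  }

subdivide-cong : ∀ {F K : Graph} (φ : F ≅ K) {u v} (r : Graph._~_ F u v) →
                 subdivide F u v r ≅
                 subdivide K (_≅_.to φ u) (_≅_.to φ v) (Equivalence.to (_≅_.adjacency φ u v) r)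
subdivide-cong {F} {K} φ {u} {v} r = bijective⇒≅ f f-inj f-surj adj
  where
  open _≅_ φ
  open Inverse bijection using (from; strictlyInverseˡ; strictlyInverseʳ)

  to-inj : ∀ {a b} → to a ≡ to b → a ≡ b
  to-inj eq = trans (sym (strictlyInverseʳ _)) (trans (cong from eq) (strictlyInverseʳ _))

  f : Fin (suc (Graph.order F)) → Fin (suc (Graph.order K))
  f zero    = zero
  f (suc a) = suc (to a)

  f-inj : ∀ {a b} → f a ≡ f b → a ≡ b
  f-inj {zero}  {zero}  _  = refl
  f-inj {suc a} {suc b} eq = cong suc (to-inj (Fin.suc-injective eq))

  f-surj : ∀ w → ∃[ a ] f a ≡ w
  f-surj zero    = zero , refl
  f-surj (suc w) = suc (from w) , cong suc (strictlyInverseˡ w)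

  same : ∀ {a b} → SamePair (a , b) (u , v) → SamePair (to a , to b) (to u , to v)
  same (inj₁ (refl , refl)) = inj₁ (refl , refl)
  same (inj₂ (refl , refl)) = inj₂ (refl , refl)

  same⁻ : ∀ {a b} → SamePair (to a , to b) (to u , to v) → SamePair (a , b) (u , v)
  same⁻ (inj₁ (p , q)) = inj₁ (to-inj p , to-inj q)
  same⁻ (inj₂ (p , q)) = inj₂ (to-inj p , to-inj q)

  end : ∀ {a} → a ≡ u ⊎ a ≡ v → to a ≡ to u ⊎ to a ≡ to v
  end = [ inj₁ ∘ cong to , inj₂ ∘ cong to ]′

  end⁻ : ∀ {a} → to a ≡ to u ⊎ to a ≡ to v → a ≡ u ⊎ a ≡ v
  end⁻ = [ inj₁ ∘ to-inj , inj₂ ∘ to-inj ]′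

  adj : ∀ a b → SubdivideAdj F u v a b ⇔ SubdivideAdj K (to u) (to v) (f a) (f b)
  adj zero    zero    = mk⇔ id id
  adj zero    (suc b) = mk⇔ end end⁻
  adj (suc a) zero    = mk⇔ end end⁻
  adj (suc a) (suc b) = mk⇔
    (λ (r , ¬s) → Equivalence.to (adjacency a b) r , ¬s ∘ same⁻)
    (λ (r , ¬s) → Equivalence.from (adjacency a b) r , ¬s ∘ same)

-- The colored graph in which both halves of the subdivided edge keep its color.
module SubdivideColored {c} (F : ColoredGraph c) {i₀ : Fin c} {u v} (uv : ColoredGraph.D F i₀ u v) where
  open ColoredGraph F

  private
    Adj : Fin c → Rel (Fin (suc order)) 0ℓ
    Adj i zero    zero    = ⊥
    Adj i zero    (suc b) = i ≡ i₀ × (b ≡ u ⊎ b ≡ v)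
    Adj i (suc a) zero    = i ≡ i₀ × (a ≡ u ⊎ a ≡ v)
    Adj i (suc a) (suc b) = D i a b × ¬ SamePair (a , b) (u , v)

    end? : ∀ i a → Dec (i ≡ i₀ × (a ≡ u ⊎ a ≡ v))
    end? i a = (i Fin.≟ i₀) ×-dec ((a Fin.≟ u) ⊎-dec (a Fin.≟ v))

    adj? : ∀ i → Decidable (Adj i)
    adj? i zero    zero    = no λ ()
    adj? i zero    (suc b) = end? i b
    adj? i (suc a) zero    = end? i a
    adj? i (suc a) (suc b) = D? i a b ×-dec ¬? (samePair? (a , b) (u , v))

    adj-sym : ∀ i a b → Adj i a b → Adj i b a
    adj-sym i zero    (suc b) p       = p
    adj-sym i (suc a) zero    p       = p
    adj-sym i (suc a) (suc b) (p , q) = D-sym i p , q ∘ samePair-swap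

    adj-irrefl : ∀ i a → ¬ Adj i a a
    adj-irrefl i (suc a) (p , _) = D-irrefl i refl p

    adj-disjoint : ∀ {i j} a b → Adj i a b → Adj j a b → i ≡ j
    adj-disjoint zero    (suc b) (p , _) (q , _) = trans p (sym q)
    adj-disjoint (suc a) zero    (p , _) (q , _) = trans p (sym q)
    adj-disjoint (suc a) (suc b) (p , _) (q , _) = disjoint p q

    u≢v : u ≢ v
    u≢v eq = D-irrefl i₀ eq uv

    same⇒color : ∀ {i a b} → D i a b → SamePair (a , b) (u , v) → i ≡ i₀
    same⇒color r (inj₁ (refl , refl)) = disjoint r uv
    same⇒color r (inj₂ (refl , refl)) = disjoint (D-sym _ r) uv

    same⇒end : ∀ {a b} → SamePair (a , b) (u , v) → a ≡ u ⊎ a ≡ v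
    same⇒end (inj₁ (p , _)) = inj₁ p
    same⇒end (inj₂ (p , _)) = inj₂ p

  subdivided : ColoredGraph c
  subdivided = record
    { order    = suc order
    ; D        = Adj
    ; D?       = adj?
    ; D-sym    = λ i {a} {b} → adj-sym i a b
    ; D-irrefl = λ { i {a} refl → adj-irrefl i a }
    ; disjoint = λ {i} {j} {a} {b} → adj-disjoint a b
    }

  private
    module S = ColoredGraph subdivided

  underlying-subdivided : S.underlying ≅ subdivide underlying u v (i₀ , uv)
  underlying-subdivided = bijective⇒≅ id id (λ w → w , refl) adj
    where
    adj : ∀ a b → (∃[ i ] Adj i a b) ⇔ SubdivideAdj underlying u v a b
    adj zero    zero    = mk⇔ (λ ()) (λ ())
    adj zero    (suc b) = mk⇔ (λ (_ , _ , e) → e) (λ e → i₀ , refl , e)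
    adj (suc a) zero    = mk⇔ (λ (_ , _ , e) → e) (λ e → i₀ , refl , e)
    adj (suc a) (suc b) = mk⇔ (λ (i , r , ¬s) → (i , r) , ¬s) (λ ((i , r) , ¬s) → i , r , ¬s)

  -- An end of the split edge loses one neighbor of that color and gains the new vertex; elsewhere
  -- nothing changes. Both the loss and the gain are counted by `end?`.
  degree-old : ∀ a i → S.degree (suc a) i ≡ degree a i
  degree-old a i = begin
    S.degree (suc a) i
      ≡⟨ #-suc (adj? i (suc a)) ⟩
    𝟙 (end? i a) + # (adj? i (suc a) ∘ suc)
      ≡⟨ cong₂ _+_ (sym removed) (#-∑ (adj? i (suc a) ∘ suc)) ⟩
    # removed? + ∑ᶠ (λ b → 𝟙 (adj? i (suc a) (suc b)))
      ≡⟨ cong (_+ ∑ᶠ (λ b → 𝟙 (adj? i (suc a) (suc b)))) (#-∑ removed?) ⟩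
    ∑ᶠ (𝟙 ∘ removed?) + ∑ᶠ (λ b → 𝟙 (adj? i (suc a) (suc b)))
      ≡⟨ sym (∑-+ (allFin order) _ _) ⟩
    ∑ᶠ (λ b → 𝟙 (removed? b) + 𝟙 (adj? i (suc a) (suc b)))
      ≡⟨ ∑-cong (allFin order) pointwise ⟩
    ∑ᶠ (λ b → 𝟙 (D? i a b))
      ≡⟨ sym (#-∑ (D? i a)) ⟩
    degree a i ∎
    where
    open ≡-Reasoning
    removed? : ∀ b → Dec (D i a b × SamePair (a , b) (u , v))
    removed? b = D? i a b ×-dec samePair? (a , b) (u , v)

    pointwise : ∀ b → 𝟙 (removed? b) + 𝟙 (adj? i (suc a) (suc b)) ≡ 𝟙 (D? i a b)
    pointwise b = 𝟙-split (D? i a b) (samePair? (a , b) (u , v))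

    once : i ≡ i₀ × (a ≡ u ⊎ a ≡ v) → # removed? ≡ 1
    once (refl , inj₁ refl) = #-unique removed? (uv , inj₁ (refl , refl))
      λ { _ (_ , inj₁ (_ , q)) → q ; _ (_ , inj₂ (p , _)) → contradiction p u≢v }
    once (refl , inj₂ refl) = #-unique removed? (D-sym _ uv , inj₂ (refl , refl))
      λ { _ (_ , inj₁ (p , _)) → contradiction (sym p) u≢v ; _ (_ , inj₂ (_ , q)) → q }

    removed : # removed? ≡ 𝟙 (end? i a)
    removed = [ (λ e → trans (once e) (sym (𝟙-yes (end? i a) e)))
              , (λ ¬e → trans (#≡0 removed? (λ b (r , s) → ¬e (same⇒color r s , same⇒end s)))
                              (sym (𝟙-no (end? i a) ¬e))) ]′ (Dec.toSum (end? i a))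

  coloredDegree-old : ∀ a → S.coloredDegree (suc a) ≡ coloredDegree a
  coloredDegree-old a = Vec.tabulate-cong (degree-old a)

  coloredDegree-new : InΔ (S.coloredDegree zero)
  coloredDegree-new = i₀ , trans (lookup-degree subdivided zero i₀) two ,
    λ j j≢ → trans (lookup-degree subdivided zero j)
      (#≡0 (adj? j zero) λ { zero () ; (suc b) (p , _) → j≢ p })
    where
    open ≡-Reasoning
    two : S.degree zero i₀ ≡ 2
    two = begin
      S.degree zero i₀
        ≡⟨ #-suc (adj? i₀ zero) ⟩
      # (end? i₀)
        ≡⟨ #-∑ (end? i₀) ⟩
      ∑ᶠ (λ b → 𝟙 (end? i₀ b))
        ≡⟨ ∑-cong (allFin order) pointwise ⟩
      ∑ᶠ (λ b → 𝟙 (b Fin.≟ u) + 𝟙 (b Fin.≟ v))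
        ≡⟨ ∑-+ (allFin order) _ _ ⟩
      ∑ᶠ (λ b → 𝟙 (b Fin.≟ u)) + ∑ᶠ (λ b → 𝟙 (b Fin.≟ v))
        ≡⟨ cong₂ _+_ (once u) (once v) ⟩
      2 ∎
      where
      once : ∀ w → ∑ᶠ (λ b → 𝟙 (b Fin.≟ w)) ≡ 1
      once w = trans (sym (#-∑ (Fin._≟ w))) (#-unique (Fin._≟ w) refl (λ _ → id))

      pointwise : ∀ b → 𝟙 (end? i₀ b) ≡ 𝟙 (b Fin.≟ u) + 𝟙 (b Fin.≟ v)
      pointwise b = trans
        (𝟙-⇔ (end? i₀ b) ((b Fin.≟ u) ⊎-dec (b Fin.≟ v)) proj₂ (refl ,_))
        (𝟙-⊎ (b Fin.≟ u) (b Fin.≟ v) λ { refl → u≢v })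

  DS-subdivided : S.DS ≡ S.coloredDegree zero ∷ DS
  DS-subdivided = cong (S.coloredDegree zero ∷_) (begin
    map S.coloredDegree (tabulate suc)           ≡⟨ List.map-tabulate suc S.coloredDegree ⟩
    tabulate (S.coloredDegree ∘ suc)             ≡⟨ List.tabulate-cong coloredDegree-old ⟩
    tabulate coloredDegree                       ≡⟨ sym (List.map-tabulate id coloredDegree) ⟩
    DS                                           ∎)
    where open ≡-Reasoning

  -- Old walks survive by taking the detour through the new vertex in place of the split edge. The
  -- new vertex is first moved to an old neighbor, its anchor.
  linked-subdivided : Linked F → Linked subdivided
  linked-subdivided linked i t t′ = join (anchor t) (anchor t′)
    where
    detour : ∀ {a b} → D i a b → Star (Adj i) (suc a) (suc b)
    detour {a} {b} r with samePair? (a , b) (u , v)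
    ... | no ¬s = (r , ¬s) ◅ ε
    ... | yes s = _◅_ {j = zero} (same⇒color r s , same⇒end s)
      ((same⇒color r s , same⇒end (samePair-swap s)) ◅ ε)

    end-touched : ∀ {a} → i ≡ i₀ → a ≡ u ⊎ a ≡ v → Degrees.Touched (D? i) a
    end-touched refl (inj₁ refl) = v , uv
    end-touched refl (inj₂ refl) = u , D-sym i₀ uv

    Anchored : S.Vertex → Set
    Anchored x = ∃[ a ] Degrees.Touched (D? i) a × Star (Adj i) x (suc a)

    join : ∀ {x y} → Anchored x → Anchored y → Star (Adj i) x y
    join (a , ta , p) (b , tb , q) =
      p ◅◅ Star.kleisliStar suc detour (linked i ta tb) ◅◅ Star.reverse (λ {a} {b} → adj-sym i a b) q

    anchor : ∀ {x} → Degrees.Touched (adj? i) x → Anchored x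
    anchor {zero}  (suc b , r)       = b , end-touched (proj₁ r) (proj₂ r) , r ◅ ε
    anchor {suc a} (zero , p , e)    = a , end-touched p e , ε
    anchor {suc a} (suc b , r , _)   = a , (b , r) , ε

  -- Contracting the new vertex into `u` turns each edge into an edge of the same color or into
  -- nothing.
  linked-subdivided⁻ : Linked subdivided → Linked F
  linked-subdivided⁻ linked i ta tb = Star.kleisliStar contract shortcut (linked i (lift ta) (lift tb))
    where
    contract : S.Vertex → Vertex
    contract zero    = u
    contract (suc a) = a

    shortcut : ∀ {x y} → Adj i x y → Star (D i) (contract x) (contract y)
    shortcut {zero}  {suc b} (_ , inj₁ refl)    = ε
    shortcut {zero}  {suc b} (refl , inj₂ refl) = uv ◅ ε
    shortcut {suc a} {zero}  (_ , inj₁ refl)    = ε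
    shortcut {suc a} {zero}  (refl , inj₂ refl) = D-sym i₀ uv ◅ ε
    shortcut {suc a} {suc b} (r , _)            = r ◅ ε

    lift : ∀ {a} → Degrees.Touched (D? i) a → Degrees.Touched (adj? i) (suc a)
    lift {a} (b , r) with samePair? (a , b) (u , v)
    ... | no ¬s = suc b , r , ¬s
    ... | yes s = zero , same⇒color r s , same⇒end s

-- Condition (a) turned from a permutation of lists into a map: `ι` marks the vertices of `F` that
-- play the vertices of `H`, and all the others can be smoothed away.
record Realizes {c} (F₀ F : ColoredGraph c) : Set where
  private
    module F₀ = ColoredGraph F₀
    module F  = ColoredGraph F
  field
    ι           : F₀.Vertex → F.Vertex
    ι-injective : ∀ {h k} → ι h ≡ ι k → h ≡ k
    ι-degree    : ∀ h → F.coloredDegree (ι h) ≡ F₀.coloredDegree h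
    others      : ∀ u → (∃[ h ] ι h ≡ u) ⊎ InΔ (F.coloredDegree u)

  degree-ι : ∀ h i → F.degree (ι h) i ≡ F₀.degree h i
  degree-ι h i = trans (sym (lookup-degree F (ι h) i))
    (trans (cong (λ δ → Vec.lookup δ i) (ι-degree h)) (lookup-degree F₀ h i))

module _ {A B : Set} (g : A → B) where

  map≡tabulate : ∀ {n} {f : Fin n → B} xs → map g xs ≡ tabulate f →
                 ∃[ ι ] xs ≡ tabulate ι × (∀ i → g (ι i) ≡ f i)
  map≡tabulate {zero}  []       _  = (λ ()) , refl , λ ()
  map≡tabulate {suc n} (x ∷ xs) eq
    with ι , refl , eqs ← map≡tabulate xs (List.∷-injectiveʳ eq) =
    (λ { zero → x ; (suc i) → ι i }) , refl , λ { zero → List.∷-injectiveˡ eq ; (suc i) → eqs i }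

  map≡++ : ∀ xs ys {zs} → map g xs ≡ ys ++ zs →
           ∃[ us ] ∃[ ws ] xs ≡ us ++ ws × map g us ≡ ys × map g ws ≡ zs
  map≡++ xs       []       eq = [] , xs , refl , refl , eq
  map≡++ (x ∷ xs) (y ∷ ys) eq
    with us , ws , refl , p , q ← map≡++ xs ys (List.∷-injectiveʳ eq) =
    x ∷ us , ws , refl , cong₂ _∷_ (List.∷-injectiveˡ eq) p , q

unique-tabulate⁻ : ∀ {A : Set} {n} {f : Fin n → A} {zs} → Unique (tabulate f ++ zs) →
                   ∀ {i j} → f i ≡ f j → i ≡ j
unique-tabulate⁻ {n = suc n} {f} (x∉ ∷ uniq) {zero}  {zero}  eq = refl
unique-tabulate⁻ {n = suc n} {f} (x∉ ∷ uniq) {zero}  {suc j} eq =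
  contradiction eq (All.tabulate⁻ (All.++⁻ˡ (tabulate (f ∘ suc)) x∉) j)
unique-tabulate⁻ {n = suc n} {f} (x∉ ∷ uniq) {suc i} {zero}  eq =
  contradiction (sym eq) (All.tabulate⁻ (All.++⁻ˡ (tabulate (f ∘ suc)) x∉) i)
unique-tabulate⁻ {n = suc n} {f} (x∉ ∷ uniq) {suc i} {suc j} eq = cong suc (unique-tabulate⁻ uniq eq)

-- Pulling the permutation back along `map` lists the vertices of `F` so that those carrying `M`
-- come first; `ι` reads this initial segment.
extends⇒realizes : ∀ {c} (F₀ F : ColoredGraph c) →
                   ExtendsByΔ (ColoredGraph.DS F₀) (ColoredGraph.DS F) → Realizes F₀ F
extends⇒realizes {c} F₀ F (L , inΔ , ds) = from-lists (↭.↭-map-inv F.coloredDegree ds)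
  where
  module F  = ColoredGraph F
  module F₀ = ColoredGraph F₀

  from-split : ∀ {us ws} → allFin F.order ↭ us ++ ws → map F.coloredDegree ws ≡ L →
               (∃[ ι ] us ≡ tabulate ι × (∀ h → F.coloredDegree (ι h) ≡ F₀.coloredDegree h)) →
               Realizes F₀ F
  from-split {ws = ws} all↭ ws≡ (ι , refl , degrees) = record
    { ι           = ι
    ; ι-injective = unique-tabulate⁻ {zs = ws}
        (Setoid↭ₚ.Unique-resp-↭ (setoid F.Vertex) (↭⇒↭ₛ all↭) (Unique.allFin⁺ F.order))
    ; ι-degree    = degrees
    ; others      = λ u → classify u (∈-++⁻ (tabulate ι) (↭.∈-resp-↭ all↭ (∈-allFin u)))
    }
    where
    classify : ∀ u → u ∈ tabulate ι ⊎ u ∈ ws → (∃[ h ] ι h ≡ u) ⊎ InΔ (F.coloredDegree u)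
    classify u (inj₁ u∈) with h , eq ← ∈-tabulate⁻ u∈ = inj₁ (h , sym eq)
    classify u (inj₂ u∈) = inj₂ (All.lookup inΔ (subst (F.coloredDegree u ∈_) ws≡ (∈-map⁺ F.coloredDegree u∈)))

  from-lists : (∃[ vs ] F₀.DS ++ L ≡ map F.coloredDegree vs × allFin F.order ↭ vs) → Realizes F₀ F
  from-lists (vs , eq , all↭)
    with us , ws , refl , us≡ , ws≡ ← map≡++ F.coloredDegree vs F₀.DS (sym eq) =
    from-split all↭ ws≡
      (map≡tabulate F.coloredDegree us (trans us≡ (List.map-tabulate id F₀.coloredDegree)))

-- Subdivisions of H satisfy C*_M

module _ {c} {H : Graph} (F₀ : ColoredGraph c) (colorizes : ColoredGraph.underlying F₀ ≅ H) (linked₀ : Linked F₀) where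

  private
    M = ColoredGraph.DS F₀

  subdivision⇒colored : ∀ {F} → Subdivided H F →
    ∃[ Fᶜ ] ColoredGraph.underlying Fᶜ ≅ F × ExtendsByΔ M (ColoredGraph.DS Fᶜ) × Linked Fᶜ
  subdivision⇒colored none = F₀ , colorizes , ([] , [] , ↭-sym (↭.++-identityʳ M)) , linked₀
  subdivision⇒colored (step {F} sub u v r)
    with Fᶜ , φ , (L , inΔ , ds) , linked ← subdivision⇒colored sub =
    subdivided , ψ , (δ ∷ L , coloredDegree-new ∷ inΔ , ds′) , linked-subdivided linked
    where
    φ⁻ : F ≅ ColoredGraph.underlying Fᶜ
    φ⁻ = ≅-sym φ

    uv = proj₂ (Equivalence.to (_≅_.adjacency φ⁻ u v) r)

    open SubdivideColored Fᶜ uv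

    δ = ColoredGraph.coloredDegree subdivided zero

    ψ : ColoredGraph.underlying subdivided ≅ subdivide F u v r
    ψ = ≅-trans underlying-subdivided (≅-sym (subdivide-cong φ⁻ r))

    ds′ : ColoredGraph.DS subdivided ↭ M ++ δ ∷ L
    ds′ = subst (_↭ M ++ δ ∷ L) (sym DS-subdivided)
      (↭-trans (prep δ ds) (↭-sym (↭.shift δ M L)))

∑ᶠ-image : ∀ {m n} (ι : Fin m → Fin n) → (∀ {h k} → ι h ≡ ι k → h ≡ k) → (f : Fin n → ℕ) →
           (∀ u → (∃[ h ] ι h ≡ u) ⊎ f u ≡ 0) → ∑ᶠ f ≡ ∑ᶠ (f ∘ ι)
∑ᶠ-image {m} {n} ι inj f off = ℕ.≤-antisym
  (begin
    ∑ᶠ f                            ≡⟨ sym (∑-filter image? f (allFin n) outside) ⟩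
    ∑ (filter image? (allFin n)) f  ≤⟨ ∑-⊆ f (Unique.filter⁺ image? (Unique.allFin⁺ n)) inside ⟩
    ∑ (map ι (allFin m)) f          ≡⟨ ∑-map ι f (allFin m) ⟩
    ∑ᶠ (f ∘ ι)                      ∎)
  (begin
    ∑ᶠ (f ∘ ι)                      ≡⟨ sym (∑-map ι f (allFin m)) ⟩
    ∑ (map ι (allFin m)) f          ≤⟨ ∑-⊆ f (Unique.map⁺ inj (Unique.allFin⁺ m)) (λ _ → ∈-allFin _) ⟩
    ∑ᶠ f                            ∎)
  where
  open ℕ.≤-Reasoning
  image? : ∀ u → Dec (∃[ h ] ι h ≡ u)
  image? u = Fin.any? λ h → ι h Fin.≟ u

  outside : ∀ u → ¬ (∃[ h ] ι h ≡ u) → f u ≡ 0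
  outside u ¬im with off u
  ... | inj₁ im = contradiction im ¬im
  ... | inj₂ z  = z

  inside : ∀ {u} → u ∈ filter image? (allFin n) → u ∈ map ι (allFin m)
  inside u∈ with h , refl ← proj₂ (∈-filter⁻ image? {xs = allFin n} u∈) = ∈-map⁺ ι (∈-allFin h)

#≡2 : ∀ {n} {P : Fin n → Set} (P? : ∀ i → Dec (P i)) → # P? ≡ 2 →
      ∃[ u ] ∃[ v ] u ≢ v × P u × P v × (∀ w → P w → w ≡ u ⊎ w ≡ v)
#≡2 {n} {P} P? eq = from-list (filter P? (allFin n)) eq (Unique.filter⁺ P? (Unique.allFin⁺ n))
  (λ i∈ → proj₂ (∈-filter⁻ P? {xs = allFin n} i∈)) (λ p → ∈-filter⁺ P? (∈-allFin _) p)
  where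
  from-list : ∀ xs → length xs ≡ 2 → Unique xs → (∀ {i} → i ∈ xs → P i) → (∀ {i} → P i → i ∈ xs) →
              ∃[ u ] ∃[ v ] u ≢ v × P u × P v × (∀ w → P w → w ≡ u ⊎ w ≡ v)
  from-list (u ∷ v ∷ []) _ ((u≢v ∷ []) ∷ _) sound complete =
    u , v , u≢v , sound (here refl) , sound (there (here refl)) , λ w p → which (complete p)
    where
    which : ∀ {w} → w ∈ u ∷ v ∷ [] → w ≡ u ⊎ w ≡ v
    which (here eq)         = inj₁ eq
    which (there (here eq)) = inj₂ eq

-- Deleting a vertex of degree 2 whose neighbors are adjacent keeps the graph
-- connected but removes two edges, so the graph was not a tree.
module RemoveVertex {n} {R : Rel (Fin n) 0ℓ} (R? : Decidable R) (R-sym : Symmetric R) (R-irrefl : Irreflexive _≡_ R)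
  (linked : Degrees.AllLinked R?) {x u v} (xu : R x u) (xv : R x v) (only : ∀ w → R x w → w ≡ u ⊎ w ≡ v)
  (deg-x : Degrees.deg R? x ≡ 2) (uv : R u v) where

  open Degrees R?

  private
    R′ : Rel (Fin n) 0ℓ
    R′ a b = R a b × a ≢ x × b ≢ x

    R′? : Decidable R′
    R′? a b = R? a b ×-dec (¬? (a Fin.≟ x) ×-dec ¬? (b Fin.≟ x))

    module D′ = Degrees R′?

    u≢x : u ≢ x
    u≢x eq = R-irrefl (sym eq) xu

    v≢x : v ≢ x
    v≢x eq = R-irrefl (sym eq) xv

    R′-sym : Symmetric R′
    R′-sym (r , p , q) = R-sym r , q , p

    -- A walk enters and leaves `x` through `u` or `v` only. With `x` sent to `u`, the edge `uv`
    -- fills whatever gap remains.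
    redirect : Fin n → Fin n
    redirect a with a Fin.≟ x
    ... | yes _ = u
    ... | no  _ = a

    redirect-≢ : ∀ {a} → a ≢ x → redirect a ≡ a
    redirect-≢ {a} a≢x with a Fin.≟ x
    ... | yes a≡x = contradiction a≡x a≢x
    ... | no  _   = refl

    around : ∀ {b} → R x b → Star R′ u b
    around {b} r with only b r
    ... | inj₁ refl = ε
    ... | inj₂ refl = (uv , u≢x , v≢x) ◅ ε

    redirect-edge : ∀ {a b} → R a b → Star R′ (redirect a) (redirect b)
    redirect-edge {a} {b} r with a Fin.≟ x | b Fin.≟ x
    ... | yes refl | yes refl = contradiction r (R-irrefl refl)
    ... | yes refl | no  _    = around r
    ... | no _     | yes refl = Star.reverse R′-sym (around (R-sym r))
    ... | no a≢x   | no b≢x   = (r , a≢x , b≢x) ◅ ε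

    linked′ : D′.AllLinked
    linked′ {a} {b} (_ , r , a≢x , _) (_ , s , b≢x , _) = subst₂ (Star R′) (redirect-≢ a≢x) (redirect-≢ b≢x)
      (Star.kleisliStar redirect redirect-edge (linked (_ , r) (_ , s)))

    deg-removed : ∀ a → deg a ≡ D′.deg a + (𝟙 (R? a x) + 2 * 𝟙 (a Fin.≟ x))
    deg-removed a = by-cases (a Fin.≟ x)
      where
      open ≡-Reasoning
      by-cases : (a≟x : Dec (a ≡ x)) → deg a ≡ D′.deg a + (𝟙 (R? a x) + 2 * 𝟙 a≟x)
      by-cases (yes refl) = trans deg-x (sym (cong₂ (λ k l → k + (l + 2))
        (#≡0 (R′? x) λ _ (_ , x≢x , _) → x≢x refl) (𝟙-no (R? x x) (R-irrefl refl))))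
      by-cases (no a≢x) = begin
        deg a
          ≡⟨ #-∑ (R? a) ⟩
        ∑ᶠ (λ b → 𝟙 (R? a b))
          ≡⟨ ∑-cong (allFin n) (λ b → sym (𝟙-split (R? a b) (b Fin.≟ x))) ⟩
        ∑ᶠ (λ b → 𝟙 (R? a b ×-dec (b Fin.≟ x)) + 𝟙 (R? a b ×-dec ¬? (b Fin.≟ x)))
          ≡⟨ ∑-+ (allFin n) _ _ ⟩
        ∑ᶠ (λ b → 𝟙 (R? a b ×-dec (b Fin.≟ x))) + ∑ᶠ (λ b → 𝟙 (R? a b ×-dec ¬? (b Fin.≟ x)))
          ≡⟨ cong₂ _+_
               (trans (∑ᶠ-only _ x (λ b b≢x → 𝟙-no (R? a b ×-dec (b Fin.≟ x)) (b≢x ∘ proj₂)))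
                 (𝟙-⇔ (R? a x ×-dec (x Fin.≟ x)) (R? a x) proj₁ (_, refl)))
               (trans (∑-cong (allFin n) λ b → 𝟙-⇔ (R? a b ×-dec ¬? (b Fin.≟ x)) (R′? a b)
                 (λ (r , b≢x) → r , a≢x , b≢x) (λ (r , _ , b≢x) → r , b≢x))
                 (sym (#-∑ (R′? a)))) ⟩
        𝟙 (R? a x) + D′.deg a
          ≡⟨ ℕ.+-comm (𝟙 (R? a x)) (D′.deg a) ⟩
        D′.deg a + 𝟙 (R? a x)
          ≡⟨ cong (D′.deg a +_) (sym (ℕ.+-identityʳ _)) ⟩
        D′.deg a + (𝟙 (R? a x) + 0) ∎

    only-x : (k : ℕ) → ∑ᶠ (λ a → k * 𝟙 (a Fin.≟ x)) ≡ k
    only-x k = trans (∑ᶠ-only _ x λ a a≢x → trans (cong (k *_) (𝟙-no (a Fin.≟ x) a≢x)) (ℕ.*-zeroʳ k))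
      (trans (cong (k *_) (𝟙-yes (x Fin.≟ x) refl)) (ℕ.*-identityʳ k))

    -- The two edges at `x` account for four half-edges, two at `x` and one at each neighbor.
    ∑deg : ∑ᶠ deg ≡ ∑ᶠ D′.deg + 4
    ∑deg = begin
      ∑ᶠ deg
        ≡⟨ ∑-cong (allFin n) deg-removed ⟩
      ∑ᶠ (λ a → D′.deg a + (𝟙 (R? a x) + 2 * 𝟙 (a Fin.≟ x)))
        ≡⟨ ∑-+ (allFin n) D′.deg _ ⟩
      ∑ᶠ D′.deg + ∑ᶠ (λ a → 𝟙 (R? a x) + 2 * 𝟙 (a Fin.≟ x))
        ≡⟨ cong (∑ᶠ D′.deg +_) (∑-+ (allFin n) _ _) ⟩
      ∑ᶠ D′.deg + (∑ᶠ (λ a → 𝟙 (R? a x)) + ∑ᶠ (λ a → 2 * 𝟙 (a Fin.≟ x)))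
        ≡⟨ cong (∑ᶠ D′.deg +_) (cong₂ _+_
             (trans (∑-cong (allFin n) λ a → 𝟙-⇔ (R? a x) (R? x a) R-sym R-sym)
               (trans (sym (#-∑ (R? x))) deg-x))
             (only-x 2)) ⟩
      ∑ᶠ D′.deg + 4 ∎
      where open ≡-Reasoning

    #touched : # touched? ≡ # D′.touched? + 1
    #touched = begin
      # touched?                                          ≡⟨ #-∑ touched? ⟩
      ∑ᶠ (λ a → 𝟙 (touched? a))                           ≡⟨ ∑-cong (allFin n) (λ a → pointwise a (a Fin.≟ x)) ⟩
      ∑ᶠ (λ a → 𝟙 (D′.touched? a) + 1 * 𝟙 (a Fin.≟ x))    ≡⟨ ∑-+ (allFin n) _ _ ⟩
      ∑ᶠ (λ a → 𝟙 (D′.touched? a)) + ∑ᶠ (λ a → 1 * 𝟙 (a Fin.≟ x))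
                                                          ≡⟨ cong₂ _+_ (sym (#-∑ D′.touched?)) (only-x 1) ⟩
      # D′.touched? + 1                                   ∎
      where
      open ≡-Reasoning
      still : ∀ {a} → a ≢ x → Touched a → D′.Touched a
      still {a} a≢x (b , r) with b Fin.≟ x
      ... | no b≢x = b , r , a≢x , b≢x
      ... | yes refl with only a (R-sym r)
      ...   | inj₁ refl = v , uv , u≢x , v≢x
      ...   | inj₂ refl = u , R-sym uv , v≢x , u≢x

      pointwise : ∀ a (a≟x : Dec (a ≡ x)) → 𝟙 (touched? a) ≡ 𝟙 (D′.touched? a) + 1 * 𝟙 a≟x
      pointwise a (yes refl) = trans (𝟙-yes (touched? x) (u , xu))
        (cong (_+ 1) (sym (𝟙-no (D′.touched? x) λ (_ , _ , x≢x , _) → x≢x refl)))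
      pointwise a (no a≢x) = trans
        (𝟙-⇔ (touched? a) (D′.touched? a) (still a≢x) (λ (b , r , _) → b , r))
        (sym (ℕ.+-identityʳ _))

  not-tree : 2 * # touched? ≢ ∑ᶠ deg + 2
  not-tree tree = ℕ.<⇒≱ {∑ᶠ D′.deg + 2} {2 * # D′.touched?}
    (ℕ.+-cancelʳ-< 2 _ _ (begin-strict
      ∑ᶠ D′.deg + 2 + 2            <⟨ ℕ.m<m+n _ {2} (s≤s z≤n) ⟩
      ∑ᶠ D′.deg + 2 + 2 + 2        ≡⟨ arith (∑ᶠ D′.deg) ⟩
      ∑ᶠ D′.deg + 4 + 2            ≡⟨ cong (_+ 2) (sym ∑deg) ⟩
      ∑ᶠ deg + 2                   ≡⟨ sym tree ⟩
      2 * # touched?               ≡⟨ cong (2 *_) #touched ⟩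
      2 * (# D′.touched? + 1)      ≡⟨ ℕ.*-distribˡ-+ 2 (# D′.touched?) 1 ⟩
      2 * # D′.touched? + 2        ∎))
    (D′.connected-bound R′-sym linked′)
    where
    open ℕ.≤-Reasoning
    arith : ∀ k → k + 2 + 2 + 2 ≡ k + 4 + 2
    arith = solve-∀

-- Graphs satisfying C*_M are subdivisions of H

module Compare {c} (F₀ F : ColoredGraph c) (center : ∀ i → StarCenter F₀ i)
  (linked : Linked F) (real : Realizes F₀ F) where

  open Realizes real
  private
    module F₀ = ColoredGraph F₀
    module F  = ColoredGraph F
    module Z i = StarCenter (center i)
    module Deg i = Degrees (F.D? i)
    module Deg₀ i = Degrees (F₀.D? i)

  -- Distinct vertices of a star are adjacent as soon as one of them is the center. Degree at least
  -- 2 identifies the center; if no degree reaches 2, the star is a single edge and the two vertices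
  -- are its ends.
  star-adjacent : ∀ i {a b} → a ≢ b → Deg₀.Touched i a → Deg₀.Touched i b →
                  2 ≤ F₀.degree a i ⊎ 2 ≤ F₀.degree b i ⊎ (∀ w → F₀.degree w i ≤ 1) → F₀.D i a b
  star-adjacent i {a} {b} a≢b (a′ , ta) (b′ , tb) large with a Fin.≟ Z.z i | b Fin.≟ Z.z i
  ... | yes refl | yes refl = contradiction refl a≢b
  ... | yes refl | no b≢z   = F₀.D-sym i (subst (F₀.D i b) (Z.neighbor-is-center i b≢z tb) tb)
  ... | no a≢z   | yes refl = subst (F₀.D i a) (Z.neighbor-is-center i a≢z ta) ta
  ... | no a≢z   | no b≢z with large
  ...   | inj₁ le        = contradiction (Z.deg≥2⇒center i le) a≢z
  ...   | inj₂ (inj₁ le) = contradiction (Z.deg≥2⇒center i le) b≢z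
  ...   | inj₂ (inj₂ le) = contradiction (#≤1 (F₀.D? i (Z.z i)) (le (Z.z i)) (toward a≢z ta) (toward b≢z tb)) a≢b
    where
    toward : ∀ {w w′} → w ≢ Z.z i → F₀.D i w w′ → F₀.D i (Z.z i) w
    toward w≢z r = F₀.D-sym i (subst (F₀.D i _) (Z.neighbor-is-center i w≢z r) r)

  touched-ι : ∀ i {h} → Deg.Touched i (ι h) → Deg₀.Touched i h
  touched-ι i {h} t = Deg₀.deg≥1⇒touched i (subst (1 ≤_) (degree-ι h i) (Deg.touched⇒deg≥1 i t))

  touched-ι⁻ : ∀ i {h} → Deg₀.Touched i h → Deg.Touched i (ι h)
  touched-ι⁻ i {h} t = Deg.deg≥1⇒touched i (subst (1 ≤_) (sym (degree-ι h i)) (Deg₀.touched⇒deg≥1 i t))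

  -- If h and k were both leaves, the whole color-i component would be the
  -- closed set P, which leaves no room for a center of degree at least 2.
  adjacent-if : ∀ i {h k} → h ≢ k → Deg.Touched i (ι h) → Deg.Touched i (ι k) → (P : F.Vertex → Set) →
                (F.degree (ι h) i ≤ 1 → F.degree (ι k) i ≤ 1 → ∀ {u v} → P u → F.D i u v → P v) →
                P (ι h) → (∀ {w} → P (ι w) → w ≡ h ⊎ w ≡ k) → F₀.D i h k
  adjacent-if i {h} {k} h≢k th tk P closed ph only =
    star-adjacent i h≢k (touched-ι i th) (touched-ι i tk) (large (2 ℕ.≤? F₀.degree h i) (2 ℕ.≤? F₀.degree k i))
    where
    large : Dec (2 ≤ F₀.degree h i) → Dec (2 ≤ F₀.degree k i) →
            2 ≤ F₀.degree h i ⊎ 2 ≤ F₀.degree k i ⊎ (∀ w → F₀.degree w i ≤ 1)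
    large (yes le) _        = inj₁ le
    large (no _)   (yes le) = inj₂ (inj₁ le)
    large (no ¬h)  (no ¬k)  = inj₂ (inj₂ λ w → ℕ.≮⇒≥ (small w))
      where
      h≤1 : F₀.degree h i ≤ 1
      h≤1 = ℕ.≮⇒≥ ¬h
      k≤1 : F₀.degree k i ≤ 1
      k≤1 = ℕ.≮⇒≥ ¬k

      small : ∀ w → ¬ 2 ≤ F₀.degree w i
      small w le with only (Deg.closed-star i
        (closed (subst (_≤ 1) (sym (degree-ι h i)) h≤1) (subst (_≤ 1) (sym (degree-ι k i)) k≤1))
        ph (linked i th (touched-ι⁻ i (Deg₀.deg≥1⇒touched i (ℕ.≤-trans (s≤s z≤n) le)))))
      ... | inj₁ refl = ¬h le
      ... | inj₂ refl = ¬k le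

  -- Were both ends of the edge leaves, the edge would be a component of its color, so its two ends
  -- form the closed set required.
  reflect : ∀ i {h k} → F.D i (ι h) (ι k) → F₀.D i h k
  reflect i {h} {k} r = adjacent-if i (λ { refl → F.D-irrefl i refl r }) (ι k , r) (ι h , F.D-sym i r)
    (λ w → w ≡ ι h ⊎ w ≡ ι k)
    (λ { h≤1 k≤1 (inj₁ refl) s → inj₂ (#≤1 (F.D? i _) h≤1 s r)
       ; h≤1 k≤1 (inj₂ refl) s → inj₁ (#≤1 (F.D? i _) k≤1 s (F.D-sym i r)) })
    (inj₁ refl) [ inj₁ ∘ ι-injective , inj₂ ∘ ι-injective ]′

  module _ (surjective : ∀ u → ∃[ h ] ι h ≡ u) where

    private
      -- Equal degrees give the leaf some neighbor in `F`; reflecting that edge shows that the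
      -- neighbor can only be the center.
      spoke : ∀ i {k} → k ≢ Z.z i → F₀.D i (Z.z i) k → F.D i (ι k) (ι (Z.z i))
      spoke i {k} k≢z r
        with u , s ← touched-ι⁻ i (_ , F₀.D-sym i r)
        with h , refl ← surjective u =
        subst (λ z → F.D i (ι k) (ι z)) (Z.neighbor-is-center i k≢z (reflect i s)) s

    preserve : ∀ i {h k} → F₀.D i h k → F.D i (ι h) (ι k)
    preserve i r with Z.through i r
    ... | inj₁ refl = F.D-sym i (spoke i (λ eq → F₀.D-irrefl i (sym eq) r) r)
    ... | inj₂ refl = spoke i (λ eq → F₀.D-irrefl i eq r) (F₀.D-sym i r)

    underlying-≅ : F₀.underlying ≅ F.underlying
    underlying-≅ = bijective⇒≅ ι ι-injective surjective
      λ h k → mk⇔ (λ (i , r) → i , preserve i r) (λ (i , r) → i , reflect i r)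

  others-pure : ∀ u → ¬ (∃[ h ] ι h ≡ u) → InΔ (F.coloredDegree u)
  others-pure u ¬im = [ (λ im → contradiction im ¬im) , id ]′ (others u)

  -- An element of Δ has a single nonzero entry, so a vertex meeting two colors must come from `H`.
  two-colors⇒image : ∀ {i j u} → i ≢ j → Deg.Touched i u → Deg.Touched j u → ∃[ h ] ι h ≡ u
  two-colors⇒image {i} {j} {u} i≢j ti tj with others u
  ... | inj₁ im            = im
  ... | inj₂ (k , _ , off) = contradiction (trans (on-k i ti) (sym (on-k j tj))) i≢j
    where
    on-k : ∀ l → Deg.Touched l u → l ≡ k
    on-k l t with l Fin.≟ k
    ... | yes eq = eq
    ... | no neq = contradiction (subst (1 ≤_) (trans (sym (lookup-degree F u l)) (off l neq)) (Deg.touched⇒deg≥1 l t)) λ ()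

  -- A vertex outside the image has color-i degree 0 or 2, so it does not affect
  -- the difference between the two sides.
  tree : ∀ i → 2 * # (Deg.touched? i) ≡ ∑ᶠ (Deg.deg i) + 2
  tree i = ℕ.+-cancelʳ-≡ over _ _ (begin
    2 * # (Deg.touched? i) + over     ≡⟨ Deg.∑-deg-split i ⟩
    ∑ᶠ (Deg.deg i) + ends             ≡⟨ cong (∑ᶠ (Deg.deg i) +_) ends≡ ⟩
    ∑ᶠ (Deg.deg i) + (over + 2)       ≡⟨ cong (∑ᶠ (Deg.deg i) +_) (ℕ.+-comm over 2) ⟩
    ∑ᶠ (Deg.deg i) + (2 + over)       ≡⟨ sym (ℕ.+-assoc (∑ᶠ (Deg.deg i)) 2 over) ⟩
    ∑ᶠ (Deg.deg i) + 2 + over         ∎)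
    where
    open ≡-Reasoning
    over ends : ℕ
    over = ∑ᶠ (λ u → F.degree u i ∸ 2)
    ends = ∑ᶠ (λ u → 𝟙 (F.degree u i ℕ.≟ 1))

    transfer : (h : ℕ → ℕ) → h 0 ≡ 0 → h 2 ≡ 0 →
               ∑ᶠ (λ u → h (F.degree u i)) ≡ ∑ᶠ (λ w → h (F₀.degree w i))
    transfer h h0 h2 = trans (∑ᶠ-image ι ι-injective (λ u → h (F.degree u i)) off)
      (∑-cong (allFin F₀.order) λ w → cong h (degree-ι w i))
      where
      off : ∀ u → (∃[ w ] ι w ≡ u) ⊎ h (F.degree u i) ≡ 0
      off u with others u
      ... | inj₁ im = inj₁ im
      ... | inj₂ (k , two , zeros) with i Fin.≟ k
      ...   | yes refl = inj₂ (trans (cong h (trans (sym (lookup-degree F u i)) two)) h2)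
      ...   | no i≢k   = inj₂ (trans (cong h (trans (sym (lookup-degree F u i)) (zeros i i≢k))) h0)

    ends≡ : ends ≡ over + 2
    ends≡ = trans (transfer (λ d → 𝟙 (d ℕ.≟ 1)) refl refl)
      (trans (Z.ends≡over+2 i) (cong (_+ 2) (sym (transfer (_∸ 2) refl refl))))

  module _ {x i u v} (x∉ : ¬ (∃[ h ] ι h ≡ x)) (u≢v : u ≢ v) (xu : F.D i x u) (xv : F.D i x v)
    (only : ∀ w → F.D i x w → w ≡ u ⊎ w ≡ v) (deg-x : F.degree x i ≡ 2) where

    private
      -- The edge `uv` reflects to an edge of color `j` in the coloring of `H`. The path through `x`
      -- yields one of color `i` between the same vertices, because `u`, `v`, `x` would form a
      -- closed set if both ends were leaves. A single edge would have two colors.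
      clash : ∀ {j} → i ≢ j → F.D j u v → (∃[ h ] ι h ≡ u) → (∃[ k ] ι k ≡ v) → ⊥
      clash {j} i≢j r (h , refl) (k , refl) = i≢j (F₀.disjoint in-i in-j)
        where
        in-j : F₀.D j h k
        in-j = reflect j r

        in-i : F₀.D i h k
        in-i = adjacent-if i (λ { refl → u≢v refl }) (x , F.D-sym i xu) (x , F.D-sym i xv)
          (λ w → w ≡ ι h ⊎ w ≡ ι k ⊎ w ≡ x)
          (λ { h≤1 k≤1 (inj₁ refl) s → inj₂ (inj₂ (#≤1 (F.D? i _) h≤1 s (F.D-sym i xu)))
             ; h≤1 k≤1 (inj₂ (inj₁ refl)) s → inj₂ (inj₂ (#≤1 (F.D? i _) k≤1 s (F.D-sym i xv)))
             ; h≤1 k≤1 (inj₂ (inj₂ refl)) s → [ inj₁ , inj₂ ∘ inj₁ ]′ (only _ s) })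
          (inj₁ refl)
          λ { (inj₁ eq) → inj₁ (ι-injective eq) ; (inj₂ (inj₁ eq)) → inj₂ (ι-injective eq)
            ; (inj₂ (inj₂ eq)) → contradiction (_ , eq) x∉ }

    neighbors-nonadjacent : ∀ j → ¬ F.D j u v
    neighbors-nonadjacent j r with i Fin.≟ j
    ... | yes refl = RemoveVertex.not-tree (F.D? i) (F.D-sym i) (F.D-irrefl i) (linked i) xu xv only deg-x r (tree i)
    ... | no i≢j   = clash i≢j r
      (two-colors⇒image i≢j (x , F.D-sym i xu) (v , r))
      (two-colors⇒image i≢j (x , F.D-sym i xv) (u , F.D-sym j r))

-- Degrees and connectivity of the smoothed graph are not computed directly: it is subdivided again,
-- and the result is matched with the given graph by a bijection. Nonadjacency of `u` and `v` keeps
-- the restored edge from coinciding with an old one.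
module Smooth {c n} (D : Fin c → Rel (Fin (suc n)) 0ℓ) (D? : ∀ i → Decidable (D i)) (D-sym : ∀ i → Symmetric (D i))
  (D-irrefl : ∀ i → Irreflexive _≡_ (D i)) (disjoint : ∀ {i j u v} → D i u v → D j u v → i ≡ j)
  {x : Fin (suc n)} {i₀ : Fin c} {u v : Fin n} (u≢v : u ≢ v)
  (xu : D i₀ x (punchIn x u)) (xv : D i₀ x (punchIn x v))
  (only : ∀ j w → D j x (punchIn x w) → j ≡ i₀ × (w ≡ u ⊎ w ≡ v))
  (nonadjacent : ∀ j → ¬ D j (punchIn x u) (punchIn x v)) where

  F : ColoredGraph c
  F = record { order = suc n ; D = D ; D? = D? ; D-sym = D-sym ; D-irrefl = D-irrefl ; disjoint = disjoint }

  private
    p = punchIn x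

    Adj : Fin c → Rel (Fin n) 0ℓ
    Adj j a b = D j (p a) (p b) ⊎ (j ≡ i₀ × SamePair (a , b) (u , v))

    not-same : ∀ {j a b} → D j (p a) (p b) → ¬ SamePair (a , b) (u , v)
    not-same r (inj₁ (refl , refl)) = nonadjacent _ r
    not-same r (inj₂ (refl , refl)) = nonadjacent _ (D-sym _ r)

    adj-irrefl : ∀ j a → ¬ Adj j a a
    adj-irrefl j a (inj₁ r) = D-irrefl j refl r
    adj-irrefl j a (inj₂ (_ , inj₁ (refl , q))) = u≢v q
    adj-irrefl j a (inj₂ (_ , inj₂ (refl , q))) = u≢v (sym q)

    adj-disjoint : ∀ {i j a b} → Adj i a b → Adj j a b → i ≡ j
    adj-disjoint (inj₁ r)       (inj₁ s)       = disjoint r s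
    adj-disjoint (inj₁ r)       (inj₂ (_ , s)) = contradiction s (not-same r)
    adj-disjoint (inj₂ (_ , s)) (inj₁ r)       = contradiction s (not-same r)
    adj-disjoint (inj₂ (p , _)) (inj₂ (q , _)) = trans p (sym q)

  smoothed : ColoredGraph c
  smoothed = record
    { order    = n
    ; D        = Adj
    ; D?       = λ j a b → D? j (p a) (p b) ⊎-dec ((j Fin.≟ i₀) ×-dec samePair? (a , b) (u , v))
    ; D-sym    = λ { j (inj₁ r) → inj₁ (D-sym j r) ; j (inj₂ (eq , s)) → inj₂ (eq , samePair-swap s) }
    ; D-irrefl = λ { j {a} refl → adj-irrefl j a }
    ; disjoint = adj-disjoint
    }

  uv : Adj i₀ u v
  uv = inj₂ (refl , inj₁ (refl , refl))

  open SubdivideColored smoothed uv public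

  private
    module S = ColoredGraph subdivided

    restore : Fin (suc n) → Fin (suc n)
    restore zero    = x
    restore (suc a) = p a

    restore-injective : ∀ {a b} → restore a ≡ restore b → a ≡ b
    restore-injective {zero}  {zero}  _  = refl
    restore-injective {zero}  {suc b} eq = contradiction (sym eq) (Fin.punchInᵢ≢i x b)
    restore-injective {suc a} {zero}  eq = contradiction eq (Fin.punchInᵢ≢i x a)
    restore-injective {suc a} {suc b} eq = cong suc (Fin.punchIn-injective x a b eq)

    restore-surjective : ∀ w → ∃[ a ] restore a ≡ w
    restore-surjective w with x Fin.≟ w
    ... | yes refl = zero , refl
    ... | no x≢w   = suc (punchOut x≢w) , Fin.punchIn-punchOut x≢w

    end : ∀ {j a} → j ≡ i₀ × (a ≡ u ⊎ a ≡ v) → D j x (p a)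
    end (refl , inj₁ refl) = xu
    end (refl , inj₂ refl) = xv

    forth : ∀ j {a b} → S.D j a b → D j (restore a) (restore b)
    forth j {zero}  {suc b} e = end e
    forth j {suc a} {zero}  e = D-sym j (end e)
    forth j {suc a} {suc b} (inj₁ r , _)        = r
    forth j {suc a} {suc b} (inj₂ (_ , s) , ¬s) = contradiction s ¬s

    back′ : ∀ j {a b} → D j (restore a) (restore b) → S.D j a b
    back′ j {zero}  {zero}  r = D-irrefl j refl r
    back′ j {zero}  {suc b} r = only j b r
    back′ j {suc a} {zero}  r = only j a (D-sym j r)
    back′ j {suc a} {suc b} r = inj₁ r , not-same r

    back : ∀ j {a w} → D j (restore a) w → ∃[ b ] restore b ≡ w × S.D j a b
    back j {a} {w} r with b , refl ← restore-surjective w = b , refl , back′ j r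

    module Emb = ColoredEmbedding subdivided F restore restore-injective forth back

  smoothed-degree : ∀ a → ColoredGraph.coloredDegree smoothed a ≡ ColoredGraph.coloredDegree F (p a)
  smoothed-degree a = trans (sym (coloredDegree-old a)) (Emb.coloredDegree-embed (suc a))

  smoothed-linked : Linked F → Linked smoothed
  smoothed-linked linked = linked-subdivided⁻ λ i → Emb.linked-down i (linked i)

  underlying-F : ColoredGraph.underlying F ≅ subdivide (ColoredGraph.underlying smoothed) u v (i₀ , uv)
  underlying-F = ≅-trans (≅-sym (bijective⇒≅ restore restore-injective restore-surjective
    λ a b → mk⇔ (λ (j , r) → j , forth j r) (λ (j , r) → j , back′ j r))) underlying-subdivided

module _ {c} {H : Graph} (F₀ : ColoredGraph c) (colorizes : ColoredGraph.underlying F₀ ≅ H)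
  (center : ∀ i → StarCenter F₀ i) where

  private
    module F₀ = ColoredGraph F₀

    Contracts : ColoredGraph c → Set₁
    Contracts F = ∃[ F′ ] Subdivided H F′ × ColoredGraph.underlying F ≅ F′

    surjective⇒≅ : ∀ {F} → Linked F → (real : Realizes F₀ F) →
                   (∀ u → ∃[ h ] Realizes.ι real h ≡ u) → Contracts F
    surjective⇒≅ {F} linked real surj =
      H , none , ≅-trans (≅-sym (Compare.underlying-≅ F₀ F center linked real surj)) colorizes

  -- Induction on the order. Smoothing a vertex outside the image leaves a realization, and the
  -- subdivision step that undoes it is appended to the result of the recursion; once `ι` is onto,
  -- the graph is `H` itself.
  realizes⇒contracts : ∀ n F → ColoredGraph.order F ≡ n → Linked F → Realizes F₀ F → Contracts F
  realizes⇒contracts zero F refl linked real = surjective⇒≅ linked real λ ()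
  realizes⇒contracts (suc n) F refl linked real
    with Fin.any? (λ x → ¬? (Fin.any? λ h → Realizes.ι real h Fin.≟ x))
  ... | no  covered  = surjective⇒≅ linked real λ u →
    Dec.decidable-stable (Fin.any? λ h → Realizes.ι real h Fin.≟ u) λ ¬im → covered (u , ¬im)
  ... | yes (x , x∉) with i₀ , two , zeros ← Compare.others-pure F₀ F center linked real x x∉
    with u , v , u≢v , xu , xv , only ← #≡2 (ColoredGraph.D? F i₀ x) (trans (sym (lookup-degree F x i₀)) two) =
    extend (realizes⇒contracts n smoothed refl (smoothed-linked linked) real′)
    where
    open Realizes real
    module F = ColoredGraph F

    x≢u : x ≢ u
    x≢u eq = F.D-irrefl i₀ eq xu

    x≢v : x ≢ v
    x≢v eq = F.D-irrefl i₀ eq xv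

    pu : punchIn x (punchOut x≢u) ≡ u
    pu = Fin.punchIn-punchOut x≢u

    pv : punchIn x (punchOut x≢v) ≡ v
    pv = Fin.punchIn-punchOut x≢v

    color : ∀ j {w} → F.D j x w → j ≡ i₀
    color j r with j Fin.≟ i₀
    ... | yes eq = eq
    ... | no neq = contradiction
      (subst (1 ≤_) (trans (sym (lookup-degree F x j)) (zeros j neq)) (Degrees.touched⇒deg≥1 (F.D? j) (_ , r))) λ ()

    only′ : ∀ j w → F.D j x (punchIn x w) → j ≡ i₀ × (w ≡ punchOut x≢u ⊎ w ≡ punchOut x≢v)
    only′ j w r with refl ← color j r with only _ r
    ... | inj₁ eq = refl , inj₁ (Fin.punchIn-injective x _ _ (trans eq (sym pu)))
    ... | inj₂ eq = refl , inj₂ (Fin.punchIn-injective x _ _ (trans eq (sym pv)))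

    open Smooth F.D F.D? F.D-sym F.D-irrefl F.disjoint {x} {i₀}
      (λ eq → u≢v (Fin.punchOut-injective x≢u x≢v eq))
      (subst (F.D i₀ x) (sym pu) xu) (subst (F.D i₀ x) (sym pv) xv) only′
      (λ j r → Compare.neighbors-nonadjacent F₀ F center linked real x∉ u≢v xu xv only
        (trans (sym (lookup-degree F x i₀)) two) j (subst₂ (F.D j) pu pv r))
      hiding (F)

    x≢ι : ∀ h → x ≢ ι h
    x≢ι h eq = x∉ (h , sym eq)

    real′ : Realizes F₀ smoothed
    real′ = record
      { ι           = λ h → punchOut (x≢ι h)
      ; ι-injective = λ {h} {k} eq → ι-injective (Fin.punchOut-injective (x≢ι h) (x≢ι k) eq)
      ; ι-degree    = λ h → trans (smoothed-degree _)
          (trans (cong F.coloredDegree (Fin.punchIn-punchOut (x≢ι h))) (ι-degree h))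
      ; others      = λ a → others′ a (others (punchIn x a))
      }
      where
      others′ : ∀ a → (∃[ h ] ι h ≡ punchIn x a) ⊎ InΔ (F.coloredDegree (punchIn x a)) →
                (∃[ h ] punchOut (x≢ι h) ≡ a) ⊎ InΔ (ColoredGraph.coloredDegree smoothed a)
      others′ a (inj₁ (h , eq)) = inj₁ (h , Fin.punchIn-injective x _ _ (trans (Fin.punchIn-punchOut (x≢ι h)) eq))
      others′ a (inj₂ d)        = inj₂ (subst InΔ (sym (smoothed-degree a)) d)

    extend : Contracts smoothed → Contracts F
    extend (K , sub , φ) = _ , step sub _ _ (Equivalence.to (_≅_.adjacency φ _ _) (i₀ , uv)) ,
      ≅-trans underlying-F (subdivide-cong φ (i₀ , uv))

extendedProfile : ∀ {c} (H : Graph) (F₀ : ColoredGraph c) → IsStarColorization H F₀ →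
                  IsExtendedProfile (ColoredGraph.DS F₀) (𝒮 H)
extendedProfile {c} H F₀ colorization F = mk⇔ colored contracted
  where
  open IsStarColorization colorization using (colorizes; star)
  M = ColoredGraph.DS F₀

  center : ∀ i → StarCenter F₀ i
  center i = isStar⇒center F₀ i (star i)

  colored : 𝒮 H F → ∃[ Fᶜ ] ColoredGraph.underlying Fᶜ ≅ F × SatisfiesC* M Fᶜ
  colored (F′ , sub , ψ)
    with Fᶜ , φ , ext , linked ← subdivision⇒colored F₀ colorizes (λ i → StarCenter.linked (center i)) sub =
    Fᶜ , ≅-trans φ (≅-sym ψ) , ext , λ i → linked⇒connected (ColoredGraph.colorGraph Fᶜ i) (linked i)

  contracted : (∃[ Fᶜ ] ColoredGraph.underlying Fᶜ ≅ F × SatisfiesC* M Fᶜ) → 𝒮 H F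
  contracted (Fᶜ , φ , ext , conn)
    with F′ , sub , ψ ← realizes⇒contracts F₀ colorizes center _ Fᶜ refl
           (λ i → connected⇒linked (ColoredGraph.colorGraph Fᶜ i) (conn i)) (extends⇒realizes F₀ Fᶜ ext) =
    F′ , sub , ≅-trans (≅-sym φ) ψ

-- Decision diagrams as residuals of a family of words

module Words (c m : ℕ) where

  -- The letter zero is the 0-arc; the letter suc j is color j.
  Word : Set
  Word = Vec (Fin (suc c)) m

  infixl 20 _!_
  _!_ : Word → Fin m → Fin (suc c)
  _!_ = Vec.lookup

  word-ext : ∀ {x y : Word} → (∀ e → x ! e ≡ y ! e) → x ≡ y
  word-ext {x} {y} eq = trans (sym (Vec.tabulate∘lookup x)) (trans (Vec.tabulate-cong eq) (Vec.tabulate∘lookup y))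

  infix 4 _≟ʷ_
  _≟ʷ_ : DecidableEquality Word
  _≟ʷ_ = Vec.≡-dec Fin._≟_

  abstract
    -- Prefixes and suffixes are both stored as words of full length whose other letters are
    -- ignored, so that no length depends on `k`.
    mix : ℕ → Word → Word → Word
    mix k x R = Vec.tabulate λ e → if does (toℕ e ℕ.<? k) then x ! e else R ! e

    mix-below : ∀ k x R e → toℕ e < k → mix k x R ! e ≡ x ! e
    mix-below k x R e e<k rewrite Vec.lookup∘tabulate (λ e → if does (toℕ e ℕ.<? k) then x ! e else R ! e) e
      | Dec.dec-true (toℕ e ℕ.<? k) e<k = refl

    mix-above : ∀ k x R e → k ≤ toℕ e → mix k x R ! e ≡ R ! e
    mix-above k x R e k≤e rewrite Vec.lookup∘tabulate (λ e → if does (toℕ e ℕ.<? k) then x ! e else R ! e) e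
      | Dec.dec-false (toℕ e ℕ.<? k) (ℕ.≤⇒≯ k≤e) = refl

  mix-elim : ∀ k x R {y} → (∀ e → toℕ e < k → x ! e ≡ y ! e) → (∀ e → k ≤ toℕ e → R ! e ≡ y ! e) →
             mix k x R ≡ y
  mix-elim k x R below above = word-ext λ e →
    [ (λ e<k → trans (mix-below k x R e e<k) (below e e<k))
    , (λ k≤e → trans (mix-above k x R e k≤e) (above e k≤e)) ]′ (ℕ.<-≤-connex (toℕ e) k)

  mix-idem : ∀ k x → mix k x x ≡ x
  mix-idem k x = mix-elim k x x (λ _ _ → refl) (λ _ _ → refl)

  allVecs : ∀ n → List (Vec (Fin (suc c)) n)
  allVecs zero    = Vec.[] ∷ []
  allVecs (suc n) = cartesianProductWith Vec._∷_ (allFin (suc c)) (allVecs n)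

  ∈-allVecs : ∀ {n} (x : Vec (Fin (suc c)) n) → x ∈ allVecs n
  ∈-allVecs Vec.[]       = here refl
  ∈-allVecs (a Vec.∷ x) = ∈-cartesianProductWith⁺ Vec._∷_ (∈-allFin a) (∈-allVecs x)

  allVecs-unique : ∀ n → Unique (allVecs n)
  allVecs-unique zero    = [] ∷ []
  allVecs-unique (suc n) = Unique.cartesianProductWith⁺ Vec._∷_ Vec.∷-injective (Unique.allFin⁺ (suc c)) (allVecs-unique n)

  words : List Word
  words = allVecs m

  abstract
    allWords? : {P : Word → Set} → (∀ w → Dec (P w)) → Dec (∀ w → P w)
    allWords? P? = Dec.map′ (λ all w → All.lookup all (∈-allVecs w)) (λ f → All.tabulate λ {w} _ → f w)
      (All.all? P? words)

    anyWord? : {P : Word → Set} → (∀ w → Dec (P w)) → Dec (∃[ w ] P w)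
    anyWord? P? = Dec.map′ Any.satisfied (λ (w , p) → lose (∈-allVecs w) p) (Any.any? P? words)

  private
    letter : ∀ {e : Fin m} (B : ColoredSubset c m) → Dec (∃[ j ] e Subset.∈ ColoredSubset.D B j) → Fin (suc c)
    letter B (yes (j , _)) = suc j
    letter B (no _)        = zero

    color? : (B : ColoredSubset c m) → ∀ e → Dec (∃[ j ] e Subset.∈ ColoredSubset.D B j)
    color? B e = Fin.any? λ j → e Subset.∈? ColoredSubset.D B j

  wordOf : ColoredSubset c m → Word
  wordOf B = Vec.tabulate λ e → letter B (color? B e)

  wordOf-color : ∀ B {j e} → e Subset.∈ ColoredSubset.D B j → wordOf B ! e ≡ suc j
  wordOf-color B {j} {e} e∈ = trans (Vec.lookup∘tabulate (λ e → letter B (color? B e)) e) (go (color? B e))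
    where
    go : (d : Dec (∃[ j ] e Subset.∈ ColoredSubset.D B j)) → letter B d ≡ suc j
    go (yes (k , e∈k)) = cong suc (ColoredSubset.disjoint B e∈k e∈)
    go (no ¬e∈)        = contradiction (j , e∈) ¬e∈

  wordOf-color⁻ : ∀ B {j e} → wordOf B ! e ≡ suc j → e Subset.∈ ColoredSubset.D B j
  wordOf-color⁻ B {j} {e} eq = go (color? B e) (trans (sym (Vec.lookup∘tabulate (λ e → letter B (color? B e)) e)) eq)
    where
    go : (d : Dec (∃[ j ] e Subset.∈ ColoredSubset.D B j)) → letter B d ≡ suc j → e Subset.∈ ColoredSubset.D B j
    go (yes (k , e∈k)) refl = e∈k

-- The minimal diagram: a node at level k is a class of accepted words, two
-- words being equivalent when their prefixes of length k have the same
-- completions.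
module Nerode {c m} (𝓕 : Words.Word c m → Set) (𝓕? : ∀ w → Dec (𝓕 w)) where

  open Words c m

  infix 4 _≈[_]_
  record _≈[_]_ (x : Word) (k : ℕ) (y : Word) : Set where
    constructor mk≈
    field
      complete : ∀ R → (𝓕 (mix k x R) → 𝓕 (mix k y R)) × (𝓕 (mix k y R) → 𝓕 (mix k x R))

  open _≈[_]_ public

  ≈-refl : ∀ {k x} → x ≈[ k ] x
  ≈-refl = mk≈ λ R → id , id

  ≈-sym : ∀ {k x y} → x ≈[ k ] y → y ≈[ k ] x
  ≈-sym eq = mk≈ λ R → proj₂ (complete eq R) , proj₁ (complete eq R)

  ≈-trans : ∀ {k x y z} → x ≈[ k ] y → y ≈[ k ] z → x ≈[ k ] z
  ≈-trans p q = mk≈ λ R → proj₁ (complete q R) ∘ proj₁ (complete p R) , proj₂ (complete p R) ∘ proj₂ (complete q R)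

  private
    member? : ∀ k x y → Dec (𝓕 y × x ≈[ k ] y)
    member? k x y = 𝓕? y ×-dec Dec.map′ mk≈ complete (allWords? λ R →
      (𝓕? (mix k x R) →-dec 𝓕? (mix k y R)) ×-dec (𝓕? (mix k y R) →-dec 𝓕? (mix k x R)))

    class : ℕ → Word → List Word
    class k x = filter (member? k x) words

    self-∈ : ∀ k {x} → 𝓕 x → x ∈ class k x
    self-∈ k {x} fx = ∈-filter⁺ (member? k x) (∈-allVecs x) (fx , ≈-refl)

  abstract
    -- Equivalent accepted words filter the fixed enumeration to the same list, so its first entry
    -- names the class and takes the place of a quotient.
    rep : ℕ → Word → Word
    rep k x = first x (class k x)

    rep-∈ : ∀ k {x} → 𝓕 x → 𝓕 (rep k x) × x ≈[ k ] rep k x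
    rep-∈ k {x} fx = proj₂ (∈-filter⁻ (member? k x) {xs = words} (first-∈ (self-∈ k fx)))

    rep-accepted : ∀ k {x} → 𝓕 x → 𝓕 (rep k x)
    rep-accepted k fx = proj₁ (rep-∈ k fx)

    rep-≈ : ∀ k {x} → 𝓕 x → x ≈[ k ] rep k x
    rep-≈ k fx = proj₂ (rep-∈ k fx)

    rep-cong : ∀ k {x y} → 𝓕 x → 𝓕 y → x ≈[ k ] y → rep k x ≡ rep k y
    rep-cong k {x} {y} fx fy eq = trans (cong (first x) same) (first-default (self-∈ k fy))
      where
      same : class k x ≡ class k y
      same = List.filter-≐ (member? k x) (member? k y)
        ((λ (f , p) → f , ≈-trans (≈-sym eq) p) , (λ (f , p) → f , ≈-trans eq p)) words

  private
    node? : (lx : Fin m × Word) → Dec (𝓕 (proj₂ lx) × rep (toℕ (proj₁ lx)) (proj₂ lx) ≡ proj₂ lx)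
    node? (l , x) = 𝓕? x ×-dec (rep (toℕ l) x ≟ʷ x)

    abstract
      -- Since nodes are named by accepted words, a prefix without accepted completion has no node,
      -- and arcs leading to it end in `⊥ᵗ` at once.
      nodes : List (Fin m × Word)
      nodes = filter node? (cartesianProduct (allFin m) words)

      nodes-unique : Unique nodes
      nodes-unique = Unique.filter⁺ node? (Unique.cartesianProduct⁺ (Unique.allFin⁺ m) (allVecs-unique m))

      nodes-sound : ∀ {l x} → (l , x) ∈ nodes → 𝓕 x × rep (toℕ l) x ≡ x
      nodes-sound lx∈ = proj₂ (∈-filter⁻ node? {xs = cartesianProduct (allFin m) words} lx∈)

      nodes-complete : ∀ l {x} → 𝓕 x → rep (toℕ l) x ≡ x → (l , x) ∈ nodes
      nodes-complete l {x} fx eq = ∈-filter⁺ node? (∈-cartesianProduct⁺ (∈-allFin l) (∈-allVecs x)) (fx , eq)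

    size : ℕ
    size = length nodes

    Node : Set
    Node = Terminal ⊎ Fin size

    label : Fin size → Fin m
    label α = proj₁ (lookup nodes α)

    word : Fin size → Word
    word α = proj₂ (lookup nodes α)

    level : Fin size → ℕ
    level α = toℕ (label α)

    node-spec : ∀ α → 𝓕 (word α) × rep (level α) (word α) ≡ word α
    node-spec α = nodes-sound (∈-lookup α)

    rep-∈-nodes : ∀ l {x} → 𝓕 x → (l , rep (toℕ l) x) ∈ nodes
    rep-∈-nodes l {x} fx = nodes-complete l (rep-accepted _ fx)
      (rep-cong _ (rep-accepted _ fx) fx (≈-sym (rep-≈ _ fx)))

    nodeOf : ∀ l {x} → 𝓕 x → Fin size
    nodeOf l fx = Any.index (rep-∈-nodes l fx)

    lookup-nodeOf : ∀ l {x} (fx : 𝓕 x) → lookup nodes (nodeOf l fx) ≡ (l , rep (toℕ l) x)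
    lookup-nodeOf l fx = sym (Any.lookup-index (rep-∈-nodes l fx))

    nodeOf-≈ : ∀ l {x} (fx : 𝓕 x) β → l ≡ label β → x ≈[ toℕ l ] word β → nodeOf l fx ≡ β
    nodeOf-≈ l {x} fx β refl eq = unique-lookup-injective nodes-unique
      (trans (lookup-nodeOf l fx) (cong (l ,_)
        (trans (rep-cong _ fx (proj₁ (node-spec β)) eq) (proj₂ (node-spec β)))))

    target′ : ∀ k {x} → 𝓕 x → Dec (k < m) → Node
    target′ k fx (yes k<m) = inj₂ (nodeOf (fromℕ< k<m) fx)
    target′ k fx (no _)    = inj₁ ⊤ᵗ

    target : ∀ k {x} → 𝓕 x → Node
    target k fx = target′ k fx (k ℕ.<? m)

    Extends : ℕ → Word → Word → Set
    Extends k x z = ∀ e → toℕ e < k → z ! e ≡ x ! e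

    -- A witness that reading `j` after the prefix of `α` can still lead to acceptance. The choice
    -- of witness is immaterial, as by `mix-child` all of them have the same residual.
    Child : Fin size → Fin (suc c) → Word → Set
    Child α j z = 𝓕 z × Extends (level α) (word α) z × z ! label α ≡ j

    child? : ∀ α j → Dec (∃[ z ] Child α j z)
    child? α j = anyWord? λ z → 𝓕? z ×-dec
      (Fin.all? (λ e → (toℕ e ℕ.<? level α) →-dec (z ! e Fin.≟ word α ! e)) ×-dec (z ! label α Fin.≟ j))

    arc′ : ∀ {α j} → Dec (∃[ z ] Child α j z) → Node
    arc′ {α} (yes (z , fz , _)) = target (suc (level α)) fz
    arc′     (no _)             = inj₁ ⊥ᵗ

    arc : Fin size → Fin (suc c) → Node
    arc α j = arc′ (child? α j)

    root′ : Dec (∃[ z ] 𝓕 z) → Node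
    root′ (yes (z , fz)) = target 0 fz
    root′ (no _)         = inj₁ ⊥ᵗ

    root : Node
    root = root′ (anyWord? 𝓕?)

    -- An accepting path must not stop before all `m` letters are read, whereas rejection may happen
    -- on any level.
    AtLevel : Node → ℕ → Set
    AtLevel (inj₁ ⊤ᵗ) k = m ≤ k
    AtLevel (inj₁ ⊥ᵗ) k = ⊤
    AtLevel (inj₂ β)  k = level β ≡ k

    target-level : ∀ k {x} (fx : 𝓕 x) → AtLevel (target k fx) k
    target-level k fx = by (k ℕ.<? m)
      where
      by : ∀ d → AtLevel (target′ k fx d) k
      by (yes k<m) = trans (cong (toℕ ∘ proj₁) (lookup-nodeOf (fromℕ< k<m) fx)) (Fin.toℕ-fromℕ< k<m)
      by (no k≮m)  = ℕ.≮⇒≥ k≮m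

    arc-level : ∀ α j → AtLevel (arc α j) (suc (level α))
    arc-level α j = by (child? α j)
      where
      by : ∀ d → AtLevel (arc′ {α} {j} d) (suc (level α))
      by (yes (z , fz , _)) = target-level _ fz
      by (no _)             = tt

    root-level : AtLevel root 0
    root-level = by (anyWord? 𝓕?)
      where
      by : ∀ d → AtLevel (root′ d) 0
      by (yes (z , fz)) = target-level 0 fz
      by (no _)         = tt

    arc-label : ∀ α j {β} → arc α j ≡ inj₂ β → level β ≡ suc (level α)
    arc-label α j eq = subst (λ ν → AtLevel ν _) eq (arc-level α j)

    target-≈ : ∀ k {x} (fx : 𝓕 x) β → level β ≡ k → x ≈[ k ] word β → target k fx ≡ inj₂ β
    target-≈ k fx β refl eq = by (k ℕ.<? m)
      where
      by : ∀ d → target′ k fx d ≡ inj₂ β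
      by (yes k<m) = cong inj₂ (nodeOf-≈ _ fx β (Fin.fromℕ<-toℕ (label β) k<m)
        (subst (λ l → _ ≈[ l ] word β) (sym (Fin.toℕ-fromℕ< k<m)) eq))
      by (no k≮m)  = contradiction (Fin.toℕ<n (label β)) k≮m

    mix-child : ∀ {α j z} R → Child α j z → R ! label α ≡ j →
                mix (suc (level α)) z R ≡ mix (level α) (word α) R
    mix-child {α} {j} {z} R (_ , ext , at) Rj = mix-elim _ z R
      (λ e e<sk → [ (λ e<k → trans (ext e e<k) (sym (mix-below _ (word α) R e e<k)))
                  , (λ e≡k → let e≡ = Fin.toℕ-injective e≡k in
                      trans (trans (trans (cong (z !_) e≡) at) (trans (sym Rj) (cong (R !_) (sym e≡))))
                        (sym (mix-above _ (word α) R e (ℕ.≤-reflexive (sym e≡k))))) ]′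
                  (ℕ.m≤n⇒m<n∨m≡n (ℕ.≤-pred e<sk)))
      (λ e k<e → sym (mix-above _ (word α) R e (ℕ.<⇒≤ k<e)))

    -- The word naming `β` also passes through a class on the level before. The node of that class
    -- is the parent: reading there the next letter of the word leads back to `β`.
    root-unique : ∀ β → inj₂ β ≡ root ⊎ (∃[ α ] ∃[ j ] arc α j ≡ inj₂ β)
    root-unique β with label β in eq
    ... | zero = inj₁ (sym (from-root (anyWord? 𝓕?)))
      where
      from-root : ∀ d → root′ d ≡ inj₂ β
      from-root (no ¬any)      = contradiction (_ , proj₁ (node-spec β)) ¬any
      from-root (yes (z , fz)) = target-≈ 0 fz β (cong toℕ eq) (mk≈ λ R →
        let at-0 : ∀ y → mix 0 y R ≡ R
            at-0 y = mix-elim 0 y R (λ _ ()) (λ _ _ → refl)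
            step-eq = trans (at-0 z) (sym (at-0 (word β)))
        in subst 𝓕 step-eq , subst 𝓕 (sym step-eq))
    ... | suc l = inj₂ (α , j , from-arc (child? α j))
      where
      x : Word
      x = word β

      fx : 𝓕 x
      fx = proj₁ (node-spec β)

      α : Fin size
      α = nodeOf (inject₁ l) fx

      label-α : label α ≡ inject₁ l
      label-α = cong proj₁ (lookup-nodeOf (inject₁ l) fx)

      level-β : level β ≡ suc (level α)
      level-β = trans (cong toℕ eq) (cong suc (sym (trans (cong toℕ label-α) (Fin.toℕ-inject₁ l))))

      j : Fin (suc c)
      j = x ! label α

      x≈α : x ≈[ level α ] word α
      x≈α = subst₂ (λ k y → x ≈[ k ] y) (sym (cong toℕ label-α))
        (sym (cong proj₂ (lookup-nodeOf (inject₁ l) fx))) (rep-≈ _ fx)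

      child : ∃[ z ] Child α j z
      child = mix (level α) (word α) x ,
        proj₁ (complete x≈α x) (subst 𝓕 (sym (mix-idem _ x)) fx) ,
        mix-below _ (word α) x ,
        mix-above _ (word α) x (label α) ℕ.≤-refl

      z≈β : ∀ {z} → Child α j z → z ≈[ suc (level α) ] x
      z≈β {z} ch = mk≈ λ R →
        (λ f → subst 𝓕 (eq₂ R) (proj₂ (complete x≈α (R′ R)) (subst 𝓕 (eq₁ R) f))) ,
        (λ f → subst 𝓕 (sym (eq₁ R)) (proj₁ (complete x≈α (R′ R)) (subst 𝓕 (sym (eq₂ R)) f)))
        where
        k = level α
        -- Putting the letter of `x` at position `k` back in front turns a completion for the next
        -- level into one for level `k`, where the equivalence with `word α` is known.
        R′ : Word → Word
        R′ R = mix (suc k) x R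

        eq₁ : ∀ R → mix (suc k) z R ≡ mix k (word α) (R′ R)
        eq₁ R = trans (mix-elim (suc k) z R (λ e e<k → sym (mix-below (suc k) z (R′ R) e e<k))
                   (λ e k≤e → trans (sym (mix-above (suc k) x R e k≤e)) (sym (mix-above (suc k) z (R′ R) e k≤e))))
                 (mix-child (R′ R) ch (mix-below (suc k) x R (label α) ℕ.≤-refl))

        eq₂ : ∀ R → mix k x (R′ R) ≡ mix (suc k) x R
        eq₂ R = mix-elim k x (R′ R) (λ e e<k → sym (mix-below (suc k) x R e (ℕ.m≤n⇒m≤1+n e<k))) (λ _ _ → refl)

      from-arc : (d : Dec (∃[ z ] Child α j z)) → arc′ {α} {j} d ≡ inj₂ β
      from-arc (no ¬child)    = contradiction child ¬child
      from-arc (yes (z , ch)) = target-≈ _ (proj₁ ch) β level-β (z≈β ch)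

  diagram : DD c m
  diagram = record
    { size        = size
    ; label       = label
    ; arc         = arc
    ; arc-label   = arc-label
    ; root        = root
    ; root-unique = root-unique
    }

  open DD diagram using (PathTo⊤; Uses; RepresentedBy; Represents; width) renaming (done to finish; step to follow)

  private
    Accepts : Node → Word → Set
    Accepts (inj₁ ⊤ᵗ) R = ⊤
    Accepts (inj₁ ⊥ᵗ) R = ⊥
    Accepts (inj₂ α)  R = 𝓕 (mix (level α) (word α) R)

    target-accepts : ∀ k {x} (fx : 𝓕 x) R → Accepts (target k fx) R ⇔ 𝓕 (mix k x R)
    target-accepts k {x} fx R = by (k ℕ.<? m)
      where
      by : ∀ d → Accepts (target′ k fx d) R ⇔ 𝓕 (mix k x R)
      by (yes k<m) = subst (_⇔ 𝓕 (mix k x R))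
        (sym (trans (cong (λ (l , y) → 𝓕 (mix (toℕ l) y R)) (lookup-nodeOf (fromℕ< k<m) fx))
          (cong (λ l → 𝓕 (mix l (rep l x) R)) (Fin.toℕ-fromℕ< k<m))))
        (mk⇔ (proj₂ (complete (rep-≈ k fx) R)) (proj₁ (complete (rep-≈ k fx) R)))
      by (no k≮m)  = mk⇔ (λ _ → subst 𝓕 (sym x≡) fx) (λ _ → tt)
        where
        x≡ : mix k x R ≡ x
        x≡ = mix-elim k x R (λ _ _ → refl) λ e k≤e →
          contradiction (Fin.toℕ<n e) (ℕ.≤⇒≯ (ℕ.≤-trans (ℕ.≮⇒≥ k≮m) k≤e))

    arc-accepts : ∀ α R → Accepts (arc α (R ! label α)) R ⇔ Accepts (inj₂ α) R
    arc-accepts α R = by (child? α (R ! label α))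
      where
      by : (d : Dec (∃[ z ] Child α (R ! label α) z)) → Accepts (arc′ {α} d) R ⇔ Accepts (inj₂ α) R
      by (yes (z , ch)) = subst (λ w → Accepts (target (suc (level α)) (proj₁ ch)) R ⇔ 𝓕 w) (mix-child R ch refl)
        (target-accepts (suc (level α)) (proj₁ ch) R)
      by (no ¬child)    = mk⇔ (λ ()) λ f → contradiction
        (mix (level α) (word α) R , f , mix-below _ (word α) R , mix-above _ (word α) R (label α) ℕ.≤-refl) ¬child

    root-accepts : ∀ R → Accepts root R ⇔ 𝓕 R
    root-accepts R = by (anyWord? 𝓕?)
      where
      by : (d : Dec (∃[ z ] 𝓕 z)) → Accepts (root′ d) R ⇔ 𝓕 R
      by (yes (z , fz)) = subst (λ w → Accepts (target 0 fz) R ⇔ 𝓕 w) (mix-elim 0 z R (λ _ ()) (λ _ _ → refl))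
        (target-accepts 0 fz R)
      by (no ¬any)      = mk⇔ (λ ()) (λ f → ¬any (R , f))

    Follows : ∀ {ν} → PathTo⊤ ν → Word → Set
    Follows p R = ∀ β k → Uses p β k → R ! label β ≡ k

    follows⇒accepts : ∀ {ν} (p : PathTo⊤ ν) R → Follows p R → Accepts ν R
    follows⇒accepts finish         R fol = tt
    follows⇒accepts (follow α j p) R fol with refl ← fol α j (inj₁ (refl , refl)) =
      Equivalence.to (arc-accepts α R) (follows⇒accepts p R (λ β k u → fol β k (inj₂ u)))

    Covers : ∀ {ν} → PathTo⊤ ν → Word → ℕ → Set
    Covers p R k = ∀ e → k ≤ toℕ e → ∃[ β ] label β ≡ e × Uses p β (R ! e)

    -- `fuel` bounds the number of levels left. `Covers` is carried along because `RepresentedBy`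
    -- also demands that every colored edge occur on the path.
    accepts⇒follows : ∀ fuel {k} ν R → m ≤ k + fuel → AtLevel ν k → Accepts ν R →
                      Σ[ p ∈ PathTo⊤ ν ] Follows p R × Covers p R k
    accepts⇒follows fuel (inj₁ ⊤ᵗ) R _ m≤k _ = finish , (λ _ _ ()) ,
      λ e k≤e → contradiction (Fin.toℕ<n e) (ℕ.≤⇒≯ (ℕ.≤-trans m≤k k≤e))
    accepts⇒follows zero (inj₂ α) R m≤k refl acc =
      contradiction (Fin.toℕ<n (label α)) (ℕ.≤⇒≯ (subst (m ≤_) (ℕ.+-identityʳ _) m≤k))
    accepts⇒follows (suc fuel) (inj₂ α) R m≤k refl acc
      with p , fol , cov ← accepts⇒follows fuel (arc α (R ! label α)) R
             (subst (m ≤_) (ℕ.+-suc (level α) fuel) m≤k) (arc-level α _) (Equivalence.from (arc-accepts α R) acc) =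
      follow α (R ! label α) p ,
      (λ { β k (inj₁ (refl , refl)) → refl ; β k (inj₂ u) → fol β k u }) ,
      λ e k≤e → [ (λ k<e → let β , eq , u = cov e k<e in β , eq , inj₂ u)
                , (λ k≡e → let eq = Fin.toℕ-injective k≡e in
                    α , eq , inj₁ (refl , cong (R !_) eq)) ]′ (ℕ.m≤n⇒m<n∨m≡n k≤e)

    uses-level : ∀ {ν} (p : PathTo⊤ ν) {k β j} → AtLevel ν k → Uses p β j → k ≤ level β
    uses-level (follow α j p) refl (inj₁ (refl , _)) = ℕ.≤-refl
    uses-level (follow α j p) refl (inj₂ u)          = ℕ.<⇒≤ (uses-level p (arc-level α j) u)

    -- Levels increase strictly along a path, so it visits each label at most once.
    uses-functional : ∀ {ν} (p : PathTo⊤ ν) {β β′ j j′} → label β ≡ label β′ →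
                      Uses p β j → Uses p β′ j′ → j ≡ j′
    uses-functional (follow α j p) eq (inj₁ (refl , refl)) (inj₁ (refl , refl)) = refl
    uses-functional (follow α j p) eq (inj₁ (refl , refl)) (inj₂ u) =
      contradiction (cong toℕ eq) (ℕ.<⇒≢ (uses-level p (arc-level α j) u))
    uses-functional (follow α j p) eq (inj₂ u) (inj₁ (refl , refl)) =
      contradiction (cong toℕ (sym eq)) (ℕ.<⇒≢ (uses-level p (arc-level α j) u))
    uses-functional (follow α j p) eq (inj₂ u) (inj₂ u′) = uses-functional p eq u u′

  represents : Represents (𝓕 ∘ wordOf)
  represents B = mk⇔ forth back
    where
    R : Word
    R = wordOf B

    forth : (∃[ p ] RepresentedBy B p) → 𝓕 R
    forth (p , rb) = Equivalence.to (root-accepts R) (follows⇒accepts p R fol)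
      where
      fol : Follows p R
      fol β (suc j) u = wordOf-color B (Equivalence.from (rb j (label β)) (β , refl , u))
      -- `RepresentedBy` constrains the colored arcs only. A colored letter at this place would make
      -- the path use a second arc at the same label.
      fol β zero    u with R ! label β in eq
      ... | zero  = refl
      ... | suc j with β′ , same , u′ ← Equivalence.to (rb j (label β)) (wordOf-color⁻ B eq)
                  with () ← uses-functional p same u′ u

    back : 𝓕 R → ∃[ p ] RepresentedBy B p
    back f with p , fol , cov ← accepts⇒follows m root R ℕ.≤-refl root-level (Equivalence.from (root-accepts R) f) =
      p , λ j e → mk⇔
        (λ e∈ → let β , eq , u = cov e z≤n in β , eq , subst (Uses p β) (wordOf-color B e∈) u)
        (λ { (β , refl , u) → wordOf-color⁻ B (fol β (suc j) u) })

  -- The nodes of one level are distinct representatives and hence pairwise inequivalent, so a code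
  -- that separates classes is injective on them.
  width-≤ : ∀ {N} (code : Fin m → Word → Fin N) →
            (∀ l {x y} → 𝓕 x → 𝓕 y → code l x ≡ code l y → x ≈[ toℕ l ] y) → width ≤ N
  width-≤ {N} code sound = ℕ.≤-pred (max<v⁺ (s≤s z≤n) (All.map⁺ (All.tabulate {xs = allFin m} λ {l} _ → s≤s
    (#≤ (λ α → label α Fin.≟ l) (λ α → code l (word α)) (inj l)))))
    where
    inj : ∀ l {α β} → label α ≡ l → label β ≡ l → code l (word α) ≡ code l (word β) → α ≡ β
    inj l {α} {β} eqα refl eq = unique-lookup-injective nodes-unique (cong₂ _,_ eqα
      (trans (sym (proj₂ (node-spec α))) (trans (cong (λ l → rep (toℕ l) (word α)) eqα)
        (trans (rep-cong (toℕ l) (proj₁ (node-spec α)) (proj₁ (node-spec β))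
          (sound l (proj₁ (node-spec α)) (proj₁ (node-spec β)) eq)) (proj₂ (node-spec β))))))

-- Degree sums and counts of accepted graphs

𝟘 : ∀ {c} → Vec ℕ c
𝟘 = Vec.replicate _ 0

module _ {c} (F : ColoredGraph c) where
  open ColoredGraph F

  unused⇒𝟘 : ∀ {u} → ¬ Used F u → coloredDegree u ≡ 𝟘
  unused⇒𝟘 {u} ¬used = trans
    (Vec.tabulate-cong λ i → Degrees.untouched⇒deg≡0 (D? i) λ (v , r) → ¬used (v , i , r))
    (trans (Vec.tabulate-cong λ i → sym (Vec.lookup-replicate i 0)) (Vec.tabulate∘lookup 𝟘))

  used⇒≢𝟘 : ∀ {u} → Used F u → coloredDegree u ≢ 𝟘
  used⇒≢𝟘 {u} (v , i , r) eq = contradiction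
    (subst (1 ≤_) (trans (sym (lookup-degree F u i)) (trans (cong (λ δ → Vec.lookup δ i) eq) (Vec.lookup-replicate i 0)))
      (Degrees.touched⇒deg≥1 (D? i) (v , r))) λ ()

  used-∑ : (h : Vec ℕ c → ℕ) → h 𝟘 ≡ 0 → ∑ (usedDegrees F) h ≡ ∑ᶠ (h ∘ coloredDegree)
  used-∑ h h𝟘 = trans (∑-map coloredDegree h (endpoints underlying))
    (∑-filter (used? F) (h ∘ coloredDegree) (allFin order) λ u ¬used → trans (cong h (unused⇒𝟘 ¬used)) h𝟘)

  satisfies-∑ : ∀ {M} (h : Vec ℕ c → ℕ) → h 𝟘 ≡ 0 → (∀ {δ} → InΔ δ → h δ ≡ 0) →
                Satisfies F M → ∑ᶠ (h ∘ coloredDegree) ≡ ∑ M h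
  satisfies-∑ h h𝟘 hΔ (ext , _) = trans (sym (used-∑ h h𝟘)) (extends-∑ h hΔ ext)

  -- Such a weight sees neither isolated vertices nor those contributed by Δ. The weights that
  -- matter are being an end, the excess over 2, and having degree at least 3.
  satisfies-∑ᵢ : ∀ {M} (h : ℕ → ℕ) → h 0 ≡ 0 → h 2 ≡ 0 → Satisfies F M → ∀ i →
                 ∑ᶠ (λ u → h (degree u i)) ≡ ∑ M (λ δ → h (Vec.lookup δ i))
  satisfies-∑ᵢ h h0 h2 sat i = trans (∑-cong (allFin order) λ u → cong h (sym (lookup-degree F u i)))
    (satisfies-∑ (λ δ → h (Vec.lookup δ i)) (trans (cong h (Vec.lookup-replicate i 0)) h0) (λ {δ} → onΔ {δ}) sat)
    where
    onΔ : ∀ {δ} → InΔ δ → h (Vec.lookup δ i) ≡ 0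
    onΔ (k , two , zeros) with i Fin.≟ k
    ... | yes refl = trans (cong h two) h2
    ... | no i≢k   = trans (cong h (zeros i i≢k)) h0

  -- Host vertices off the subgraph all have degree `𝟘` without belonging to the edge-induced graph,
  -- which is why `𝟘` is set apart here and later.
  used-count : ∀ {δ} → δ ≢ 𝟘 → #δ δ (usedDegrees F) ≡ # (λ u → δ ≟δ coloredDegree u)
  used-count {δ} δ≢𝟘 = trans (used-∑ (λ δ′ → 𝟙 (δ ≟δ δ′)) (𝟙-no (δ ≟δ 𝟘) δ≢𝟘))
    (sym (#-∑ λ u → δ ≟δ coloredDegree u))

  used-count-𝟘 : #δ 𝟘 (usedDegrees F) ≡ 0
  used-count-𝟘 = trans (∑-map coloredDegree _ (endpoints underlying)) (∑-zero (endpoints underlying) λ {u} u∈ →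
    𝟙-no (𝟘 ≟δ coloredDegree u) λ eq → used⇒≢𝟘 (proj₂ (∈-filter⁻ (used? F) {xs = allFin order} u∈)) (sym eq))

module _ {c} (F : ColoredGraph c) (D′ : Fin c → Rel (ColoredGraph.Vertex F) 0ℓ) (D′? : ∀ i → Decidable (D′ i))
  (sym′ : ∀ i → Symmetric (D′ i)) (irrefl′ : ∀ i → Irreflexive _≡_ (D′ i))
  (disjoint′ : ∀ {i j u v} → D′ i u v → D′ j u v → i ≡ j) where

  open ColoredGraph F

  private
    F′ : ColoredGraph c
    F′ = record { order = order ; D = D′ ; D? = D′? ; D-sym = sym′ ; D-irrefl = irrefl′ ; disjoint = disjoint′ }

  satisfies-cong : (∀ i {u v} → D i u v → D′ i u v) → (∀ i {u v} → D′ i u v → D i u v) →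
                   ∀ {M} → Satisfies F M → Satisfies F′ M
  satisfies-cong forth back {M} (ext , linked) = subst (ExtendsByΔ M) degrees≡ ext ,
    λ i → Emb.linked-up i (λ _ → _ , refl) (linked i)
    where
    module Emb = ColoredEmbedding F F′ id id forth (λ i r → _ , refl , back i r)

    degrees≡ : usedDegrees F ≡ usedDegrees F′
    degrees≡ = trans (List.map-cong Emb.coloredDegree-embed (endpoints underlying))
      (cong (map (ColoredGraph.coloredDegree F′)) (List.filter-≐ (used? F) (used? F′)
        ((λ (v , i , r) → v , i , forth i r) , (λ (v , i , r) → v , i , back i r)) (allFin order)))

-- Colored graphs encoded by words

module WordGraphs {c : ℕ} {G : Graph} (E : EdgeOrdering G) where
  open Graph G using (order; ~-irrefl)
  open EdgeOrdering E
  open Words c size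

  record Adj (w : Word) (i : Fin c) (u v : Fin order) : Set where
    constructor via
    field
      edge   : Fin size
      letter : w ! edge ≡ suc i
      joins  : SamePair (u , v) (ends edge)

  adj? : ∀ w i → Decidable (Adj w i)
  adj? w i u v = Dec.map′ (λ (e , eq , s) → via e eq s) (λ (via e eq s) → e , eq , s)
    (Fin.any? λ e → (w ! e Fin.≟ suc i) ×-dec samePair? (u , v) (ends e))

  ends-distinct : ∀ {u} e → ¬ SamePair (u , u) (ends e)
  ends-distinct e (inj₁ (p , q)) = ~-irrefl (trans (sym p) q) (sound e)
  ends-distinct e (inj₂ (p , q)) = ~-irrefl (trans (sym q) p) (sound e)

  same-edge : ∀ {p e f} → SamePair p (ends e) → SamePair p (ends f) → e ≡ f
  same-edge s t = injective (samePair-trans (samePair-sym s) t)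

  graph : Word → ColoredGraph c
  graph w = record
    { order    = order
    ; D        = Adj w
    ; D?       = adj? w
    ; D-sym    = λ i (via e eq s) → via e eq (samePair-swap s)
    ; D-irrefl = λ { i refl (via e _ s) → ends-distinct e s }
    ; disjoint = λ (via e p s) (via f q t) → Fin.suc-injective
        (trans (sym p) (trans (cong (w !_) (same-edge s t)) q))
    }

  private
    -- Repeats the spanning graph that is local to `coloredSubgraph`, so that the criterion for
    -- edge-induced graphs applies to the latter.
    spanning : ColoredSubset c size → ColoredGraph c
    spanning B = record
      { order    = order
      ; D        = λ i u v → ∃[ e ] e Subset.∈ D i × SamePair (u , v) (ends e)
      ; D?       = λ i u v → Fin.any? λ e → (e Subset.∈? D i) ×-dec samePair? (u , v) (ends e)
      ; D-sym    = λ i (e , eq , s) → e , eq , samePair-swap s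
      ; D-irrefl = λ { i refl (e , _ , s) → ends-distinct e s }
      ; disjoint = λ (e , p , s) (f , q , t) → disjoint p (subst (Subset._∈ D _) (sym (same-edge s t)) q)
      }
      where open ColoredSubset B

    spanning⇒graph : ∀ B i {u v} → ColoredGraph.D (spanning B) i u v → Adj (wordOf B) i u v
    spanning⇒graph B i (e , e∈ , s) = via e (wordOf-color B e∈) s

    graph⇒spanning : ∀ B i {u v} → Adj (wordOf B) i u v → ColoredGraph.D (spanning B) i u v
    graph⇒spanning B i (via e eq s) = e , wordOf-color⁻ B eq , s

  subgraph⇔graph : ∀ M B → Satisfies (graph (wordOf B)) M ⇔ SatisfiesC* M (coloredSubgraph E B)
  subgraph⇔graph M B = mk⇔
    (λ sat → satisfies⇒induced (spanning B) (satisfies-cong W S.D S.D? S.D-sym S.D-irrefl S.disjoint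
      (graph⇒spanning B) (spanning⇒graph B) sat))
    (λ sat → satisfies-cong (spanning B) W.D W.D? W.D-sym W.D-irrefl W.disjoint
      (spanning⇒graph B) (graph⇒spanning B) (induced⇒satisfies (spanning B) sat))
    where
    W = graph (wordOf B)
    module W = ColoredGraph W
    module S = ColoredGraph (spanning B)

-- Exchanging the prefixes of accepted words

-- Copies beyond `m` do not help to reach `m`, so truncated counts are enough for the lower bound in
-- `CountsMatch`.
⊓-transfer : ∀ {a a′} m h → a ⊓ m ≡ a′ ⊓ m → m ≤ a + h → m ≤ a′ + h
⊓-transfer {a} {a′} m h eq le = begin
  m               ≤⟨ truncated ⟩
  a ⊓ m + h       ≡⟨ cong (_+ h) eq ⟩
  a′ ⊓ m + h      ≤⟨ ℕ.+-monoˡ-≤ h (ℕ.m⊓n≤m a′ m) ⟩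
  a′ + h          ∎
  where
  open ℕ.≤-Reasoning
  truncated : m ≤ a ⊓ m + h
  truncated = [ (λ a≤m → subst (λ k → m ≤ k + h) (sym (ℕ.m≤n⇒m⊓n≡m a≤m)) le)
              , (λ m≤a → subst (λ k → m ≤ k + h) (sym (ℕ.m≥n⇒m⊓n≡n m≤a)) (ℕ.m≤m+n m h)) ]′ (ℕ.≤-total a m)

∸2+2 : ∀ {d} → 1 ≤ d → d ∸ 2 + 2 ≡ d + 𝟙 (d ℕ.≟ 1)
∸2+2 {suc zero}    _ = refl
∸2+2 {suc (suc d)} _ = trans (ℕ.+-comm d 2) (sym (ℕ.+-identityʳ _))

-- For positive degrees the end indicator cancels against the truncated excess, and the hypotheses
-- become `A ≤ p + r + O` and `A = q + r + O`. Here `A` and `O` collect the ends and excesses of all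
-- other vertices, and `r` is the later degree.
unknown-degree-≤ : ∀ A O r {p q} → 1 ≤ p → 1 ≤ q →
                   𝟙 (p + r ℕ.≟ 1) + A ≤ (p + r ∸ 2 + O) + 2 → 𝟙 (q + r ℕ.≟ 1) + A ≡ (q + r ∸ 2 + O) + 2 → q ≤ p
unknown-degree-≤ A O r {p} {q} 1≤p 1≤q le eq = ℕ.+-cancelʳ-≤ r q p (ℕ.+-cancelʳ-≤ O _ _ (begin
  q + r + O      ≡⟨ sym (ℕ.+-cancelʳ-≡ (𝟙 (q + r ℕ.≟ 1)) _ _
                      (trans (ℕ.+-comm A _) (trans eq (normal 1≤q)))) ⟩
  A              ≤⟨ ℕ.+-cancelʳ-≤ (𝟙 (p + r ℕ.≟ 1)) _ _
                      (ℕ.≤-trans (ℕ.≤-reflexive (ℕ.+-comm A _)) (ℕ.≤-trans le (ℕ.≤-reflexive (normal 1≤p)))) ⟩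
  p + r + O      ∎))
  where
  open ℕ.≤-Reasoning
  swap : ∀ a b k → a + b + k ≡ a + k + b
  swap = solve-∀

  normal : ∀ {d} → 1 ≤ d → (d + r ∸ 2 + O) + 2 ≡ d + r + O + 𝟙 (d + r ℕ.≟ 1)
  normal {d} 1≤d = trans (swap (d + r ∸ 2) O 2)
    (trans (cong (_+ O) (∸2+2 (ℕ.≤-trans 1≤d (ℕ.m≤m+n d r)))) (swap (d + r) (𝟙 (d + r ℕ.≟ 1)) O))

module Exchange {c} {M : List (Vec ℕ c)} (shape : StarDegrees M) {G : Graph} (E : EdgeOrdering G)
  (l : Fin (EdgeOrdering.size E)) where

  open Graph G using (order; Vertex)
  open EdgeOrdering E
  open Words c size
  open WordGraphs {c} E
  open StarDegrees shape

  k : ℕ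
  k = toℕ l

  Accepted : Word → Set
  Accepted w = Satisfies (graph w) M

  -- The frontier is their intersection: `InFrontier l v` unfolds to `Lo v × Hi v`.
  Lo Hi : Vertex → Set
  Lo v = ∃[ e ] toℕ e < k × Incident v e
  Hi v = ∃[ e ] k ≤ toℕ e × Incident v e

  lo? : ∀ v → Dec (Lo v)
  lo? v = Fin.any? λ e → (toℕ e ℕ.<? k) ×-dec incident? v e

  hi? : ∀ v → Dec (Hi v)
  hi? v = Fin.any? λ e → (k ℕ.≤? toℕ e) ×-dec incident? v e

  blank : Word
  blank = Vec.replicate size zero

  lo hi : Word → ColoredGraph c
  lo x = graph (mix k x blank)
  hi R = graph (mix k blank R)

  joined : Word → Word → ColoredGraph c
  joined x R = graph (mix k x R)

  degLo degHi : Word → Fin c → Vertex → ℕ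
  degLo x i v = ColoredGraph.degree (lo x) v i
  degHi R i v = ColoredGraph.degree (hi R) v i

  LoAdj HiAdj : Word → Fin c → Rel Vertex 0ℓ
  LoAdj x = Adj (mix k x blank)
  HiAdj R = Adj (mix k blank R)

  adj-sym : ∀ w i → Symmetric (Adj w i)
  adj-sym w = ColoredGraph.D-sym (graph w)

  private
    blank≢suc : ∀ {e} {i : Fin c} → blank ! e ≢ suc i
    blank≢suc {e} eq with () ← trans (sym (Vec.lookup-replicate e zero)) eq

    ends-incident : ∀ {u v} e → SamePair (u , v) (ends e) → Incident u e
    ends-incident e (inj₁ (p , _)) = inj₁ p
    ends-incident e (inj₂ (p , _)) = inj₂ p

    lo-edge : ∀ {x i u v} (r : LoAdj x i u v) → toℕ (Adj.edge r) < k
    lo-edge {x} (via e eq _) = [ id , (λ k≤e → contradiction (trans (sym (mix-above k x blank e k≤e)) eq) blank≢suc) ]′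
      (ℕ.<-≤-connex (toℕ e) k)

    hi-edge : ∀ {R i u v} (r : HiAdj R i u v) → k ≤ toℕ (Adj.edge r)
    hi-edge {R} (via e eq _) = [ (λ e<k → contradiction (trans (sym (mix-below k blank R e e<k)) eq) blank≢suc) , id ]′
      (ℕ.<-≤-connex (toℕ e) k)

  lo⇒Lo : ∀ {x i u v} → LoAdj x i u v → Lo u
  lo⇒Lo r@(via e _ s) = e , lo-edge r , ends-incident e s

  hi⇒Hi : ∀ {R i u v} → HiAdj R i u v → Hi u
  hi⇒Hi r@(via e _ s) = e , hi-edge r , ends-incident e s

  lo⇒joined : ∀ x R {i u v} → LoAdj x i u v → Adj (mix k x R) i u v
  lo⇒joined x R r@(via e eq s) =
    via e (trans (mix-below k x R e (lo-edge r)) (trans (sym (mix-below k x blank e (lo-edge r))) eq)) s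

  hi⇒joined : ∀ x R {i u v} → HiAdj R i u v → Adj (mix k x R) i u v
  hi⇒joined x R r@(via e eq s) =
    via e (trans (mix-above k x R e (hi-edge r)) (trans (sym (mix-above k blank R e (hi-edge r))) eq)) s

  joined⇒ : ∀ x R {i u v} → Adj (mix k x R) i u v → LoAdj x i u v ⊎ HiAdj R i u v
  joined⇒ x R (via e eq s) =
    [ (λ e<k → inj₁ (via e (trans (mix-below k x blank e e<k) (trans (sym (mix-below k x R e e<k)) eq)) s))
    , (λ k≤e → inj₂ (via e (trans (mix-above k blank R e k≤e) (trans (sym (mix-above k x R e k≤e)) eq)) s)) ]′
    (ℕ.<-≤-connex (toℕ e) k)

  lo-hi-exclusive : ∀ x R {i j u v} → LoAdj x i u v → ¬ HiAdj R j u v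
  lo-hi-exclusive x R r@(via e _ s) r′@(via f _ t) with refl ← same-edge s t = ℕ.<⇒≱ (lo-edge r) (hi-edge r′)

  deg-joined : ∀ x R i v → ColoredGraph.degree (joined x R) v i ≡ degLo x i v + degHi R i v
  deg-joined x R i v = begin
    ColoredGraph.degree (joined x R) v i
      ≡⟨ #-∑ (J? i v) ⟩
    ∑ᶠ (λ u → 𝟙 (J? i v u))
      ≡⟨ ∑-cong (allFin order) (λ u → trans
           (𝟙-⇔ (J? i v u) (L? i v u ⊎-dec H? i v u) (joined⇒ x R) [ lo⇒joined x R , hi⇒joined x R ]′)
           (𝟙-⊎ (L? i v u) (H? i v u) (lo-hi-exclusive x R))) ⟩
    ∑ᶠ (λ u → 𝟙 (L? i v u) + 𝟙 (H? i v u))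
      ≡⟨ ∑-+ (allFin order) _ _ ⟩
    ∑ᶠ (λ u → 𝟙 (L? i v u)) + ∑ᶠ (λ u → 𝟙 (H? i v u))
      ≡⟨ cong₂ _+_ (sym (#-∑ (L? i v))) (sym (#-∑ (H? i v))) ⟩
    degLo x i v + degHi R i v ∎
    where
    open ≡-Reasoning
    J? = ColoredGraph.D? (joined x R)
    L? = ColoredGraph.D? (lo x)
    H? = ColoredGraph.D? (hi R)

  ¬Lo⇒degLo≡0 : ∀ {x i v} → ¬ Lo v → degLo x i v ≡ 0
  ¬Lo⇒degLo≡0 {x} {i} ¬lo = Degrees.untouched⇒deg≡0 (ColoredGraph.D? (lo x) i) λ (_ , r) → ¬lo (lo⇒Lo {x} r)

  ¬Hi⇒degHi≡0 : ∀ {R i v} → ¬ Hi v → degHi R i v ≡ 0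
  ¬Hi⇒degHi≡0 {R} {i} ¬hi = Degrees.untouched⇒deg≡0 (ColoredGraph.D? (hi R) i) λ (_ , r) → ¬hi (hi⇒Hi {R} r)

  degrees : Word → Vertex → Vec ℕ c
  degrees w = ColoredGraph.coloredDegree (graph w)

  degrees-left : ∀ x R {v} → ¬ Hi v → degrees (mix k x R) v ≡ degrees (mix k x blank) v
  degrees-left x R {v} ¬hi = Vec.tabulate-cong λ i → trans (deg-joined x R i v)
    (trans (cong (degLo x i v +_) (¬Hi⇒degHi≡0 {R} {i} ¬hi)) (ℕ.+-identityʳ _))

  -- Vertices without later edges keep their degree in every completion. For `δ` outside Δ and other
  -- than `𝟘`, this is the number of copies of `δ` in `M` that an accepted prefix has used.
  finished : Word → Vec ℕ c → ℕ
  finished x δ = # (λ v → (δ ≟δ degrees (mix k x blank) v) ×-dec ¬? (hi? v))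

  LoTouched HiTouched : Word → Fin c → Vertex → Set
  LoTouched x i u = ∃[ v ] LoAdj x i u v
  HiTouched R i u = ∃[ v ] HiAdj R i u v

  -- What a state has to remember. The last field tolerates a wrong degree at one frontier vertex
  -- per color; touching and linking are one-way implications, so the relation is used in both
  -- directions.
  record Agree (x y : Word) : Set where
    field
      agree-finished : ∀ δ → finished x δ ⊓ #δ δ M ≡ finished y δ ⊓ #δ δ M
      agree-touched  : ∀ i {s} → InFrontier l s → LoTouched x i s → LoTouched y i s
      agree-linked   : ∀ i {s t} → InFrontier l s → InFrontier l t → Star (LoAdj x i) s t → Star (LoAdj y i) s t
      agree-degrees  : ∀ i {s t} → InFrontier l s → InFrontier l t →
                       degLo x i s ≢ degLo y i s → degLo x i t ≢ degLo y i t → s ≡ t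

  accepted-count : ∀ {w δ} → δ ≢ 𝟘 → Accepted w →
                   #δ δ M ≤ # (λ v → δ ≟δ degrees w v) × (InΔ δ ⊎ # (λ v → δ ≟δ degrees w v) ≡ #δ δ M)
  accepted-count {w} {δ} δ≢𝟘 (ext , _) = subst (λ n → #δ δ M ≤ n × (InΔ δ ⊎ n ≡ #δ δ M))
    (used-count (graph w) δ≢𝟘) (extends⇒counts ext δ)

  finished-≤ : ∀ {x δ} → Accepted x → δ ≢ 𝟘 → ¬ InΔ δ → finished x δ ≤ #δ δ M
  finished-≤ {x} {δ} acc δ≢𝟘 ¬Δ with proj₂ (accepted-count {x} δ≢𝟘 acc)
  ... | inj₁ d  = contradiction d ¬Δ
  ... | inj₂ eq = ℕ.≤-trans (#-⊆ _ (λ v → δ ≟δ degrees x v) λ v (eq , ¬hi) →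
      trans eq (trans (sym (degrees-left x x ¬hi)) (cong (λ w → degrees w v) (mix-idem k x))))
    (ℕ.≤-reflexive eq)

  -- An accepted word has no surplus outside Δ, so truncation at the multiplicity in `M` loses
  -- nothing there.
  finished-≡ : ∀ {x y δ} → Accepted x → Accepted y → Agree x y → δ ≢ 𝟘 → ¬ InΔ δ → finished x δ ≡ finished y δ
  finished-≡ {x} {y} {δ} ax ay agree δ≢𝟘 ¬Δ = trans (sym (ℕ.m≤n⇒m⊓n≡m (finished-≤ ax δ≢𝟘 ¬Δ)))
    (trans (Agree.agree-finished agree δ) (ℕ.m≤n⇒m⊓n≡m (finished-≤ ay δ≢𝟘 ¬Δ)))

  -- The walk is cut at its first vertex with a later edge. Up to that point every step is early,
  -- and a vertex with both kinds of edges is on the frontier.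
  lo-to-frontier : ∀ {x R i a b} → Star (Adj (mix k x R) i) a b → LoTouched x i a → InFrontier l b →
                   ∃[ s ] InFrontier l s × LoTouched x i s × Star (LoAdj x i) a s
  lo-to-frontier {a = a} ε ta fb = a , fb , ta , ε
  lo-to-frontier {x} {R} {i} {a} (r ◅ walk) ta@(_ , ra) fb with hi? a
  ... | yes hia = a , (lo⇒Lo {x} ra , hia) , ta , ε
  ... | no ¬hia with joined⇒ x R r
  ...   | inj₂ h = contradiction (hi⇒Hi {R} h) ¬hia
  ...   | inj₁ r′ with s , fs , ts , walk′ ← lo-to-frontier {x} {R} walk (a , adj-sym _ i r′) fb =
    s , fs , ts , r′ ◅ walk′

  hi-to-frontier : ∀ {x R i a b} → Star (Adj (mix k x R) i) a b → HiTouched R i a → InFrontier l b →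
                   ∃[ s ] InFrontier l s × HiTouched R i s × Star (HiAdj R i) a s
  hi-to-frontier {a = a} ε ta fb = a , fb , ta , ε
  hi-to-frontier {x} {R} {i} {a} (r ◅ walk) ta@(_ , ra) fb with lo? a
  ... | yes loa = a , (loa , hi⇒Hi {R} ra) , ta , ε
  ... | no ¬loa with joined⇒ x R r
  ...   | inj₁ h = contradiction (lo⇒Lo {x} h) ¬loa
  ...   | inj₂ r′ with s , fs , ts , walk′ ← hi-to-frontier {x} {R} walk (a , adj-sym _ i r′) fb =
    s , fs , ts , r′ ◅ walk′

  private
    keeps-Lo : ∀ {x i a b} → Lo a → Star (LoAdj x i) a b → Lo b
    keeps-Lo la ε = la
    keeps-Lo {x} {i} la (r ◅ walk) = keeps-Lo {x} (lo⇒Lo {x} (adj-sym _ i r)) walk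

    keeps-Hi : ∀ {R i a b} → Hi a → Star (HiAdj R i) a b → Hi b
    keeps-Hi ha ε = ha
    keeps-Hi {R} {i} ha (r ◅ walk) = keeps-Hi {R} (hi⇒Hi {R} (adj-sym _ i r)) walk

  -- Walks between frontier vertices alternate between the two halves only at
  -- frontier vertices, so the early pieces can be replaced one by one.
  module _ {x y} (agree : Agree x y) (R : Word) (i : Fin c) where
    open Agree agree

    private
      Target : Rel Vertex 0ℓ
      Target = Star (Adj (mix k y R) i)

      Reached : Vertex → Vertex → Set
      Reached s u = ∃[ t ] InFrontier l t × Target s t × (Star (LoAdj x i) t u ⊎ Star (HiAdj R i) t u)

      settle-lo : ∀ {s t u} → InFrontier l t → InFrontier l u → Target s t → Star (LoAdj x i) t u → Target s u
      settle-lo ft fu p q = p ◅◅ Star.map (lo⇒joined y R) (agree-linked i ft fu q)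

      settle-hi : ∀ {s t u} → Target s t → Star (HiAdj R i) t u → Target s u
      settle-hi p q = p ◅◅ Star.map (hi⇒joined y R) q

      extend : ∀ {s u v} → Reached s u → Adj (mix k x R) i u v → Reached s v
      extend (t , ft , p , q) r with joined⇒ x R r | q
      ... | inj₁ r′ | inj₁ q′ = t , ft , p , inj₁ (q′ ◅◅ r′ ◅ ε)
      ... | inj₂ r′ | inj₂ q′ = t , ft , p , inj₂ (q′ ◅◅ r′ ◅ ε)
      ... | inj₁ r′ | inj₂ q′ = _ , (lo⇒Lo {x} r′ , keeps-Hi {R} (proj₂ ft) q′) , settle-hi p q′ , inj₁ (r′ ◅ ε)
      ... | inj₂ r′ | inj₁ q′ = _ , fu , settle-lo ft fu p q′ , inj₂ (r′ ◅ ε)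
        where fu = keeps-Lo {x} (proj₁ ft) q′ , hi⇒Hi {R} r′

      run : ∀ {s u v} → Reached s u → Star (Adj (mix k x R) i) u v → Reached s v
      run acc ε       = acc
      run acc (r ◅ p) = run (extend acc r) p

    exchange : ∀ {s t} → InFrontier l s → InFrontier l t → Star (Adj (mix k x R) i) s t → Target s t
    exchange {s} {t} fs ft walk with run (s , fs , ε , inj₁ ε) walk
    ... | u , fu , p , inj₁ q = settle-lo fu ft p q
    ... | u , fu , p , inj₂ q = settle-hi p q

  accepted-walk : ∀ w → Accepted w → ∀ i {a a′ b b′} → Adj w i a a′ → Adj w i b b′ → Star (Adj w i) a b
  accepted-walk w (_ , linked) i r s = linked i (_ , r) (_ , s)

  accepted-self : ∀ {x} → Accepted x → Accepted (mix k x x)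
  accepted-self {x} = subst Accepted (sym (mix-idem k x))

  FrontierUntouched : Word → Fin c → Set
  FrontierUntouched x i = ∀ s → InFrontier l s → ¬ LoTouched x i s

  -- A walk can change halves only at a frontier vertex touched by the early part; without one,
  -- connectivity confines the color to a single half.
  one-sided : ∀ {x R i} → Accepted (mix k x R) → FrontierUntouched x i →
              ∀ {a b} → LoTouched x i a → ¬ HiTouched R i b
  one-sided {x} {R} {i} acc unt {a} {b} ta@(_ , ra) tb@(_ , rb) =
    unt b (lo⇒Lo {x} (proj₂ tb′) , hi⇒Hi {R} rb) tb′
    where
    stays : ∀ {u v} → LoTouched x i u → Adj (mix k x R) i u v → LoTouched x i v
    stays {u} tu@(_ , ru) r with joined⇒ x R r
    ... | inj₁ r′ = u , adj-sym _ i r′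
    ... | inj₂ r′ = contradiction tu (unt u (lo⇒Lo {x} ru , hi⇒Hi {R} r′))

    tb′ : LoTouched x i b
    tb′ = Degrees.closed-star (ColoredGraph.D? (joined x R) i) {LoTouched x i} stays ta
      (accepted-walk (mix k x R) acc i (lo⇒joined x R ra) (hi⇒joined x R rb))

  -- The right-hand side of `ends-over` is at least 2.
  leaf-exists : ∀ i → ∃[ δ ] δ ∈ M × Vec.lookup δ i ≡ 1
  leaf-exists i = from-sum M (ℕ.≤-trans (ℕ.≤-trans (s≤s z≤n) (ℕ.m≤n+m 2 _)) (ℕ.≤-reflexive (sym (ends-over i))))
    where
    from-sum : ∀ xs → 1 ≤ ∑ xs (λ δ → 𝟙 (Vec.lookup δ i ℕ.≟ 1)) → ∃[ δ ] δ ∈ xs × Vec.lookup δ i ≡ 1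
    from-sum (δ ∷ xs) le = by (Vec.lookup δ i ℕ.≟ 1) le
      where
      by : (d : Dec (Vec.lookup δ i ≡ 1)) → 1 ≤ 𝟙 d + ∑ xs (λ δ → 𝟙 (Vec.lookup δ i ℕ.≟ 1)) →
           ∃[ δ′ ] δ′ ∈ δ ∷ xs × Vec.lookup δ′ i ≡ 1
      by (yes eq) _  = δ , here refl , eq
      by (no _)   le with δ′ , δ∈ , eq ← from-sum xs le = δ′ , there δ∈ , eq

  -- If the color-i part lies entirely to the left, then so does a leaf of color i.
  lo-nonempty : ∀ {x y i} → Accepted x → Agree x y → FrontierUntouched x i →
                ∀ {a} → LoTouched x i a → ∃[ b ] LoTouched y i b
  lo-nonempty {x} {y} {i} acc agree unt ta =
    to-y (#≥1⁻ (λ v → δ ≟δ degrees x v) (ℕ.≤-trans count≥1 (proj₁ (accepted-count {x} δ≢𝟘 acc))))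
    where
    δ   = proj₁ (leaf-exists i)
    δ∈  = proj₁ (proj₂ (leaf-exists i))
    one = proj₂ (proj₂ (leaf-exists i))

    δ≢𝟘 : δ ≢ 𝟘
    δ≢𝟘 eq with () ← trans (sym one) (trans (cong (λ δ → Vec.lookup δ i) eq) (Vec.lookup-replicate i 0))

    count≥1 : 1 ≤ #δ δ M
    count≥1 = ∈⇒count≥1 _≟δ_ δ∈

    touched-by : ∀ w {v} → δ ≡ degrees w v → ∃[ u ] Adj w i v u
    touched-by w {v} eq = Degrees.deg≥1⇒touched (ColoredGraph.D? (graph w) i) {v}
      (ℕ.≤-reflexive (trans (sym one) (trans (cong (λ δ → Vec.lookup δ i) eq) (lookup-degree (graph w) v i))))

    from-left : ∀ {v} → δ ≡ degrees x v → LoTouched x i v → ∃[ b ] LoTouched y i b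
    from-left {v} eq (_ , r) = proj₁ found , touched-by (mix k y blank) (proj₁ (proj₂ found))
      where
      ¬hi : ¬ Hi v
      ¬hi hiv = unt v (lo⇒Lo {x} r , hiv) (_ , r)

      finished-x : 1 ≤ finished x δ
      finished-x = #≥1 (λ v → (δ ≟δ degrees (mix k x blank) v) ×-dec ¬? (hi? v)) {v}
        (trans eq (trans (cong (λ w → degrees w v) (sym (mix-idem k x))) (degrees-left x x ¬hi)) , ¬hi)

      finished-y : 1 ≤ finished y δ
      finished-y = ℕ.≤-trans (ℕ.⊓-glb finished-x count≥1)
        (ℕ.≤-trans (ℕ.≤-reflexive (Agree.agree-finished agree δ)) (ℕ.m⊓n≤m _ _))

      found = #≥1⁻ (λ v → (δ ≟δ degrees (mix k y blank) v) ×-dec ¬? (hi? v)) finished-y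

    to-y : (∃[ v ] δ ≡ degrees x v) → ∃[ b ] LoTouched y i b
    to-y (v , eq) with _ , r ← touched-by (mix k x x) (trans eq (cong (λ w → degrees w v) (sym (mix-idem k x))))
      with joined⇒ x x r
    ... | inj₂ h  = contradiction (_ , h) (one-sided {x} {x} (accepted-self acc) unt ta)
    ... | inj₁ r′ = from-left eq (_ , r′)

  private
    -- The color lies in one half only. If `y` has none of it early, neither has `x`, and the walks
    -- come from the completion of `x`; otherwise the suffix has none of it, and the walks come from
    -- the accepted word `y`.
    transfer-untouched : ∀ {x y R} → Accepted x → Accepted y → Agree x y → Agree y x → Accepted (mix k x R) →
      ∀ {i} → FrontierUntouched x i → FrontierUntouched y i → Dec (∃[ b ] LoTouched y i b) →
      ∀ {a a′ b b′} → Adj (mix k y R) i a a′ → Adj (mix k y R) i b b′ → Star (Adj (mix k y R) i) a b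
    transfer-untouched {x} {y} {R} ax ay xy yx az {i} unt-x unt-y (no empty-y) r r′ =
      Star.map (λ e → hi⇒joined y R (only-hi-x e))
        (accepted-walk (mix k x R) az i (hi⇒joined x R (only-hi-y r)) (hi⇒joined x R (only-hi-y r′)))
      where
      only-hi-y : ∀ {u v} → Adj (mix k y R) i u v → HiAdj R i u v
      only-hi-y r with joined⇒ y R r
      ... | inj₁ r′ = contradiction (_ , _ , r′) empty-y
      ... | inj₂ r′ = r′

      only-hi-x : ∀ {u v} → Adj (mix k x R) i u v → HiAdj R i u v
      only-hi-x r with joined⇒ x R r
      ... | inj₁ r′ = contradiction (lo-nonempty {x} {y} ax xy unt-x (_ , r′)) empty-y
      ... | inj₂ r′ = r′
    transfer-untouched {x} {y} {R} ax ay xy yx az {i} unt-x unt-y (yes (b , tb)) r r′ =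
      Star.map (λ e → lo⇒joined y R (only-lo y e (one-sided {y} {y} (accepted-self ay) unt-y tb)))
        (accepted-walk (mix k y y) (accepted-self ay) i
          (lo⇒joined y y (only-lo R r hi-empty)) (lo⇒joined y y (only-lo R r′ hi-empty)))
      where
      hi-empty : ∀ {b} → ¬ HiTouched R i b
      hi-empty = one-sided {x} {R} az unt-x (proj₂ (lo-nonempty {y} {x} ay yx unt-y tb))

      only-lo : ∀ Q {u v} → Adj (mix k y Q) i u v → (∀ {b} → ¬ HiTouched Q i b) → LoAdj y i u v
      only-lo Q r none-hi with joined⇒ y Q r
      ... | inj₁ r′ = r′
      ... | inj₂ r′ = contradiction (_ , r′) none-hi

    -- Each vertex is led to the frontier inside its own half: an early one within the accepted word
    -- `y`, a late one within the completion of `x`. The frontier vertices reached are then joined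
    -- by `exchange`.
    transfer-touched : ∀ {x y R} → Accepted x → Accepted y → Agree x y → Agree y x → Accepted (mix k x R) →
      ∀ {i s₀} → InFrontier l s₀ → LoTouched y i s₀ →
      ∀ {a a′ b b′} → Adj (mix k y R) i a a′ → Adj (mix k y R) i b b′ → Star (Adj (mix k y R) i) a b
    transfer-touched {x} {y} {R} ax ay xy yx az {i} {s₀} fs₀ (_ , rs₀) r r′ = join (anchor r) (anchor r′)
      where
      Touched-x : Vertex → Set
      Touched-x v = ∃[ u ] Adj (mix k x R) i v u

      lo-touched-x : ∀ {s} → InFrontier l s → LoTouched y i s → Touched-x s
      lo-touched-x fs ts with u , r ← Agree.agree-touched yx i fs ts = u , lo⇒joined x R r

      Anchored : Vertex → Set
      Anchored a = ∃[ s ] InFrontier l s × Touched-x s × Star (Adj (mix k y R) i) a s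

      anchor-lo : ∀ {a b} → LoAdj y i a b → Anchored a
      anchor-lo r′ with s , fs , ts , walk ← lo-to-frontier {y} {y}
              (accepted-walk (mix k y y) (accepted-self ay) i (lo⇒joined y y r′) (lo⇒joined y y rs₀)) (_ , r′) fs₀ =
        s , fs , lo-touched-x fs ts , Star.map (lo⇒joined y R) walk

      anchor-hi : ∀ {a b} → HiAdj R i a b → Anchored a
      anchor-hi r′ with s , fs , (t , ts) , walk ← hi-to-frontier {x} {R}
              (accepted-walk (mix k x R) az i (hi⇒joined x R r′) (proj₂ (lo-touched-x fs₀ (_ , rs₀)))) (_ , r′) fs₀ =
        s , fs , (t , hi⇒joined x R ts) , Star.map (hi⇒joined y R) walk

      anchor : ∀ {a b} → Adj (mix k y R) i a b → Anchored a
      anchor r = [ anchor-lo , anchor-hi ]′ (joined⇒ y R r)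

      join : ∀ {a b} → Anchored a → Anchored b → Star (Adj (mix k y R) i) a b
      join (s , fs , (_ , ts) , p) (t , ft , (_ , tt′) , q) =
        p ◅◅ exchange xy R i fs ft (accepted-walk (mix k x R) az i ts tt′) ◅◅ Star.reverse (adj-sym _ i) q

  -- Connectivity is settled before degrees: this is what permits the edge bound for a splice whose
  -- degrees are still in doubt.
  transfer-linked : ∀ {x y R} → Accepted x → Accepted y → Agree x y → Agree y x → Accepted (mix k x R) →
                    Linked (joined y R)
  transfer-linked {x} {y} {R} ax ay xy yx az i {a} {b} (_ , r) (_ , r′) = by
    (Fin.any? λ s → inFrontier? l s ×-dec Degrees.touched? (adj? (mix k y blank) i) s)
    where
    by : Dec (∃[ s ] InFrontier l s × LoTouched y i s) → Star (Adj (mix k y R) i) a b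
    by (yes (s , fs , ts)) = transfer-touched ax ay xy yx az fs ts r r′
    by (no ¬touch)         = transfer-untouched ax ay xy yx az
      (λ s fs ts → ¬touch (s , fs , Agree.agree-touched xy i fs ts)) (λ s fs ts → ¬touch (s , fs , ts))
      (Fin.any? (Degrees.touched? (adj? (mix k y blank) i))) r r′

-- Recovering frontier degrees and completing exchanged prefixes

module Completion {c} {M : List (Vec ℕ c)} (shape : StarDegrees M) {G : Graph} (E : EdgeOrdering G)
  (l : Fin (EdgeOrdering.size E)) where

  open Graph G using (order; Vertex)
  open EdgeOrdering E
  open Words c size
  open WordGraphs {c} E
  open StarDegrees shape
  open Exchange shape E l

  private
    left right : List Vertex
    left  = filter (λ v → ¬? (hi? v)) (allFin order)
    right = filter hi? (allFin order)

    core : Word → List (Vec ℕ c)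
    core x = map (degrees (mix k x blank)) left

    -- Surplus copies from Δ and the isolated vertices at `𝟘` may differ between agreeing words.
    -- They have weight 0 in the sums below, so discarding them turns equal counts into equal sums.
    relevant? : (δ : Vec ℕ c) → Dec (¬ InΔ δ × δ ≢ 𝟘)
    relevant? δ = ¬? (inΔ? δ) ×-dec ¬? (δ ≟δ 𝟘)

    finished-core : ∀ x δ → finished x δ ≡ #δ δ (core x)
    finished-core x δ = begin
      finished x δ                                   ≡⟨ #-∑ both? ⟩
      ∑ᶠ (𝟙 ∘ both?)                                 ≡⟨ sym (∑-filter (λ v → ¬? (hi? v)) (𝟙 ∘ both?) (allFin order)
                                                          λ v hiv → 𝟙-no (both? v) (λ (_ , ¬hi) → hiv ¬hi)) ⟩
      ∑ left (𝟙 ∘ both?)                             ≡⟨ ∑-cong-∈ left (λ {v} v∈ → 𝟙-⇔ (both? v) (δ ≟δ degrees (mix k x blank) v) proj₁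
                                                          (_, proj₂ (∈-filter⁻ (λ v → ¬? (hi? v)) {xs = allFin order} v∈))) ⟩
      ∑ left (λ v → 𝟙 (δ ≟δ degrees (mix k x blank) v)) ≡⟨ sym (∑-map _ _ left) ⟩
      #δ δ (core x)                                  ∎
      where
      open ≡-Reasoning
      both? : ∀ v → Dec (δ ≡ degrees (mix k x blank) v × ¬ Hi v)
      both? v = (δ ≟δ degrees (mix k x blank) v) ×-dec ¬? (hi? v)

    relevant-↭ : ∀ {x y} → Accepted x → Accepted y → Agree x y →
                 filter relevant? (core x) ↭ filter relevant? (core y)
    relevant-↭ {x} {y} ax ay agree = counts-≡⇒↭ _≟δ_ λ δ → by δ (relevant? δ)
      where
      keep : ∀ {δ} xs → ¬ InΔ δ × δ ≢ 𝟘 → #δ δ (filter relevant? xs) ≡ #δ δ xs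
      keep {δ} xs rel = ∑-filter relevant? (λ δ′ → 𝟙 (δ ≟δ δ′)) xs
        λ δ′ ¬rel → 𝟙-no (δ ≟δ δ′) λ { refl → ¬rel rel }

      drop : ∀ {δ} xs → ¬ (¬ InΔ δ × δ ≢ 𝟘) → #δ δ (filter relevant? xs) ≡ 0
      drop {δ} xs ¬rel = ∑-zero (filter relevant? xs) λ {δ′} δ∈ →
        𝟙-no (δ ≟δ δ′) λ { refl → ¬rel (proj₂ (∈-filter⁻ relevant? {xs = xs} δ∈)) }

      by : ∀ δ → Dec (¬ InΔ δ × δ ≢ 𝟘) → #δ δ (filter relevant? (core x)) ≡ #δ δ (filter relevant? (core y))
      by δ (no ¬rel) = trans (drop (core x) ¬rel) (sym (drop (core y) ¬rel))
      by δ (yes rel@(¬Δ , δ≢𝟘)) = trans (keep (core x) rel) (trans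
        (trans (sym (finished-core x δ)) (trans (finished-≡ {x} {y} ax ay agree δ≢𝟘 ¬Δ) (finished-core y δ)))
        (sym (keep (core y) rel)))

    irrelevant : (h : ℕ → ℕ) → h 0 ≡ 0 → h 2 ≡ 0 → ∀ i (δ : Vec ℕ c) → ¬ (¬ InΔ δ × δ ≢ 𝟘) → h (Vec.lookup δ i) ≡ 0
    irrelevant h h0 h2 i δ ¬rel with inΔ? δ | δ ≟δ 𝟘
    ... | no ¬Δ | no δ≢𝟘 = contradiction (¬Δ , δ≢𝟘) ¬rel
    ... | no ¬Δ | yes refl = trans (cong h (Vec.lookup-replicate i 0)) h0
    ... | yes (j , two , zeros) | _ with i Fin.≟ j
    ...   | yes refl = trans (cong h two) h2
    ...   | no i≢j   = trans (cong h (zeros i i≢j)) h0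

    left-∑ : ∀ {x y} → Accepted x → Accepted y → Agree x y → (h : ℕ → ℕ) → h 0 ≡ 0 → h 2 ≡ 0 → ∀ i →
             ∑ left (λ v → h (degLo x i v)) ≡ ∑ left (λ v → h (degLo y i v))
    left-∑ {x} {y} ax ay agree h h0 h2 i = trans (as-core x) (trans (∑-↭ (λ δ → h (Vec.lookup δ i)) (relevant-↭ {x} {y} ax ay agree)) (sym (as-core y)))
      where
      as-core : ∀ z → ∑ left (λ v → h (degLo z i v)) ≡ ∑ (filter relevant? (core z)) (λ δ → h (Vec.lookup δ i))
      as-core z = trans (∑-cong left λ v → cong h (sym (lookup-degree (lo z) v i)))
        (trans (sym (∑-map _ _ left)) (sym (∑-filter relevant? (λ δ → h (Vec.lookup δ i)) (core z) (irrelevant h h0 h2 i))))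

    -- Swapping the prefix x for y inside x keeps the color-i part connected; as all
    -- degrees but the one at s cancel, the edge bound compares the two degrees at s.
    module _ {x y} (ax : Accepted x) (ay : Accepted y) (xy : Agree x y) (yx : Agree y x)
      (i : Fin c) {s} (fs : InFrontier l s) (differ : degLo x i s ≢ degLo y i s) where

      s∈ : s ∈ right
      s∈ = ∈-filter⁺ hi? (∈-allFin s) (proj₂ fs)

      rest = proj₁ (∈⇒↭ s∈)

      right↭ : right ↭ s ∷ rest
      right↭ = proj₂ (∈⇒↭ s∈)

      elsewhere : ∀ {v} → v ∈ rest → degLo x i v ≡ degLo y i v
      elsewhere {v} v∈ with lo? v
      ... | no ¬lo = trans (¬Lo⇒degLo≡0 {x} ¬lo) (sym (¬Lo⇒degLo≡0 {y} ¬lo))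
      ... | yes lov = Dec.decidable-stable (degLo x i v ℕ.≟ degLo y i v) λ differ′ →
        Unique.Unique[x∷xs]⇒x∉xs unique (subst (_∈ rest) (sym (Agree.agree-degrees xy i fs (lov , hiv) differ differ′)) v∈)
        where
        hiv : Hi v
        hiv = proj₂ (∈-filter⁻ hi? {xs = allFin order} (↭.∈-resp-↭ (↭-sym right↭) (there v∈)))

        unique : Unique (s ∷ rest)
        unique = Setoid↭ₚ.Unique-resp-↭ (setoid Vertex) (↭⇒↭ₛ right↭) (Unique.filter⁺ hi? (Unique.allFin⁺ order))

      background : (ℕ → ℕ) → ℕ
      background h = ∑ left (λ v → h (degLo x i v)) + ∑ rest (λ v → h (degLo x i v + degHi x i v))

      ∑-around : ∀ z (h : ℕ → ℕ) → ∑ left (λ v → h (degLo z i v)) ≡ ∑ left (λ v → h (degLo x i v)) →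
                 (∀ {v} → v ∈ rest → degLo z i v ≡ degLo x i v) →
                 ∑ᶠ (λ v → h (ColoredGraph.degree (joined z x) v i)) ≡ h (degLo z i s + degHi x i s) + background h
      ∑-around z h left≡ rest≡ = begin
        ∑ᶠ f
          ≡⟨ ∑-partition hi? f (allFin order) ⟩
        ∑ left f + ∑ right f
          ≡⟨ cong₂ _+_ on-left (trans (∑-cong right λ v → cong h (deg-joined z x i v)) (∑-↭ _ right↭)) ⟩
        ∑ left (λ v → h (degLo x i v)) + (h (degLo z i s + degHi x i s) + ∑ rest (λ v → h (degLo z i v + degHi x i v)))
          ≡⟨ cong (λ n → ∑ left (λ v → h (degLo x i v)) + (h (degLo z i s + degHi x i s) + n))
               (∑-cong-∈ rest λ {v} v∈ → cong (λ d → h (d + degHi x i v)) (rest≡ v∈)) ⟩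
        ∑ left (λ v → h (degLo x i v)) + (h (degLo z i s + degHi x i s) + ∑ rest (λ v → h (degLo x i v + degHi x i v)))
          ≡⟨ shuffle (∑ left (λ v → h (degLo x i v))) (h (degLo z i s + degHi x i s)) (∑ rest (λ v → h (degLo x i v + degHi x i v))) ⟩
        h (degLo z i s + degHi x i s) + background h ∎
        where
        open ≡-Reasoning
        f : Vertex → ℕ
        f v = h (ColoredGraph.degree (joined z x) v i)

        shuffle : ∀ a b c → a + (b + c) ≡ b + (a + c)
        shuffle = solve-∀

        on-left : ∑ left f ≡ ∑ left (λ v → h (degLo x i v))
        on-left = trans (∑-cong-∈ left λ {v} v∈ → cong h (trans (deg-joined z x i v)
          (trans (cong (degLo z i v +_) (¬Hi⇒degHi≡0 {x} {i} (proj₂ (∈-filter⁻ (λ v → ¬? (hi? v)) {xs = allFin order} v∈))))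
            (ℕ.+-identityʳ _)))) left≡

      isEnd excess : ℕ → ℕ
      isEnd d = 𝟙 (d ℕ.≟ 1)
      excess d = d ∸ 2

      differing-≤ : 1 ≤ degLo x i s → 1 ≤ degLo y i s → degLo x i s ≤ degLo y i s
      differing-≤ 1≤x 1≤y = unknown-degree-≤ (background isEnd) (background excess) (degHi x i s) 1≤y 1≤x
        (subst₂ (λ a b → a ≤ b + 2) (around-y isEnd refl refl) (around-y excess refl refl)
          (Degrees.ends-bound (ColoredGraph.D? (joined y x) i) (adj-sym (mix k y x) i)
            (λ {u} {v} → transfer-linked {x} {y} {x} ax ay xy yx (accepted-self ax) i {u} {v})))
        -- For `x` with its own suffix the edge bound is an equality by `ends-over`; against the
        -- inequality for `y` this gives one direction, and exchanging the roles gives the other.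
        (trans (sym (∑-around x isEnd refl (λ _ → refl)))
          (trans (satisfies-∑ᵢ (joined x x) isEnd refl refl (accepted-self ax) i)
            (trans (ends-over i) (cong (_+ 2)
              (trans (sym (satisfies-∑ᵢ (joined x x) excess refl refl (accepted-self ax) i))
                (∑-around x excess refl (λ _ → refl)))))))
        where
        around-y : ∀ h → h 0 ≡ 0 → h 2 ≡ 0 →
                   ∑ᶠ (λ v → h (ColoredGraph.degree (joined y x) v i)) ≡ h (degLo y i s + degHi x i s) + background h
        around-y h h0 h2 = ∑-around y h (sym (left-∑ {x} {y} ax ay xy h h0 h2 i)) (sym ∘ elsewhere)

    frontier-≤ : ∀ {x y} → Accepted x → Accepted y → Agree x y → Agree y x →
                 ∀ i {s} → InFrontier l s → degLo x i s ≤ degLo y i s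
    frontier-≤ {x} {y} ax ay xy yx i {s} fs = by (degLo x i s ℕ.≟ degLo y i s) (1 ℕ.≤? degLo x i s)
      where
      by : Dec (degLo x i s ≡ degLo y i s) → Dec (1 ≤ degLo x i s) → degLo x i s ≤ degLo y i s
      by (yes eq) _        = ℕ.≤-reflexive eq
      by (no _) (no ¬1≤x)  = ℕ.≤-trans (ℕ.≤-pred (ℕ.≰⇒> ¬1≤x)) z≤n
      by (no neq) (yes 1≤x) = differing-≤ {x} {y} ax ay xy yx i fs neq 1≤x
        (Degrees.touched⇒deg≥1 (adj? (mix k y blank) i)
          (Agree.agree-touched xy i fs (Degrees.deg≥1⇒touched (adj? (mix k x blank) i) 1≤x)))

  later-degrees : ∀ {x y} R → Accepted x → Accepted y → Agree x y → Agree y x →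
                  ∀ {v} → Hi v → degrees (mix k x R) v ≡ degrees (mix k y R) v
  later-degrees {x} {y} R ax ay xy yx {v} hiv = Vec.tabulate-cong λ i →
    trans (deg-joined x R i v) (trans (cong (_+ degHi R i v) (same i (lo? v))) (sym (deg-joined y R i v)))
    where
    same : ∀ i → Dec (Lo v) → degLo x i v ≡ degLo y i v
    same i (no ¬lo)  = trans (¬Lo⇒degLo≡0 {x} ¬lo) (sym (¬Lo⇒degLo≡0 {y} ¬lo))
    same i (yes lov) = ℕ.≤-antisym (frontier-≤ {x} {y} ax ay xy yx i (lov , hiv)) (frontier-≤ {y} {x} ay ax yx xy i (lov , hiv))

  private
    split-count : ∀ x R δ → # (λ v → δ ≟δ degrees (mix k x R) v) ≡
                  finished x δ + # (λ v → (δ ≟δ degrees (mix k x R) v) ×-dec hi? v)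
    split-count x R δ = begin
      # P?                                                  ≡⟨ #-∑ P? ⟩
      ∑ᶠ (𝟙 ∘ P?)                                           ≡⟨ ∑-cong (allFin order) (λ v → sym (𝟙-split (P? v) (hi? v))) ⟩
      ∑ᶠ (λ v → 𝟙 (P? v ×-dec hi? v) + 𝟙 (P? v ×-dec ¬? (hi? v)))
                                                            ≡⟨ ∑-+ (allFin order) _ _ ⟩
      ∑ᶠ (λ v → 𝟙 (P? v ×-dec hi? v)) + ∑ᶠ (λ v → 𝟙 (P? v ×-dec ¬? (hi? v)))
                                                            ≡⟨ cong₂ _+_ (sym (#-∑ (λ v → P? v ×-dec hi? v)))
                                                                 (sym (#-∑ (λ v → P? v ×-dec ¬? (hi? v)))) ⟩
      # (λ v → P? v ×-dec hi? v) + # (λ v → P? v ×-dec ¬? (hi? v))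
                                                            ≡⟨ ℕ.+-comm (# (λ v → P? v ×-dec hi? v)) _ ⟩
      # (λ v → P? v ×-dec ¬? (hi? v)) + # (λ v → P? v ×-dec hi? v)
                                                            ≡⟨ cong (_+ # (λ v → P? v ×-dec hi? v)) (#-cong
                                                                 (λ v → P? v ×-dec ¬? (hi? v))
                                                                 (λ v → (δ ≟δ degrees (mix k x blank) v) ×-dec ¬? (hi? v))
                                                                 (λ v (eq , ¬hi) → trans eq (degrees-left x R ¬hi) , ¬hi)
                                                                 (λ v (eq , ¬hi) → trans eq (sym (degrees-left x R ¬hi)) , ¬hi)) ⟩
      finished x δ + # (λ v → P? v ×-dec hi? v)             ∎
      where
      open ≡-Reasoning
      P? : ∀ v → Dec (δ ≡ degrees (mix k x R) v)
      P? v = δ ≟δ degrees (mix k x R) v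

  -- Vertices with later edges end with the same degree after either prefix, so only finished ones
  -- can differ. Their truncated counts preserve the lower bound, and outside Δ their exact counts
  -- preserve equality.
  agree⇒completes : ∀ {x y} → Accepted x → Accepted y → Agree x y → Agree y x →
                    ∀ R → Accepted (mix k x R) → Accepted (mix k y R)
  agree⇒completes {x} {y} ax ay xy yx R az@(ext , _) =
    counts⇒extends (λ δ → by δ (δ ≟δ 𝟘)) , transfer-linked {x} {y} {R} ax ay xy yx az
    where
    by : ∀ δ → Dec (δ ≡ 𝟘) → CountsMatch M (usedDegrees (joined y R)) δ
    by δ (yes refl) = subst (λ n → #δ 𝟘 M ≤ n × (InΔ 𝟘 ⊎ n ≡ #δ 𝟘 M))
      (trans (used-count-𝟘 (joined x R)) (sym (used-count-𝟘 (joined y R)))) (extends⇒counts ext 𝟘)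
    by δ (no δ≢𝟘) = subst (λ n → #δ δ M ≤ n × (InΔ δ ⊎ n ≡ #δ δ M))
      (sym (trans (used-count (joined y R) δ≢𝟘) (split-count y R δ)))
      (⊓-transfer (#δ δ M) h′ (Agree.agree-finished xy δ) (subst (λ n → #δ δ M ≤ n) count-x (proj₁ match)) ,
       exact (inΔ? δ) (proj₂ match))
      where
      h h′ : ℕ
      h  = # (λ v → (δ ≟δ degrees (mix k x R) v) ×-dec hi? v)
      h′ = # (λ v → (δ ≟δ degrees (mix k y R) v) ×-dec hi? v)

      h≡h′ : h ≡ h′
      h≡h′ = #-cong (λ v → (δ ≟δ degrees (mix k x R) v) ×-dec hi? v) (λ v → (δ ≟δ degrees (mix k y R) v) ×-dec hi? v)
                    (λ v (eq , hiv) → trans eq (later-degrees {x} {y} R ax ay xy yx hiv) , hiv)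
                    (λ v (eq , hiv) → trans eq (sym (later-degrees {x} {y} R ax ay xy yx hiv)) , hiv)

      match = accepted-count {mix k x R} δ≢𝟘 az

      count-x : # (λ v → δ ≟δ degrees (mix k x R) v) ≡ finished x δ + h′
      count-x = trans (split-count x R δ) (cong (finished x δ +_) h≡h′)

      exact : Dec (InΔ δ) → InΔ δ ⊎ # (λ v → δ ≟δ degrees (mix k x R) v) ≡ #δ δ M →
              InΔ δ ⊎ finished y δ + h′ ≡ #δ δ M
      exact (yes d) _         = inj₁ d
      exact (no ¬d) (inj₁ d)  = inj₁ d
      exact (no ¬d) (inj₂ eq) = inj₂ (trans (cong (_+ h′) (sym (finished-≡ {x} {y} ax ay xy δ≢𝟘 ¬d)))
        (trans (sym count-x) eq))

-- Counting classes of prefixes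

bit : {P : Set} → Dec P → Fin 2
bit (yes _) = suc zero
bit (no _)  = zero

bit-≡ : {P Q : Set} (p? : Dec P) (q? : Dec Q) → bit p? ≡ bit q? → P → Q
bit-≡ (yes _) (yes q) _ _ = q
bit-≡ (no ¬p) _       _ p = contradiction p ¬p

module _ {c : ℕ} where

  -- One bit per position of M: whether f still provides a copy of the entry
  -- after serving the earlier positions.
  supply : (Vec ℕ c → ℕ) → (M : List (Vec ℕ c)) → Fin (2 ^ length M)
  supply f []      = zero
  supply f (δ ∷ M) = combine (bit (1 ℕ.≤? f δ)) (supply (λ δ′ → f δ′ ∸ 𝟙 (δ′ ≟δ δ)) M)

  -- The bit at the `j`-th copy of `δ` in `M` tells whether `f δ ≥ j`, so together these bits give
  -- `f δ` truncated at its multiplicity.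
  supply-⊓ : ∀ f g M → supply f M ≡ supply g M → ∀ δ → f δ ⊓ #δ δ M ≡ g δ ⊓ #δ δ M
  supply-⊓ f g []       _  δ = trans (ℕ.⊓-zeroʳ (f δ)) (sym (ℕ.⊓-zeroʳ (g δ)))
  supply-⊓ f g (δ₀ ∷ M) eq δ = by (δ ≟δ δ₀) (supply-⊓ _ _ M (proj₂ parts) δ)
    where
    parts = Fin.combine-injective (bit (1 ℕ.≤? f δ₀)) _ (bit (1 ℕ.≤? g δ₀)) _ eq

    peel : ∀ {a b} m → (1 ≤ a → 1 ≤ b) → (1 ≤ b → 1 ≤ a) → (a ∸ 1) ⊓ m ≡ (b ∸ 1) ⊓ m →
           a ⊓ suc m ≡ b ⊓ suc m
    peel {zero}  {zero}  m to from eq = refl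
    peel {zero}  {suc b} m to from eq = contradiction (from (s≤s z≤n)) λ ()
    peel {suc a} {zero}  m to from eq = contradiction (to (s≤s z≤n)) λ ()
    peel {suc a} {suc b} m to from eq = cong suc eq

    by : (d : Dec (δ ≡ δ₀)) → (f δ ∸ 𝟙 d) ⊓ #δ δ M ≡ (g δ ∸ 𝟙 d) ⊓ #δ δ M →
         f δ ⊓ (𝟙 d + #δ δ M) ≡ g δ ⊓ (𝟙 d + #δ δ M)
    by (no _)     eq = eq
    by (yes refl) eq = peel (#δ δ M)
      (bit-≡ (1 ℕ.≤? f δ) (1 ℕ.≤? g δ) (proj₁ parts))
      (bit-≡ (1 ℕ.≤? g δ) (1 ℕ.≤? f δ) (sym (proj₁ parts))) eq

module Code {c} {M : List (Vec ℕ c)} (shape : StarDegrees M) {G : Graph} (E : EdgeOrdering G)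
  {w : ℕ} (frontier-≤w : ∀ l → length (EdgeOrdering.frontier E l) ≤ w) (l : Fin (EdgeOrdering.size E)) where

  open Graph G using (order; Vertex)
  open EdgeOrdering E
  open Words c size
  open WordGraphs {c} E
  open Exchange shape E l
  open Completion shape E l

  private
    ∈-frontier : ∀ {s} → InFrontier l s → s ∈ frontier l
    ∈-frontier {s} fs = ∈-filter⁺ (inFrontier? l) (∈-allFin s) fs

    slot : ∀ {s} → s ∈ frontier l → Fin w
    slot s∈ = inject≤ (Any.index s∈) (frontier-≤w l)

    slot-injective : ∀ {s t} (s∈ : s ∈ frontier l) (t∈ : t ∈ frontier l) → slot s∈ ≡ slot t∈ → s ≡ t
    slot-injective s∈ t∈ eq = trans (Any.lookup-index s∈) (trans
      (cong (lookup (frontier l)) (Fin.inject≤-injective _ _ (Any.index s∈) (Any.index t∈) eq)) (sym (Any.lookup-index t∈)))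

  module _ {q} (d : Fin q) where

    private
      at′ : (Vertex → Fin q) → (a : Fin w) → Dec (toℕ a < length (frontier l)) → Fin q
      at′ value a (yes a<) = value (lookup (frontier l) (fromℕ< a<))
      at′ value a (no _)   = d

    -- A frontier may have fewer than `w` vertices; its vacant slots carry the default `d`, which
    -- makes all codes equally long.
    at : (Vertex → Fin q) → Fin w → Fin q
    at value a = at′ value a (toℕ a ℕ.<? length (frontier l))

    at-slot : ∀ value {s} (s∈ : s ∈ frontier l) → at value (slot s∈) ≡ value s
    at-slot value {s} s∈ = by (toℕ (slot s∈) ℕ.<? length (frontier l))
      where
      toℕ-slot : toℕ (slot s∈) ≡ toℕ (Any.index s∈)
      toℕ-slot = Fin.toℕ-inject≤ (Any.index s∈) (frontier-≤w l)

      by : (p : Dec (toℕ (slot s∈) < length (frontier l))) → at′ value (slot s∈) p ≡ value s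
      by (yes a<) = cong value (trans (cong (lookup (frontier l))
        (Fin.toℕ-injective (trans (Fin.toℕ-fromℕ< a<) toℕ-slot))) (sym (Any.lookup-index s∈)))
      by (no ¬a<) = contradiction (subst (_< length (frontier l)) (sym toℕ-slot) (Fin.toℕ<n (Any.index s∈))) ¬a<

    encode : (Word → Fin c → Vertex → Fin q) → Word → Fin (2 ^ length M * q ^ (w * c))
    encode value x = combine (supply (finished x) M)
      (funToFin (λ p → at (value x (proj₂ (remQuot {w} c p))) (proj₁ (remQuot {w} c p))))

    module _ (value : Word → Fin c → Vertex → Fin q) {x y} (eq : encode value x ≡ encode value y) where

      private
        parts = Fin.combine-injective (supply (finished x) M) _ (supply (finished y) M) _ eq

      encode-finished : ∀ δ → finished x δ ⊓ #δ δ M ≡ finished y δ ⊓ #δ δ M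
      encode-finished = supply-⊓ (finished x) (finished y) M (proj₁ parts)

      encode-value : ∀ i {s} → InFrontier l s → value x i s ≡ value y i s
      encode-value i {s} fs = begin
        value x i s                   ≡⟨ sym (at-slot (value x i) s∈) ⟩
        at (value x i) (slot s∈)      ≡⟨ sym (entry x) ⟩
        finToFun (funToFin (f x)) p   ≡⟨ cong (λ n → finToFun n p) (proj₂ parts) ⟩
        finToFun (funToFin (f y)) p   ≡⟨ entry y ⟩
        at (value y i) (slot s∈)      ≡⟨ at-slot (value y i) s∈ ⟩
        value y i s                   ∎
        where
        open ≡-Reasoning
        s∈ = ∈-frontier fs

        p : Fin (w * c)
        p = combine (slot s∈) i

        f : Word → Fin (w * c) → Fin q
        f z p = at (value z (proj₂ (remQuot {w} c p))) (proj₁ (remQuot {w} c p))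

        entry : ∀ z → finToFun (funToFin (f z)) p ≡ at (value z i) (slot s∈)
        entry z = trans (Fin.finToFun-funToFin (f z) p)
          (cong (λ ai → at (value z (proj₂ ai)) (proj₁ ai)) (Fin.remQuot-combine (slot s∈) i))

  private
    touched? : ∀ x i s → Dec (LoTouched x i s)
    touched? x i = Degrees.touched? (adj? (mix k x blank) i)

    touch : Word → Fin c → Vertex → Fin 2
    touch x i s = bit (touched? x i s)

  touch-code : Word → Fin (2 ^ length M * 2 ^ (w * c))
  touch-code = encode zero touch

  -- With at most one frontier vertex, linking needs only the empty walk, and the one degree per
  -- color is the one that may be forgotten.
  touch-code-agree : w ≤ 1 → ∀ {x y} → touch-code x ≡ touch-code y → Agree x y
  touch-code-agree w≤1 {x} {y} eq = record
    { agree-finished = encode-finished zero touch eq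
    ; agree-touched  = λ i {s} fs → bit-≡ (touched? x i s) (touched? y i s) (encode-value zero touch eq i fs)
    ; agree-linked   = λ i fs ft _ → subst (Star _ _) (single fs ft) ε
    ; agree-degrees  = λ i fs ft _ _ → single fs ft
    }
    where
    single : ∀ {s t} → InFrontier l s → InFrontier l t → s ≡ t
    single = #≤1 (inFrontier? l) (ℕ.≤-trans (frontier-≤w l) w≤1)

  private
    linkedTo : Word → Fin c → Vertex → List Vertex
    linkedTo x i s = filter (star? (adj? (mix k x blank) i) s) (frontier l)

    -- A component is named by its first vertex in frontier order. Storing the partition thus takes
    -- at most `w` values per vertex and color, which is where `w log w` enters the exponent.
    representative : Word → Fin c → Vertex → Vertex
    representative x i s = first s (linkedTo x i s)

    self-linked : ∀ x i {s} → InFrontier l s → s ∈ linkedTo x i s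
    self-linked x i {s} fs = ∈-filter⁺ (star? (adj? (mix k x blank) i) s) (∈-frontier fs) ε

    representative-∈ : ∀ x i {s} → InFrontier l s →
                       representative x i s ∈ frontier l × Star (LoAdj x i) s (representative x i s)
    representative-∈ x i {s} fs =
      ∈-filter⁻ (star? (adj? (mix k x blank) i) s) {xs = frontier l} (first-∈ (self-linked x i fs))

    representative-cong : ∀ x i {s t} → InFrontier l s → InFrontier l t → Star (LoAdj x i) s t →
                          representative x i s ≡ representative x i t
    representative-cong x i {s} {t} fs ft p = trans (cong (first s) same) (first-default (self-linked x i ft))
      where
      same : linkedTo x i s ≡ linkedTo x i t
      same = List.filter-≐ (star? (adj? (mix k x blank) i) s) (star? (adj? (mix k x blank) i) t)
        ((λ q → Star.reverse (adj-sym _ i) p ◅◅ q) , (λ q → p ◅◅ q)) (frontier l)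

    index? : (s : Vertex) → Dec (s ∈ frontier l)
    index? s = DecMembership._∈?_ Fin._≟_ s (frontier l)

    position′ : Fin w → ∀ {s} → Dec (s ∈ frontier l) → Fin w
    position′ d (yes s∈) = slot s∈
    position′ d (no _)   = d

    position′-injective : ∀ d {s t} (s? : Dec (s ∈ frontier l)) (t? : Dec (t ∈ frontier l)) →
                          s ∈ frontier l → t ∈ frontier l → position′ d s? ≡ position′ d t? → s ≡ t
    position′-injective d (yes s∈) (yes t∈) _ _ eq = slot-injective s∈ t∈ eq
    position′-injective d (no s∉)  _        s∈ _ _ = contradiction s∈ s∉
    position′-injective d (yes _)  (no t∉)  _ t∈ _ = contradiction t∈ t∉

    -- Only the center of color i can have degree above 2, so capping at 3 hides at
    -- most one degree per color.
    cap : ℕ → Fin 4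
    cap n = fromℕ< (s≤s (ℕ.m⊓n≤n n 3))

    cap-≡ : ∀ {m n} → cap m ≡ cap n → m ⊓ 3 ≡ n ⊓ 3
    cap-≡ {m} {n} eq = trans (sym (Fin.toℕ-fromℕ< (s≤s (ℕ.m⊓n≤n m 3))))
      (trans (cong toℕ eq) (Fin.toℕ-fromℕ< (s≤s (ℕ.m⊓n≤n n 3))))

    ⊓-≢ : ∀ {m n} → m ⊓ 3 ≡ n ⊓ 3 → m ≢ n → 3 ≤ m
    ⊓-≢ {m} {n} eq m≢n = ℕ.≮⇒≥ λ m<3 → [ (λ n<3 → m≢n (trans (sym (ℕ.m≤n⇒m⊓n≡m (ℕ.<⇒≤ m<3)))
        (trans eq (ℕ.m≤n⇒m⊓n≡m (ℕ.<⇒≤ n<3)))))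
      , (λ 3≤n → ℕ.<-irrefl (trans (sym (ℕ.m≤n⇒m⊓n≡m (ℕ.<⇒≤ m<3))) (trans eq (ℕ.m≥n⇒m⊓n≡n 3≤n))) m<3) ]′
      (ℕ.<-≤-connex n 3)

    -- An early degree of at least 3 stays that large in the accepted word `x` itself, where `M`
    -- allows one such vertex per color.
    big-unique : ∀ {x} → Accepted x → ∀ i {s t} → 3 ≤ degLo x i s → 3 ≤ degLo x i t → s ≡ t
    big-unique {x} acc i {s} {t} bs bt = #≤1 (λ v → 3 ℕ.≤? ColoredGraph.degree (joined x x) v i)
      (ℕ.≤-trans (ℕ.≤-reflexive (trans (#-∑ (λ v → 3 ℕ.≤? ColoredGraph.degree (joined x x) v i))
        (satisfies-∑ᵢ (joined x x) (λ n → 𝟙 (3 ℕ.≤? n)) refl refl (accepted-self acc) i)))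
        (StarDegrees.big shape i)) (more bs) (more bt)
      where
      more : ∀ {v} → 3 ≤ degLo x i v → 3 ≤ ColoredGraph.degree (joined x x) v i
      more {v} b = ℕ.≤-trans b (ℕ.≤-trans (ℕ.m≤m+n _ (degHi x i v)) (ℕ.≤-reflexive (sym (deg-joined x x i v))))

  module _ (d : Fin w) where

    private
      value : Word → Fin c → Vertex → Fin (4 * w)
      value x i s = combine (cap (degLo x i s)) (position′ d (index? (representative x i s)))

      default : Fin (4 * w)
      default = combine {4} zero d

    partition-code : Word → Fin (2 ^ length M * (4 * w) ^ (w * c))
    partition-code = encode default value

    partition-code-agree : ∀ {x y} → Accepted x → partition-code x ≡ partition-code y → Agree x y
    partition-code-agree {x} {y} ax eq = record
      { agree-finished = encode-finished default value eq
      ; agree-touched  = λ i fs ts → Degrees.deg≥1⇒touched (adj? (mix k y blank) i)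
          (positive (same-cap i fs) (Degrees.touched⇒deg≥1 (adj? (mix k x blank) i) ts))
      ; agree-linked   = λ i {s} {t} fs ft p →
          subst (Star (LoAdj y i) s)
            (trans (sym (same-rep i fs)) (trans (representative-cong x i fs ft p) (same-rep i ft)))
            (proj₂ (representative-∈ y i fs))
          ◅◅ Star.reverse (adj-sym _ i) (proj₂ (representative-∈ y i ft))
      ; agree-degrees  = λ i fs ft ds dt → big-unique {x} ax i (⊓-≢ (same-cap i fs) ds) (⊓-≢ (same-cap i ft) dt)
      }
      where
      parts : ∀ i {s} → InFrontier l s → _
      parts i {s} fs = Fin.combine-injective (cap (degLo x i s)) (position′ d (index? (representative x i s)))
        (cap (degLo y i s)) (position′ d (index? (representative y i s))) (encode-value default value eq i fs)

      same-cap : ∀ i {s} → InFrontier l s → degLo x i s ⊓ 3 ≡ degLo y i s ⊓ 3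
      same-cap i fs = cap-≡ (proj₁ (parts i fs))

      same-rep : ∀ i {s} → InFrontier l s → representative x i s ≡ representative y i s
      same-rep i {s} fs = position′-injective d (index? (representative x i s)) (index? (representative y i s))
        (proj₁ (representative-∈ x i fs)) (proj₁ (representative-∈ y i fs)) (proj₂ (parts i fs))

      positive : ∀ {m n} → m ⊓ 3 ≡ n ⊓ 3 → 1 ≤ m → 1 ≤ n
      positive {suc m} {suc n} _ _ = s≤s z≤n

-- The numerical width bound

n<2^[1+⌊log₂n⌋] : ∀ n → n < 2 ^ (1 + ⌊log₂ n ⌋)
n<2^[1+⌊log₂n⌋] n = ℕ.≰⇒> λ le → ℕ.<-irrefl refl
  (ℕ.≤-trans (ℕ.≤-reflexive (sym (⌊log₂[2^n]⌋≡n (1 + ⌊log₂ n ⌋)))) (⌊log₂⌋-mono-≤ le))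

-- Two bits for the capped degree and one for rounding the logarithm down make `3 + ⌊log₂ w⌋`; as
-- the logarithm is at least 1 for `w ≥ 2`, the 3 is absorbed. This is the origin of the constant 4.
4w≤2^[4log] : ∀ {w} → 2 ≤ w → 4 * w ≤ 2 ^ (4 * ⌊log₂ w ⌋)
4w≤2^[4log] {w} 2≤w = begin
  4 * w                       ≤⟨ ℕ.*-monoʳ-≤ 4 (ℕ.<⇒≤ (n<2^[1+⌊log₂n⌋] w)) ⟩
  2 ^ 2 * 2 ^ (1 + ⌊log₂ w ⌋) ≡⟨ sym (ℕ.^-distribˡ-+-* 2 2 (1 + ⌊log₂ w ⌋)) ⟩
  2 ^ (3 + ⌊log₂ w ⌋)         ≤⟨ ℕ.^-monoʳ-≤ 2 (ℕ.≤-trans (ℕ.+-monoˡ-≤ ⌊log₂ w ⌋ (ℕ.*-monoʳ-≤ 3 1≤log))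
                                   (ℕ.≤-reflexive (ℕ.+-comm (3 * ⌊log₂ w ⌋) ⌊log₂ w ⌋))) ⟩
  2 ^ (4 * ⌊log₂ w ⌋)         ∎
  where
  open ℕ.≤-Reasoning
  1≤log : 1 ≤ ⌊log₂ w ⌋
  1≤log = ⌊log₂⌋-mono-≤ 2≤w

module _ {c} {M : List (Vec ℕ c)} (shape : StarDegrees M) {G : Graph} (E : EdgeOrdering G) where

  private
    module E = EdgeOrdering E
    open Words c E.size
    open WordGraphs {c} E

    Accepted : Word → Set
    Accepted x = Satisfies (graph x) M

    module N = Nerode {c} {E.size} Accepted (λ x → satisfies? (graph x) M)

    w : ℕ
    w = E.maxFrontierSize

    frontier-≤w : ∀ l → length (E.frontier l) ≤ w
    frontier-≤w l = All.lookup (xs≤max 0 (map (length ∘ E.frontier) (allFin E.size))) (∈-map⁺ (length ∘ E.frontier) (∈-allFin l))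

    width-bound : ∀ {n} → length M ≤ n → 1 ≤ c → ∀ w → (∀ l → length (E.frontier l) ≤ w) →
                  DD.width N.diagram ≤ 2 ^ (4 * (c * (w * ⌊log₂ w ⌋)) + n) * (2 ^ c * c) ^ w
    width-bound {n} M≤n 1≤c w fr≤ = by (w ℕ.≤? 1)
      where
      open ℕ.≤-Reasoning

      sound : ∀ {N} (code : ∀ l → Word → Fin N) →
              (∀ l {x y} → Accepted x → Accepted y → code l x ≡ code l y → Exchange.Agree shape E l x y) →
              DD.width N.diagram ≤ N
      sound code agree = N.width-≤ code λ l {x} {y} ax ay eq → N.mk≈ λ R →
        Completion.agree⇒completes shape E l ax ay (agree l ax ay eq) (agree l ay ax (sym eq)) R ,
        Completion.agree⇒completes shape E l ay ax (agree l ay ax (sym eq)) (agree l ax ay eq) R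

      by : Dec (w ≤ 1) → DD.width N.diagram ≤ 2 ^ (4 * (c * (w * ⌊log₂ w ⌋)) + n) * (2 ^ c * c) ^ w
      -- One bit per slot and color fits into `(2 ^ c) ^ w`.
      by (yes w≤1) = begin
        DD.width N.diagram              ≤⟨ sound (Code.touch-code shape E fr≤)
                                             (λ l _ _ → Code.touch-code-agree shape E fr≤ l w≤1) ⟩
        2 ^ length M * 2 ^ (w * c)      ≤⟨ ℕ.*-mono-≤ (ℕ.^-monoʳ-≤ 2 (ℕ.≤-trans M≤n (ℕ.m≤n+m n (4 * (c * (w * ⌊log₂ w ⌋))))))
                                             (ℕ.≤-trans (ℕ.≤-reflexive (trans (cong (2 ^_) (ℕ.*-comm w c)) (sym (ℕ.^-*-assoc 2 c w))))
                                               (ℕ.^-monoˡ-≤ w (ℕ.≤-trans (ℕ.≤-reflexive (sym (ℕ.*-identityʳ (2 ^ c)))) (ℕ.*-monoʳ-≤ (2 ^ c) 1≤c)))) ⟩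
        2 ^ (4 * (c * (w * ⌊log₂ w ⌋)) + n) * (2 ^ c * c) ^ w ∎
      by (no w≰1) = begin
        DD.width N.diagram              ≤⟨ sound (λ l → Code.partition-code shape E fr≤ l (fromℕ< {0} (ℕ.≤-trans (s≤s z≤n) 2≤w)))
                                             (λ l ax _ → Code.partition-code-agree shape E fr≤ l _ ax) ⟩
        2 ^ length M * (4 * w) ^ (w * c) ≤⟨ ℕ.*-mono-≤ (ℕ.^-monoʳ-≤ 2 M≤n) (ℕ.^-monoˡ-≤ (w * c) (4w≤2^[4log] 2≤w)) ⟩
        2 ^ n * (2 ^ (4 * ⌊log₂ w ⌋)) ^ (w * c)
                                        ≡⟨ cong (2 ^ n *_) (trans (ℕ.^-*-assoc 2 (4 * ⌊log₂ w ⌋) (w * c))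
                                             (cong (2 ^_) (arith ⌊log₂ w ⌋ w c))) ⟩
        2 ^ n * 2 ^ (4 * (c * (w * ⌊log₂ w ⌋)))
                                        ≡⟨ trans (ℕ.*-comm (2 ^ n) _) (sym (ℕ.^-distribˡ-+-* 2 (4 * (c * (w * ⌊log₂ w ⌋))) n)) ⟩
        2 ^ (4 * (c * (w * ⌊log₂ w ⌋)) + n)
                                        ≤⟨ ℕ.m≤m*n _ ((2 ^ c * c) ^ w) {{>-nonZero positive}} ⟩
        2 ^ (4 * (c * (w * ⌊log₂ w ⌋)) + n) * (2 ^ c * c) ^ w ∎
        where
        2≤w : 2 ≤ w
        2≤w = ℕ.≰⇒> w≰1

        arith : ∀ L w c → 4 * L * (w * c) ≡ 4 * (c * (w * L))
        arith = solve-∀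

        positive : 1 ≤ (2 ^ c * c) ^ w
        positive = ℕ.m^n>0 (2 ^ c * c) {{>-nonZero (ℕ.*-mono-≤ (ℕ.m^n>0 2 c) 1≤c)}} w

  profileDiagram : ∀ {n} → length M ≤ n → 1 ≤ c →
    Σ[ Z ∈ DD c E.size ]
      DD.Represents Z (λ B → SatisfiesC* M (coloredSubgraph E B)) ×
      DD.width Z ≤ 2 ^ (4 * (c * (w * ⌊log₂ w ⌋)) + n) * (2 ^ c * c) ^ w
  profileDiagram M≤n 1≤c = N.diagram ,
    (λ B → ⇔-trans (N.represents B) (subgraph⇔graph M B)) ,
    width-bound M≤n 1≤c w frontier-≤w
    where
    ⇔-trans : {A B C : Set} → A ⇔ B → B ⇔ C → A ⇔ C
    ⇔-trans p q = mk⇔ (Equivalence.to q ∘ Equivalence.to p) (Equivalence.from p ∘ Equivalence.from q)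

theorem4 : ∃[ C ] ∀ (H : Graph) → 2 ≤ Graph.order H →
    ∀ (c : ℕ) → 1 ≤ c → IsVertexCoverNumber H c →
    ∀ (Hᶜ : ColoredGraph c) → IsStarColorization H Hᶜ →
    let M = ColoredGraph.DS Hᶜ in
    IsExtendedProfile M (𝒮 H) ×
    (∀ (G : Graph) (E : EdgeOrdering G) →
    let w = EdgeOrdering.maxFrontierSize E in
    Σ[ Z ∈ DD c (EdgeOrdering.size E) ]
    DD.Represents Z (λ B → SatisfiesC* M (coloredSubgraph E B)) ×
    DD.width Z ≤ 2 ^ (C * (c * (w * ⌊log₂ w ⌋)) + Graph.order H) * (2 ^ c * c) ^ w)
theorem4 = 4 , λ H _ c 1≤c _ Hᶜ colorization →
  extendedProfile H Hᶜ colorization ,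
  λ G E → profileDiagram (starDegrees Hᶜ λ i → isStar⇒center Hᶜ i (IsStarColorization.star colorization i)) E
    (DS-length H Hᶜ colorization) 1≤c
  where
  DS-length : ∀ {c} H (Hᶜ : ColoredGraph c) → IsStarColorization H Hᶜ →
              length (ColoredGraph.DS Hᶜ) ≤ Graph.order H
  DS-length H Hᶜ colorization = ℕ.≤-trans
    (ℕ.≤-reflexive (trans (List.length-map coloredDegree (allFin order)) (List.length-tabulate {n = order} id)))
    (Fin.injective⇒≤ {f = to} λ {u} {v} eq →
      trans (sym (strictlyInverseʳ u)) (trans (cong from eq) (strictlyInverseʳ v)))
    where
    open ColoredGraph Hᶜ
    open Inverse (_≅_.bijection (IsStarColorization.colorizes colorization)) using (to; from; strictlyInverseʳ)
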